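{- Let $(\mathcal{S}^x,H)$ be a finite thick STGQ of order $(s,t)$ with group of symmetries $\mathbb{S}$ and Kantor family $(\mathcal{F},\mathcal{F}^*)$, which is generic (i.e. $H/\mathbb{S}$ is non-abelian). Suppose that the projection lemma holds for $(\mathcal{S}^x,H)$, i.e. the only subgroup $M\le H$ with $M\mathbb{S}=H$ is $M=H$. Suppose moreover that at least one of the following holds: (a) $\Gamma(\Phi)$ is a dual partial linear space; (b) for all distinct $A,B\in\mathcal{F}$ and every maximal subgroup $K$ of $H$ not containing $A$, we have $\langle A\cap K,B\rangle\neq H$. Then the Frattini subgroup $\Phi(H)$ is the elation group of a sub-STGQ of order $(t,t)$ (containing $x$), so that $s=t^2$.
   Context: A finite GQ of order $(s,t)$: every line has $s+1$ points, every point lies on $t+1$ lines, and for each point $p$ and line $L$ not through $p$ exactly one point of $L$ is collinear with $p$; thick means $s,t\ge2$. An EGQ $(\mathcal{S}^x,H)$: $H\le\mathrm{Aut}(\mathcal{S})$ fixes every line through $x$ and acts sharply transitively on the affine points (points not collinear with $x$). A symmetry with center $x$ fixes every point collinear with $x$; an STGQ is an EGQ of order $(s,t)$ whose elation group contains a group $\mathbb{S}$ of $t$ symmetries with center $x$. Kantor family: fix an affine point $z$, let $U_0,\dots,U_t$ be the lines through $z$ and $u_i$ the point of $U_i$ collinear with $x$; $\mathcal{F}=\{H_{U_i}\}$, $\mathcal{F}^*=\{H_{u_i}\}$ (stabilizers in $H$). Write $\Phi=\Phi(H)$. The geometry $\Gamma(\Phi)$: its points are the $\Phi$-orbits on affine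 points; its lines are the $\Phi$-orbits on the sets $L\setminus\{x\}$ for lines $L$ through $x$; a point-orbit $u$ is incident with a line-orbit $V$ if some point of $V$ is collinear with some point of $u$. A dual partial linear space is one in which two distinct lines share at most one point. -}

module Defs where

open import Data.Nat using (ℕ; zero; suc; _+_; _*_; _≤_)
open import Data.Fin using (Fin; zero; suc)
open import Data.Bool using (Bool; true; false; _∧_; _∨_; if_then_else_)
open import Data.Product using (Σ; _×_; _,_; ∃; ∃-syntax)
open import Data.Sum using (_⊎_)
open import Relation.Nullary using (¬_)
open import Relation.Nullary.Decidable using (⌊_⌋)
open import Relation.Binary.PropositionalEquality using (_≡_)
open import Algebra.Structures using (IsGroup)
import Data.Fin.Properties as FinP

count : ∀ {n} → (Fin n → Bool) → ℕ
count {zero}  f = 0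
count {suc n} f = (if f zero then 1 else 0) + count (λ i → f (suc i))

anyFin : ∀ {n} → (Fin n → Bool) → Bool
anyFin {zero}  f = false
anyFin {suc n} f = f zero ∨ anyFin (λ i → f (suc i))

_≟F_ : ∀ {n} → Fin n → Fin n → Bool
a ≟F b = ⌊ a FinP.≟ b ⌋

-- Incidence geometry on point set Fin np, line set Fin nl, incidence I.
-- A (sub)geometry is given by a point subset P and a line subset Ln,
-- with incidence inherited from I.

module Geometry {np nl : ℕ} (I : Fin np → Fin nl → Bool) where

  allP : Fin np → Bool
  allP _ = true

  allL : Fin nl → Bool
  allL _ = true

  -- p and q are collinear in the subgeometry with line set Ln
  -- (a point is collinear with itself)
  col : (Fin nl → Bool) → Fin np → Fin np → Bool
  col Ln p q = anyFin (λ L → Ln L ∧ (I p L ∧ I q L))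

  record IsGQ (P : Fin np → Bool) (Ln : Fin nl → Bool) (s t : ℕ) : Set where
    field
      lineSize : ∀ L → Ln L ≡ true → count (λ p → P p ∧ I p L) ≡ suc s
      pointDeg : ∀ p → P p ≡ true → count (λ L → Ln L ∧ I p L) ≡ suc t
      gqAxiom  : ∀ p L → P p ≡ true → Ln L ≡ true → I p L ≡ false →
                 count (λ q → P q ∧ (I q L ∧ col Ln p q)) ≡ 1

  Affine : (P : Fin np → Bool) (Ln : Fin nl → Bool) (x p : Fin np) → Set
  Affine P Ln x p = (P p ≡ true) × (col Ln x p ≡ false)

record FinGroup : Set where
  field
    order   : ℕ
    _∙_     : Fin order → Fin order → Fin order
    ε       : Fin order
    _⁻¹     : Fin order → Fin order
    isGroup : IsGroup _≡_ _∙_ ε _⁻¹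

module GroupTheory (G : FinGroup) where
  open FinGroup G

  SubsetG : Set
  SubsetG = Fin order → Bool

  record IsSubgroup (K : SubsetG) : Set where
    field
      has-ε  : K ε ≡ true
      ∙-clos : ∀ g h → K g ≡ true → K h ≡ true → K (g ∙ h) ≡ true
      ⁻¹-clos : ∀ g → K g ≡ true → K (g ⁻¹) ≡ true

  _⊆_ : SubsetG → SubsetG → Set
  A ⊆ B = ∀ g → A g ≡ true → B g ≡ true

  IsMaximal : SubsetG → Set
  IsMaximal K = IsSubgroup K × (∃[ g ] K g ≡ false) ×
    (∀ M → IsSubgroup M → K ⊆ M → (∀ g → M g ≡ true) ⊎ (M ⊆ K))

  Frattini : Fin order → Set
  Frattini g = ∀ K → IsMaximal K → K g ≡ true

  Generated : (Fin order → Set) → Fin order → Set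
  Generated X g = ∀ M → IsSubgroup M → (∀ h → X h → M h ≡ true) → M g ≡ true

  commutator : Fin order → Fin order → Fin order
  commutator g h = ((g ⁻¹) ∙ (h ⁻¹)) ∙ (g ∙ h)

record Action (G : FinGroup) {np nl : ℕ} (I : Fin np → Fin nl → Bool) : Set where
  open FinGroup G
  field
    actP : Fin order → Fin np → Fin np
    actL : Fin order → Fin nl → Fin nl
    actP-ε : ∀ p → actP ε p ≡ p
    actL-ε : ∀ L → actL ε L ≡ L
    actP-∙ : ∀ g h p → actP (g ∙ h) p ≡ actP g (actP h p)
    actL-∙ : ∀ g h L → actL (g ∙ h) L ≡ actL g (actL h L)
    preservesI : ∀ g p L → I (actP g p) (actL g L) ≡ I p L
    faithful : ∀ g → (∀ p → actP g p ≡ p) → (∀ L → actL g L ≡ L) → g ≡ ε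

module STGQ {np nl : ℕ} (I : Fin np → Fin nl → Bool) (G : FinGroup)
            (A : Action G I) where
  open FinGroup G
  open Action A
  open Geometry I
  open GroupTheory G

  record IsEGQ (x : Fin np) : Set where
    field
      fixesLinesThroughX : ∀ h L → I x L ≡ true → actL h L ≡ L
      sharplyTransitive : ∀ p q → Affine allP allL x p → Affine allP allL x q →
        Σ (Fin order) λ h → (actP h p ≡ q) × (∀ h' → actP h' p ≡ q → h' ≡ h)

  record IsSymmetryGroup (x : Fin np) (S : SubsetG) (t : ℕ) : Set where
    field
      subgroup : IsSubgroup S
      size     : count S ≡ t
      symmetry : ∀ g → S g ≡ true → ∀ p → col allL x p ≡ true → actP g p ≡ p

  Generic : SubsetG → Set
  Generic S = ∃[ g ] ∃[ h ] S (commutator g h) ≡ false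

  ProjectionLemma : SubsetG → Set
  ProjectionLemma S = ∀ M → IsSubgroup M →
    (∀ h → ∃[ m ] ∃[ σ ] (M m ≡ true) × (S σ ≡ true) × (h ≡ m ∙ σ)) →
    ∀ h → M h ≡ true

  -- Γ(Φ): points = Φ-orbits of affine points; lines = Φ-orbits of points
  -- of L∖{x}, L a line through x (i.e. points of x^⊥∖{x});
  -- u incident with V iff some point of V is collinear with some point of u.
  SameΦOrbit : Fin np → Fin np → Set
  SameΦOrbit p q = ∃[ φ ] Frattini φ × (actP φ p ≡ q)

  IsΓPoint : Fin np → Fin np → Set
  IsΓPoint x a = Affine allP allL x a

  IsΓLinePt : Fin np → Fin np → Set
  IsΓLinePt x v = (col allL x v ≡ true) × ¬ (v ≡ x)

  ΓIncident : Fin np → Fin np → Set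
  ΓIncident a v = ∃[ φ₁ ] ∃[ φ₂ ] Frattini φ₁ × Frattini φ₂ ×
    (col allL (actP φ₁ a) (actP φ₂ v) ≡ true)

  GammaDualPLS : Fin np → Set
  GammaDualPLS x = ∀ v v' a a' → IsΓLinePt x v → IsΓLinePt x v' →
    ¬ SameΦOrbit v v' → IsΓPoint x a → IsΓPoint x a' →
    ΓIncident a v → ΓIncident a v' → ΓIncident a' v → ΓIncident a' v' →
    SameΦOrbit a a'

  -- stabilizer in H of a line (member of the Kantor family when the line
  -- passes through the base affine point z)
  Stab : Fin nl → SubsetG
  Stab U g = actL g U ≟F U

  ConditionB : Fin np → Set
  ConditionB z = ∀ U V → I z U ≡ true → I z V ≡ true → ¬ (U ≡ V) →
    ∀ K → IsMaximal K → ¬ (Stab U ⊆ K) →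
    ¬ (∀ g → Generated (λ h → (Stab U h ∧ K h) ≡ true ⊎ Stab V h ≡ true) g)

  record PhiSubSTGQ (x : Fin np) (t : ℕ) (P' : Fin np → Bool)
                    (L' : Fin nl → Bool) : Set where
    field
      subGQ   : IsGQ P' L' t t
      hasX    : P' x ≡ true
      stabP   : ∀ φ → Frattini φ → ∀ p → P' (actP φ p) ≡ P' p
      stabL   : ∀ φ → Frattini φ → ∀ L → L' (actL φ L) ≡ L' L
      fixesLinesThroughX : ∀ φ → Frattini φ → ∀ L → L' L ≡ true →
        I x L ≡ true → actL φ L ≡ L
      sharplyTransitive : ∀ p q → Affine P' L' x p → Affine P' L' x q →
        Σ (Fin order) λ φ → Frattini φ × (actP φ p ≡ q) ×
          (∀ φ' → Frattini φ' → actP φ' p ≡ q → φ' ≡ φ)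
      symGroup : Σ SubsetG λ T → IsSubgroup T ×
        (∀ g → T g ≡ true → Frattini g) × (count T ≡ t) ×
        (∀ g → T g ≡ true → ∀ p → P' p ≡ true → col L' x p ≡ true →
           actP g p ≡ p)

{-# OPTIONS --safe #-}
module Submission where

-- Write H for the elation group, S for the group of symmetries and Φ for the Frattini subgroup.
-- Modulo S, the stabilisers in H of points on different lines through x meet trivially; applied to a Sylow
-- p-subgroup this gives t ≤ p^a for the p-part p^a of s, so with Higman's s ≤ t² only one prime divides s.
-- Hence H/S is a p-group, and as S ≤ Φ by the projection lemma, all maximal subgroups of H are normal and
-- Φ contains all commutators. Each of (a) and (b) then says that, for distinct lines U, V through z, the point of
-- U collinear with the Φ-image of the point of V in x^⊥ again lies in the Φ-orbit of z. This makes the Φ-orbit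
-- of z the affine part of a subquadrangle of order (s₁,t); s₁ ≥ 2 because H/S is not abelian, the bound above
-- applied to Φ gives t ≤ s₁, and projection onto a line outside the subquadrangle gives t s₁ ≤ s ≤ t².

open import Defs
open import Algebra.Bundles using (Group)
open import Algebra.Structures using (IsGroup)
import Algebra.Properties.Group as GroupProperties
open import Data.Bool using (Bool; true; false; if_then_else_; _∧_)
import Data.Bool.Properties as Bool
open import Data.Empty using (⊥; ⊥-elim)
open import Data.Fin using (Fin; zero; suc; splitAt; _↑ˡ_; _↑ʳ_; join)
open import Data.Fin.Properties using (any?; all?; ¬∀⟶∃¬; splitAt-↑ˡ; splitAt-↑ʳ; join-splitAt) renaming (_≟_ to _≟ᶠ_)
open import Data.List using ([]; _∷_)
open import Data.List.Relation.Unary.All using (All; []; _∷_)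
open import Data.Nat
open import Data.Nat.Combinatorics using (_C_; nCk+nC[k+1]≡[n+1]C[k+1]; nC1≡n)
open import Data.Nat.Combinatorics.Specification using (k>n⇒nCk≡0)
open import Data.Nat.Divisibility
open import Data.Nat.ListAction using (product)
open import Data.Nat.Primality using (Prime; euclidsLemma; prime⇒nonZero; prime⇒nonTrivial; prime⇒irreducible)
open import Data.Nat.Primality.Factorisation using (PrimeFactorisation; factorise)
open import Data.Nat.Properties
open import Data.Nat.Tactic.RingSolver using (solve-∀)
open import Data.Product using (Σ; _×_; _,_; proj₁; proj₂; ∃; ∃-syntax)
open import Data.Sum using (_⊎_; inj₁; inj₂; [_,_]′)
open import Function using (_∘_; id; const; mk⇔)
open import Level using (0ℓ)
open import Relation.Binary.PropositionalEquality
open import Relation.Nullary using (¬_; Dec; yes; no; does; contradiction; ¬?; _×-dec_; _→-dec_; _⊎-dec_; decidable-stable)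
open import Relation.Nullary.Decidable using (map′; toSum; dec-true; dec-false; does-⇔)
open import Relation.Unary using (Decidable)
open import Algebra.Properties.Semiring.Sum +-*-semiring using (sum; sum-cong-≗; ∑-distrib-+; ∑-comm; *-distribˡ-sum)

-- Counting

-- H is not assumed to be a p-group; only the order s² of H/S turns out to be a power of a prime.
-- The projection lemma makes up for this: since S lies in every maximal subgroup, the p-group
-- arguments for normality and commutators run on subgroups containing S, with the factor t
-- cancelled and without forming the quotient. The closure property drawn from (a) or (b) is stated
-- at the base point z alone and carried to the rest of its orbit by Φ. Since S lies in Φ and
-- permutes transitively the lines through a point v of x^⊥ other than the line joining v to x, the
-- substructure contains every line through each of its points. Its second parameter is therefore t
-- from the start, and only the number of points per line has to be found. Two obstacles shape the
-- development. Maximal subgroups and Φ are defined by quantifying over Boolean functions, so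
-- subsets are coded by numbers to make these notions decidable. And the counting axioms do not say
-- that two points determine a line, so the first lemmas on symmetries have to be proved before
-- linearity is available.

does⁻ : {A : Set} (d : Dec A) → does d ≡ true → A
does⁻ (yes a) _ = a

1[_] : {A : Set} → Dec A → ℕ
1[ d ] = if does d then 1 else 0

1-yes : {A : Set} (d : Dec A) → A → 1[ d ] ≡ 1
1-yes d a = cong (λ b → if b then 1 else 0) (dec-true d a)

1-no : {A : Set} (d : Dec A) → ¬ A → 1[ d ] ≡ 0
1-no d ¬a = cong (λ b → if b then 1 else 0) (dec-false d ¬a)

1-mono : {A B : Set} (a? : Dec A) (b? : Dec B) → (A → B) → 1[ a? ] ≤ 1[ b? ]
1-mono (no _) _ _ = z≤n
1-mono (yes _) (yes _) _ = ≤-refl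
1-mono (yes a) (no ¬b) f = contradiction (f a) ¬b

1-split : {A B : Set} (a? : Dec A) (b? : Dec B) → 1[ a? ] ≡ 1[ a? ×-dec b? ] + 1[ a? ×-dec ¬? b? ]
1-split (no _) _ = refl
1-split (yes _) (yes _) = refl
1-split (yes _) (no _) = refl

infix 8 #_

-- Opaque, so that unification recovers the predicate from a count.
opaque
  #_ : ∀ {n} {P : Fin n → Set} → Decidable P → ℕ
  # P? = sum λ i → 1[ P? i ]

  #-def : ∀ {n} {P : Fin n → Set} (P? : Decidable P) → # P? ≡ sum λ i → 1[ P? i ]
  #-def P? = refl

sum-mono : ∀ {n} {f g : Fin n → ℕ} → (∀ i → f i ≤ g i) → sum f ≤ sum g
sum-mono {zero} _ = z≤n
sum-mono {suc _} le = +-mono-≤ (le zero) (sum-mono (le ∘ suc))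

module _ {n : ℕ} where

  module _ {P Q : Fin n → Set} (P? : Decidable P) (Q? : Decidable Q) where

    #-mono : (∀ i → P i → Q i) → # P? ≤ # Q?
    #-mono f = subst₂ _≤_ (sym (#-def P?)) (sym (#-def Q?)) (sum-mono λ i → 1-mono (P? i) (Q? i) (f i))

    #-split : # P? ≡ # (λ i → P? i ×-dec Q? i) + # (λ i → P? i ×-dec ¬? (Q? i))
    #-split = begin
      # P?                                                            ≡⟨ #-def P? ⟩
      sum (λ i → 1[ P? i ])                                           ≡⟨ sum-cong-≗ (λ i → 1-split (P? i) (Q? i)) ⟩
      sum (λ i → 1[ P? i ×-dec Q? i ] + 1[ P? i ×-dec ¬? (Q? i) ])
        ≡⟨ ∑-distrib-+ (λ i → 1[ P? i ×-dec Q? i ]) (λ i → 1[ P? i ×-dec ¬? (Q? i) ]) ⟩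
      sum (λ i → 1[ P? i ×-dec Q? i ]) + sum (λ i → 1[ P? i ×-dec ¬? (Q? i) ])
        ≡⟨ cong₂ _+_ (#-def (λ i → P? i ×-dec Q? i)) (#-def (λ i → P? i ×-dec ¬? (Q? i))) ⟨
      # (λ i → P? i ×-dec Q? i) + # (λ i → P? i ×-dec ¬? (Q? i)) ∎
      where open ≡-Reasoning

  #-cong : {P Q : Fin n → Set} (P? : Decidable P) (Q? : Decidable Q) →
    (∀ i → P i → Q i) → (∀ i → Q i → P i) → # P? ≡ # Q?
  #-cong P? Q? f g = ≤-antisym (#-mono P? Q? f) (#-mono Q? P? g)

  count≡# : (f : Fin n → Bool) {P : Fin n → Set} (P? : Decidable P) →
    (∀ i → f i ≡ true → P i) → (∀ i → P i → f i ≡ true) → count f ≡ # P?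
  count≡# f P? to from = trans (count≡sum f)
    (trans (sum-cong-≗ λ i → cong (λ b → if b then 1 else 0) (same i)) (sym (#-def P?)))
    where
    count≡sum : ∀ {m} (f : Fin m → Bool) → count f ≡ sum (λ i → if f i then 1 else 0)
    count≡sum {zero} f = refl
    count≡sum {suc m} f = cong ((if f zero then 1 else 0) +_) (count≡sum (f ∘ suc))
    same : ∀ i → f i ≡ does (P? i)
    same i with f i | to i | from i | P? i
    ... | true  | _ | _ | yes _ = refl
    ... | true  | t | _ | no ¬p = contradiction (t refl) ¬p
    ... | false | _ | r | yes p = r p
    ... | false | _ | _ | no _  = refl

  module _ {P : Fin n → Set} (P? : Decidable P) where

    private
      scaled : ∀ a → sum (λ i → a * 1[ P? i ]) ≡ # P? * a
      scaled a = trans (sym (*-distribˡ-sum a (λ i → 1[ P? i ]))) (trans (*-comm a _) (cong (_* a) (sym (#-def P?))))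

    sum≡#* : ∀ {f : Fin n → ℕ} {a} → (∀ i → P i → f i ≡ a) → (∀ i → ¬ P i → f i ≡ 0) → sum f ≡ # P? * a
    sum≡#* {f} {a} on off = trans (sum-cong-≗ eq) (scaled a)
      where
      eq : ∀ i → f i ≡ a * 1[ P? i ]
      eq i with P? i
      ... | yes p = trans (on i p) (sym (*-identityʳ a))
      ... | no ¬p = trans (off i ¬p) (sym (*-zeroʳ a))

    #*≤sum : ∀ {f : Fin n → ℕ} {a} → (∀ i → P i → a ≤ f i) → # P? * a ≤ sum f
    #*≤sum {f} {a} on = subst (_≤ sum f) (scaled a) (sum-mono le)
      where
      le : ∀ i → a * 1[ P? i ] ≤ f i
      le i with P? i
      ... | yes p = subst (_≤ f i) (sym (*-identityʳ a)) (on i p)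
      ... | no ¬p = subst (_≤ f i) (sym (*-zeroʳ a)) z≤n

    sum≤#* : ∀ {f : Fin n → ℕ} {b} → (∀ i → P i → f i ≤ b) → (∀ i → ¬ P i → f i ≡ 0) → sum f ≤ # P? * b
    sum≤#* {f} {b} on off = subst (sum f ≤_) (scaled b) (sum-mono le)
      where
      le : ∀ i → f i ≤ b * 1[ P? i ]
      le i with P? i
      ... | yes p = subst (f i ≤_) (sym (*-identityʳ b)) (on i p)
      ... | no ¬p = ≤-trans (≤-reflexive (off i ¬p)) z≤n

    #-none : (∀ i → ¬ P i) → # P? ≡ 0
    #-none none = trans (#-def P?) (trans (sum≡#* {a = 0} (λ i p → contradiction p (none i)) (λ i → 1-no (P? i))) (*-zeroʳ (# P?)))

  #-single : (i : Fin n) → # (λ j → j ≟ᶠ i) ≡ 1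
  #-single i = trans (#-def (λ j → j ≟ᶠ i)) (go i)
    where
    go : ∀ {m} (i : Fin m) → sum (λ j → 1[ j ≟ᶠ i ]) ≡ 1
    go {suc m} zero = cong suc (sum≡0 m)
      where
      sum≡0 : ∀ m → sum {m} (λ _ → 0) ≡ 0
      sum≡0 zero = refl
      sum≡0 (suc m) = sum≡0 m
    go (suc i) = go i

  module _ {P : Fin n → Set} (P? : Decidable P) where

    #-unique : ∀ i → P i → (∀ j → P j → j ≡ i) → # P? ≡ 1
    #-unique i p u = trans (#-cong P? (λ j → j ≟ᶠ i) u (λ { _ refl → p })) (#-single i)

    #≤1 : (∀ i j → P i → P j → i ≡ j) → # P? ≤ 1
    #≤1 u with any? P?
    ... | yes (i , p) = ≤-reflexive (#-unique i p (λ j q → u j i q p))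
    ... | no ¬p = ≤-trans (≤-reflexive (#-none P? λ i p → ¬p (i , p))) z≤n

    #-positive : ∀ i → P i → 1 ≤ # P?
    #-positive i p = subst (_≤ # P?) (#-single i) (#-mono (λ j → j ≟ᶠ i) P? λ { _ refl → p })

    #-inhabited : 1 ≤ # P? → ∃ P
    #-inhabited pos with any? P?
    ... | yes e = e
    ... | no ¬e = contradiction (subst (1 ≤_) (#-none P? λ i p → ¬e (i , p)) pos) λ ()

  module _ {P Q : Fin n → Set} (P? : Decidable P) (Q? : Decidable Q) where

    #-strict : (∀ i → P i → Q i) → ∀ i → Q i → ¬ P i → # P? < # Q?
    #-strict sub i q ¬p = begin
      suc (# P?)                                                        ≡⟨ +-comm 1 _ ⟩
      # P? + 1                                                          ≤⟨ +-mono-≤ (#-mono P? (λ j → Q? j ×-dec P? j) λ j p → sub j p , p) (#-positive Q∖P? i (q , ¬p)) ⟩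
      # (λ j → Q? j ×-dec P? j) + # Q∖P?                                ≡⟨ sym (#-split Q? P?) ⟩
      # Q? ∎
      where
      open ≤-Reasoning
      Q∖P? : Decidable (λ j → Q j × ¬ P j)
      Q∖P? j = Q? j ×-dec ¬? (P? j)

    #-tight : (∀ i → P i → Q i) → # Q? ≤ # P? → ∀ i → Q i → P i
    #-tight sub le i q with P? i
    ... | yes p = p
    ... | no ¬p = contradiction (#-strict sub i q ¬p) (≤⇒≯ le)

  module _ {P : Fin n → Set} (P? : Decidable P) where

    #≡1⇒unique : # P? ≡ 1 → ∀ {i j} → P i → P j → i ≡ j
    #≡1⇒unique one {i} {j} p q = sym (#-tight (λ j → j ≟ᶠ i) P? (λ { _ refl → p }) (≤-reflexive (trans one (sym (#-single i)))) j q)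

    #-remove : ∀ i → P i → # P? ≡ suc (# (λ j → P? j ×-dec ¬? (j ≟ᶠ i)))
    #-remove i p = trans (#-split P? (λ j → j ≟ᶠ i)) (cong (_+ # (λ j → P? j ×-dec ¬? (j ≟ᶠ i))) (#-unique (λ j → P? j ×-dec (j ≟ᶠ i)) i (p , refl) λ _ → proj₂))

module _ {m n : ℕ} {P : Fin m → Set} {Q : Fin n → Set} {R : Fin m → Fin n → Set}
         (P? : Decidable P) (Q? : Decidable Q) (R? : ∀ i j → Dec (R i j)) where

  sum-swap : sum (λ i → # (R? i)) ≡ sum (λ j → # (λ i → R? i j))
  sum-swap = begin
    sum (λ i → # (R? i))                    ≡⟨ sum-cong-≗ (λ i → #-def (R? i)) ⟩
    sum (λ i → sum (λ j → 1[ R? i j ]))     ≡⟨ ∑-comm (λ i j → 1[ R? i j ]) ⟩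
    sum (λ j → sum (λ i → 1[ R? i j ]))     ≡⟨ sum-cong-≗ (λ j → #-def (λ i → R? i j)) ⟨
    sum (λ j → # (λ i → R? i j)) ∎
    where open ≡-Reasoning

  -- Rows outside P can only enlarge the double sum, while columns outside Q must vanish; this is
  -- why R is asked to imply Q.
  double-≤ : ∀ {a b} → (∀ {i j} → R i j → Q j) → (∀ i → P i → a ≤ # (R? i)) →
    (∀ j → Q j → # (λ i → R? i j) ≤ b) → # P? * a ≤ # Q? * b
  double-≤ {a} {b} RQ row col = begin
    # P? * a                        ≤⟨ #*≤sum P? row ⟩
    sum (λ i → # (R? i))            ≡⟨ sum-swap ⟩
    sum (λ j → # (λ i → R? i j))    ≤⟨ sum≤#* Q? col (λ j ¬q → #-none (λ i → R? i j) λ i r → ¬q (RQ r)) ⟩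
    # Q? * b ∎
    where open ≤-Reasoning

  double-≡ : ∀ {a b} → (∀ {i j} → R i j → P i × Q j) → (∀ i → P i → # (R? i) ≡ a) →
    (∀ j → Q j → # (λ i → R? i j) ≡ b) → # P? * a ≡ # Q? * b
  double-≡ {a} {b} RPQ row col = begin
    # P? * a                        ≡⟨ sym (sum≡#* P? row (λ i ¬p → #-none (R? i) λ j r → ¬p (proj₁ (RPQ r)))) ⟩
    sum (λ i → # (R? i))            ≡⟨ sum-swap ⟩
    sum (λ j → # (λ i → R? i j))    ≡⟨ sum≡#* Q? col (λ j ¬q → #-none (λ i → R? i j) λ i r → ¬q (proj₂ (RPQ r))) ⟩
    # Q? * b ∎
    where open ≡-Reasoning

  double-1 : (∀ {i j} → R i j → P i × Q j) → (∀ i → P i → # (R? i) ≡ 1) →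
    (∀ j → Q j → # (λ i → R? i j) ≡ 1) → # P? ≡ # Q?
  double-1 RPQ row col = trans (sym (*-identityʳ _)) (trans (double-≡ RPQ row col) (*-identityʳ _))

module _ {m n : ℕ} {P : Fin m → Set} {Q : Fin n → Set} (P? : Decidable P) (Q? : Decidable Q) where

  #-injection : (f : Fin m → Fin n) → (∀ i → P i → Q (f i)) →
    (∀ i j → P i → P j → f i ≡ f j → i ≡ j) → # P? ≤ # Q?
  #-injection f into inj = subst₂ _≤_ (*-identityʳ _) (*-identityʳ _)
    (double-≤ P? Q? (λ i j → P? i ×-dec (f i ≟ᶠ j)) {1} {1}
      (λ { {i} (p , refl) → into i p })
      (λ i p → #-positive (λ j → P? i ×-dec (f i ≟ᶠ j)) (f i) (p , refl))
      (λ j q → #≤1 (λ i → P? i ×-dec (f i ≟ᶠ j)) λ { i k (p , e) (p′ , e′) → inj i k p p′ (trans e (sym e′)) }))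

module _ {m n : ℕ} {P : Fin m → Set} {Q : Fin n → Set} (P? : Decidable P) (Q? : Decidable Q) where

  #-bijection : (f : Fin m → Fin n) (g : Fin n → Fin m) → (∀ i → P i → Q (f i)) → (∀ j → Q j → P (g j)) →
    (∀ i → P i → g (f i) ≡ i) → (∀ j → Q j → f (g j) ≡ j) → # P? ≡ # Q?
  #-bijection f g to from gf fg = ≤-antisym
    (#-injection P? Q? f to λ i j p q e → trans (sym (gf i p)) (trans (cong g e) (gf j q)))
    (#-injection Q? P? g from λ i j p q e → trans (sym (fg i p)) (trans (cong f e) (fg j q)))

  -- If j were missed, f would inject P into Q without j, which is too small.
  #-injection-onto : (f : Fin m → Fin n) → (∀ i → P i → Q (f i)) →
    (∀ i j → P i → P j → f i ≡ f j → i ≡ j) → # Q? ≤ # P? → ∀ j → Q j → ∃[ i ] P i × f i ≡ j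
  #-injection-onto f into inj le j q with any? (λ i → P? i ×-dec (f i ≟ᶠ j))
  ... | yes e = e
  ... | no ¬e = contradiction le (<⇒≱ (≤-<-trans
          (#-injection P? (λ k → Q? k ×-dec ¬? (k ≟ᶠ j)) f (λ i p → into i p , λ e → ¬e (i , p , e)) inj)
          (subst (# (λ k → Q? k ×-dec ¬? (k ≟ᶠ j)) <_) (sym (#-remove Q? j q)) (n<1+n _))))

-- Prime powers

module _ {p : ℕ} (pp : Prime p) where

  private instance
    p≢0 : NonZero p
    p≢0 = prime⇒nonZero pp

  p^≢0 : ∀ k → NonZero (p ^ k)
  p^≢0 k = m^n≢0 p k

  1<p : 1 < p
  1<p = nonTrivial⇒n>1 p {{prime⇒nonTrivial pp}}

  ∤1 : ¬ p ∣ 1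
  ∤1 d = contradiction (∣⇒≤ d) (<⇒≱ 1<p)

  p^∣*⇒p^∣ : ∀ k {m n} → p ^ k ∣ m * n → ¬ p ∣ n → p ^ k ∣ m
  p^∣*⇒p^∣ zero _ _ = 1∣ _
  p^∣*⇒p^∣ (suc k) {m} {n} d ¬pn with euclidsLemma m n pp (∣-trans (m∣m*n (p ^ k)) d)
  ... | inj₂ pn = contradiction pn ¬pn
  ... | inj₁ (divides m′ refl) = subst (p ^ suc k ∣_) (*-comm p m′)
          (*-monoʳ-∣ p (p^∣*⇒p^∣ k (*-cancelˡ-∣ p (subst (p ^ suc k ∣_) (reorder m′ p n) d)) ¬pn))
    where
    reorder : ∀ m′ p n → m′ * p * n ≡ p * (m′ * n)
    reorder = solve-∀

  opaque
    ∣p^⇒≡p^ : ∀ n {d} → d ∣ p ^ n → ∃[ j ] d ≡ p ^ j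
    ∣p^⇒≡p^ zero d∣ = 0 , ∣1⇒≡1 d∣
    ∣p^⇒≡p^ (suc n) {d} (divides e eq) with euclidsLemma e d pp (divides (p ^ n) (trans (sym eq) (*-comm p (p ^ n))))
    ... | inj₁ (divides e′ refl) = ∣p^⇒≡p^ n (divides e′ (*-cancelˡ-≡ _ _ p (trans eq (lem e′ p d))))
      where
      lem : ∀ e′ p d → e′ * p * d ≡ p * (e′ * d)
      lem = solve-∀
    ... | inj₂ (divides d′ refl) =
      let j , eqj = ∣p^⇒≡p^ n {d′} (divides e (*-cancelˡ-≡ _ _ p (trans eq (lem e d′ p)))) in
      suc j , trans (*-comm d′ p) (cong (p *_) eqj)
      where
      lem : ∀ e d′ p → e * (d′ * p) ≡ p * (e * d′)
      lem = solve-∀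

  opaque
    p-part : ∀ n → .{{NonZero n}} → ∃[ k ] ∃[ m ] n ≡ p ^ k * m × ¬ p ∣ m
    p-part n = go n n ≤-refl
      where
      -- The bound b on n drops at each call, because dividing by p > 1 makes n smaller.
      go : ∀ b n → .{{NonZero n}} → n ≤ b → ∃[ k ] ∃[ m ] n ≡ p ^ k * m × ¬ p ∣ m
      go b n le with p ∣? n
      ... | no ¬d = 0 , n , sym (+-identityʳ n) , ¬d
      go b n le | yes (divides zero eq) = contradiction eq (≢-nonZero⁻¹ n)
      go zero n le | yes (divides (suc n′) eq) = contradiction (n≤0⇒n≡0 le) (≢-nonZero⁻¹ n)
      go (suc b) n le | yes (divides (suc n′) eq) =
        let k , m , eq′ , ¬d = go b (suc n′) (s≤s⁻¹ (<-≤-trans (m<m*n (suc n′) p 1<p) (subst (_≤ suc b) eq le)))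
        in suc k , m , trans eq (trans (*-comm (suc n′) p) (trans (cong (p *_) eq′) (sym (*-assoc p (p ^ k) m)))) , ¬d

-- Binomial coefficients modulo a prime

-- The absorption identity; it compares powers of p in neighbouring binomial coefficients without
-- factorials.
[k+1]*[n+1]C[k+1]≡[n+1]*nCk : ∀ n k → suc k * (suc n C suc k) ≡ suc n * (n C k)
[k+1]*[n+1]C[k+1]≡[n+1]*nCk zero zero = refl
[k+1]*[n+1]C[k+1]≡[n+1]*nCk zero (suc k) = trans (cong (suc (suc k) *_) (k>n⇒nCk≡0 (s≤s (s≤s (z≤n {k})))))
  (trans (*-zeroʳ (suc (suc k))) (sym (trans (+-identityʳ _) (k>n⇒nCk≡0 (s≤s (z≤n {k}))))))
[k+1]*[n+1]C[k+1]≡[n+1]*nCk (suc n) zero = trans (+-identityʳ _) (trans (nC1≡n (suc (suc n))) (sym (*-identityʳ _)))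
[k+1]*[n+1]C[k+1]≡[n+1]*nCk (suc n) (suc k) = begin
  suc (suc k) * (suc (suc n) C suc (suc k))    ≡⟨ cong (suc (suc k) *_) (sym (nCk+nC[k+1]≡[n+1]C[k+1] (suc n) (suc k))) ⟩
  suc (suc k) * (X + Y)                        ≡⟨ lem (suc k) X Y ⟩
  suc k * X + (X + suc (suc k) * Y)            ≡⟨ cong₂ (λ a b → a + (X + b)) ([k+1]*[n+1]C[k+1]≡[n+1]*nCk n k) ([k+1]*[n+1]C[k+1]≡[n+1]*nCk n (suc k)) ⟩
  suc n * A + (X + suc n * B)                  ≡⟨ lem′ (suc n) A B X ⟩
  suc n * (A + B) + X                          ≡⟨ cong (λ a → suc n * a + X) (nCk+nC[k+1]≡[n+1]C[k+1] n k) ⟩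
  suc n * X + X                                ≡⟨ +-comm _ X ⟩
  suc (suc n) * X                              ∎
  where
  open ≡-Reasoning
  X = suc n C suc k
  Y = suc n C suc (suc k)
  A = n C k
  B = n C suc k
  lem : ∀ k X Y → suc k * (X + Y) ≡ k * X + (X + suc k * Y)
  lem = solve-∀
  lem′ : ∀ n A B X → n * A + (X + n * B) ≡ n * (A + B) + X
  lem′ = solve-∀

-- C(p^k m - 1, j) is congruent to ±1 for j < p^k, because C(p^k m, j) vanishes for 0 < j < p^k.
∤C : ∀ {p} → Prime p → ∀ k m → ¬ p ∣ m → ¬ p ∣ ((p ^ k * m) C (p ^ k))
∤C {p} pp k m ¬pm with p ^ k in eqq | p^≢0 pp k
... | suc q | _ with suc q * m in eqN
... | zero = contradiction (subst (p ∣_) (sym ([ (λ ()) , id ]′ (m*n≡0⇒m≡0∨n≡0 (suc q) eqN))) (p ∣0)) ¬pm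
... | suc N = λ d → [ ¬pm , below q ≤-refl ]′ (euclidsLemma m (N C q) pp (subst (p ∣_) top d))
  where
  top : suc N C suc q ≡ m * (N C q)
  top = *-cancelˡ-≡ _ _ (suc q) (trans ([k+1]*[n+1]C[k+1]≡[n+1]*nCk N q)
    (trans (cong (_* (N C q)) (sym eqN)) (*-assoc (suc q) m (N C q))))
  -- By absorption p ^ k, here `suc q`, divides `suc j * (suc N C suc j)`. If p did not divide the
  -- coefficient, p ^ k would divide the smaller number `suc j`.
  vanish : ∀ j → suc j ≤ q → p ∣ (suc N C suc j)
  vanish j j<q with p ∣? (suc N C suc j)
  ... | yes d = d
  ... | no ¬d = contradiction (∣⇒≤ (subst (_∣ suc j) eqq (p^∣*⇒p^∣ pp k
        (subst (p ^ k ∣_) (sym ([k+1]*[n+1]C[k+1]≡[n+1]*nCk N j))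
          (∣-trans (divides m (trans (sym eqN) (trans (*-comm (suc q) m) (cong (m *_) (sym eqq))))) (m∣m*n (N C j)))) ¬d)))
        (<⇒≱ (s≤s j<q))
  below : ∀ j → j ≤ q → ¬ p ∣ (N C j)
  below zero _ d = ∤1 pp d
  below (suc j) j<q d = below j (≤-trans (n≤1+n j) j<q)
    (∣m+n∣n⇒∣m (subst (p ∣_) (sym (nCk+nC[k+1]≡[n+1]C[k+1] N j)) (vanish j j<q)) d)
    where
    ∣m+n∣n⇒∣m : ∀ {a b} → p ∣ a + b → p ∣ b → p ∣ a
    ∣m+n∣n⇒∣m {a} {b} d e = ∣m+n∣m⇒∣n (subst (p ∣_) (+-comm a b) d) e

-- Subsets of a finite set, coded by numbers

-- This is 2 ^ n, defined by doubling so that `splitAt` tells whether the first element belongs to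
-- the coded subset. Codes make quantification over subsets a finite search and let a group act on
-- subsets as points of a `Fin`.
bits : ℕ → ℕ
bits zero = 1
bits (suc n) = bits n + bits n

opaque
  decode : ∀ {n} → Fin (bits n) → Fin n → Bool
  decode {suc n} c zero = [ const false , const true ]′ (splitAt (bits n) c)
  decode {suc n} c (suc i) = decode ([ id , id ]′ (splitAt (bits n) c)) i

  encode : ∀ {n} → (Fin n → Bool) → Fin (bits n)
  encode {zero} f = zero
  encode {suc n} f = if f zero then bits n ↑ʳ encode (f ∘ suc) else encode (f ∘ suc) ↑ˡ bits n

  decode-encode : ∀ {n} (f : Fin n → Bool) i → decode (encode f) i ≡ f i
  decode-encode {suc n} f zero with f zero
  ... | true = cong [ const false , const true ]′ (splitAt-↑ʳ (bits n) (bits n) (encode (f ∘ suc)))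
  ... | false = cong [ const false , const true ]′ (splitAt-↑ˡ (bits n) (encode (f ∘ suc)) (bits n))
  decode-encode {suc n} f (suc i) with f zero
  ... | true = trans (cong (λ c → decode ([ id , id ]′ c) i) (splitAt-↑ʳ (bits n) (bits n) (encode (f ∘ suc)))) (decode-encode (f ∘ suc) i)
  ... | false = trans (cong (λ c → decode ([ id , id ]′ c) i) (splitAt-↑ˡ (bits n) (encode (f ∘ suc)) (bits n))) (decode-encode (f ∘ suc) i)

  -- Turns pointwise equality of subsets into an equation between codes, the form that stabilisers
  -- of an action require.
  encode-cong : ∀ {n} {f g : Fin n → Bool} → (∀ i → f i ≡ g i) → encode f ≡ encode g
  encode-cong {zero} e = refl
  encode-cong {suc n} {f} {g} e rewrite e zero | encode-cong {n} {f ∘ suc} {g ∘ suc} (e ∘ suc) = refl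

  encode-decode : ∀ {n} (c : Fin (bits n)) → encode (decode {n} c) ≡ c
  encode-decode {zero} zero = refl
  encode-decode {suc n} c with splitAt (bits n) c in eq
  ... | inj₁ c′ = trans (cong (_↑ˡ bits n) (encode-decode {n} c′))
                    (trans (cong (join (bits n) (bits n)) (sym eq)) (join-splitAt (bits n) (bits n) c))
  ... | inj₂ c′ = trans (cong (bits n ↑ʳ_) (encode-decode {n} c′))
                    (trans (cong (join (bits n) (bits n)) (sym eq)) (join-splitAt (bits n) (bits n) c))

sum-++ : ∀ a b (f : Fin (a + b) → ℕ) → sum f ≡ sum (λ i → f (i ↑ˡ b)) + sum (λ j → f (a ↑ʳ j))
sum-++ zero b f = refl
sum-++ (suc a) b f = trans (cong (f zero +_) (sum-++ a b (f ∘ suc))) (sym (+-assoc (f zero) _ _))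

opaque
  unfolding decode

  -- The codes without and with the first element contribute the two terms of Pascal's rule.
  #-of-size : ∀ n k → # (λ c → count (decode {n} c) ≟ k) ≡ n C k
  #-of-size n k = trans (#-def (λ c → count (decode {n} c) ≟ k)) (go n k)
    where
    open ≡-Reasoning
    go : ∀ n k → sum (λ c → 1[ count (decode {n} c) ≟ k ]) ≡ n C k
    go zero zero = refl
    go zero (suc k) = sym (k>n⇒nCk≡0 (s≤s (z≤n {k})))
    go (suc n) k = begin
      sum (λ c → 1[ count (decode {suc n} c) ≟ k ])
        ≡⟨ sum-++ (bits n) (bits n) (λ c → 1[ count (decode {suc n} c) ≟ k ]) ⟩
      sum (λ c → 1[ count (decode {suc n} (c ↑ˡ bits n)) ≟ k ]) + sum (λ c → 1[ count (decode {suc n} (bits n ↑ʳ c)) ≟ k ])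
        ≡⟨ cong₂ _+_ (sum-cong-≗ λ c → cong (λ s → 1[ size s ≟ k ]) (splitAt-↑ˡ (bits n) c (bits n)))
                     (sum-cong-≗ λ c → cong (λ s → 1[ size s ≟ k ]) (splitAt-↑ʳ (bits n) (bits n) c)) ⟩
      sum (λ c → 1[ count (decode {n} c) ≟ k ]) + sum (λ c → 1[ suc (count (decode {n} c)) ≟ k ])
        ≡⟨ pascal k ⟩
      suc n C k ∎
      where
      size : Fin (bits n) ⊎ Fin (bits n) → ℕ
      size s = (if [ const false , const true ]′ s then 1 else 0) + count (decode {n} ([ id , id ]′ s))
      pascal : ∀ k → sum (λ c → 1[ count (decode {n} c) ≟ k ]) + sum (λ c → 1[ suc (count (decode {n} c)) ≟ k ]) ≡ suc n C k
      pascal zero = trans (cong₂ _+_ (go n zero) (trans (sym (#-def (λ c → suc (count (decode {n} c)) ≟ 0))) (#-none (λ c → suc (count (decode {n} c)) ≟ 0) λ _ ()))) refl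
      pascal (suc k) = begin
        sum (λ c → 1[ count (decode {n} c) ≟ suc k ]) + sum (λ c → 1[ suc (count (decode {n} c)) ≟ suc k ])
          ≡⟨ cong₂ _+_ (go n (suc k)) (go n k) ⟩
        n C suc k + n C k     ≡⟨ +-comm _ (n C k) ⟩
        n C k + n C suc k     ≡⟨ nCk+nC[k+1]≡[n+1]C[k+1] n k ⟩
        suc n C suc k         ∎

-- Finite group actions

module _ {n : ℕ} {E : Fin n → Fin n → Set} (E? : ∀ i j → Dec (E i j))
         (E-refl : ∀ i → E i i) (E-sym : ∀ {i j} → E i j → E j i) (E-trans : ∀ {i j k} → E i j → E j k → E i k) where

  -- A closed set is a disjoint union of classes; they are removed one at a time, with b bounding
  -- the number of elements that remain.
  classes-∣ : ∀ {d} {P : Fin n → Set} (P? : Decidable P) → (∀ {i j} → P i → E i j → P j) →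
    (∀ i → P i → d ∣ # (E? i)) → d ∣ # P?
  classes-∣ {d} P? closed = go _ P? closed ≤-refl
    where
    go : ∀ b {P : Fin n → Set} (P? : Decidable P) → (∀ {i j} → P i → E i j → P j) → # P? ≤ b →
      (∀ i → P i → d ∣ # (E? i)) → d ∣ # P?
    go b P? closed le div with any? P?
    ... | no ¬e = subst (d ∣_) (sym (#-none P? λ i p → ¬e (i , p))) (d ∣0)
    go zero P? closed le div | yes (i , p) = contradiction le (<⇒≱ (#-positive P? i p))
    go (suc b) {P} P? closed le div | yes (i , p) = subst (d ∣_) (sym (#-split P? (E? i)))
      (∣m∣n⇒∣m+n
        (subst (d ∣_) (#-cong (E? i) (λ j → P? j ×-dec E? i j) (λ j e → closed p e , e) (λ j → proj₂)) (div i p))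
        (go b P∖? (λ (p , ¬e) e → closed p e , λ e′ → ¬e (E-trans e′ (E-sym e)))
          (s≤s⁻¹ (≤-trans (#-strict P∖? P? (λ j → proj₁) i p (λ q → proj₂ q (E-refl i))) le))
          (λ j q → div j (proj₁ q))))
      where
      P∖? : Decidable (λ j → P j × ¬ E i j)
      P∖? j = P? j ×-dec ¬? (E? i j)

  opaque
    -- The form in which orbits are selected: d is p for Sylow subgroups and fixed cosets, and a
    -- power of p for orbits on a line through x.
    class-∤ : ∀ {d} {P : Fin n → Set} (P? : Decidable P) → (∀ {i j} → P i → E i j → P j) →
      ¬ d ∣ # P? → ∃[ i ] P i × ¬ d ∣ # (E? i)
    class-∤ {d} P? closed ¬d with any? (λ i → P? i ×-dec ¬? (d ∣? # (E? i)))
    ... | yes e = e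
    ... | no ¬e = contradiction
          (classes-∣ P? closed λ i p → decidable-stable (d ∣? # (E? i)) λ ¬d∣ → ¬e (i , p , ¬d∣)) ¬d

module Groups (G : FinGroup) where
  open FinGroup G public renaming (_∙_ to infixl 7 _∙_; _⁻¹ to infix 8 _⁻¹)
  open GroupTheory G public

  open IsGroup isGroup public using (assoc; identityˡ; identityʳ; inverseˡ; inverseʳ)

  group : Group 0ℓ 0ℓ
  group = record { isGroup = isGroup }

  open GroupProperties group public using (\\-leftDividesˡ; \\-leftDividesʳ; //-rightDividesʳ; ⁻¹-anti-homo-∙; ⁻¹-involutive; ∙-cancelʳ; ε⁻¹≈ε)

  infix 4 _∈_ _∈?_

  _∈_ : Fin order → SubsetG → Set
  g ∈ K = K g ≡ true

  _∈?_ : ∀ g K → Dec (g ∈ K)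
  g ∈? K = K g Bool.≟ true

  ⌜_⌝ : {P : Fin order → Set} → Decidable P → SubsetG
  ⌜ P? ⌝ g = does (P? g)

  ∈⌜⌝⁺ : {P : Fin order → Set} (P? : Decidable P) → ∀ {g} → P g → g ∈ ⌜ P? ⌝
  ∈⌜⌝⁺ P? {g} = dec-true (P? g)

  ∈⌜⌝⁻ : {P : Fin order → Set} (P? : Decidable P) → ∀ {g} → g ∈ ⌜ P? ⌝ → P g
  ∈⌜⌝⁻ P? {g} = does⁻ (P? g)

  open IsSubgroup

  opaque
    subgroup? : Decidable IsSubgroup
    subgroup? K = map′
      (λ (e , m , i) → record { has-ε = e ; ∙-clos = m ; ⁻¹-clos = i })
      (λ s → has-ε s , ∙-clos s , ⁻¹-clos s)
      ((ε ∈? K) ×-dec all? (λ g → all? λ h → (g ∈? K) →-dec ((h ∈? K) →-dec ((g ∙ h) ∈? K)))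
                ×-dec all? (λ g → (g ∈? K) →-dec ((g ⁻¹) ∈? K)))

  ⌜⌝-subgroup : {P : Fin order → Set} (P? : Decidable P) → P ε → (∀ {g h} → P g → P h → P (g ∙ h)) →
    (∀ {g} → P g → P (g ⁻¹)) → IsSubgroup ⌜ P? ⌝
  ⌜⌝-subgroup P? e m i = record
    { has-ε = ∈⌜⌝⁺ P? e
    ; ∙-clos = λ g h a b → ∈⌜⌝⁺ P? (m (∈⌜⌝⁻ P? a) (∈⌜⌝⁻ P? b))
    ; ⁻¹-clos = λ g a → ∈⌜⌝⁺ P? (i (∈⌜⌝⁻ P? a)) }

  #⌜⌝ : {P : Fin order → Set} (P? : Decidable P) → # (_∈? ⌜ P? ⌝) ≡ # P?
  #⌜⌝ P? = #-cong (_∈? ⌜ P? ⌝) P? (λ g → ∈⌜⌝⁻ P?) (λ g → ∈⌜⌝⁺ P?)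

  full : SubsetG
  full _ = true

  full-subgroup : IsSubgroup full
  full-subgroup = record { has-ε = refl ; ∙-clos = λ _ _ _ _ → refl ; ⁻¹-clos = λ _ _ → refl }

  #-full : # (_∈? full) ≡ order
  #-full = trans (#-def (_∈? full)) (go order)
    where
    go : ∀ n → sum {n} (λ _ → 1) ≡ n
    go zero = refl
    go (suc n) = cong suc (go n)

  -- P is a union of left cosets of M, each in bijection with M.
  closed-∣ : ∀ {M} → IsSubgroup M → {P : Fin order → Set} (P? : Decidable P) →
    (∀ {g h} → P g → h ∈ M → P (g ∙ h)) → # (_∈? M) ∣ # P?
  closed-∣ {M} sM {P} P? closed = classes-∣ {E = E} E?
    (λ g → subst (_∈ M) (sym (inverseˡ g)) (has-ε sM))
    (λ {g} {h} e → subst (_∈ M) (trans (⁻¹-anti-homo-∙ (g ⁻¹) h) (cong (h ⁻¹ ∙_) (⁻¹-involutive g))) (⁻¹-clos sM _ e))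
    (λ {g} {h} {k} e e′ → subst (_∈ M) (trans (assoc (g ⁻¹) h (h ⁻¹ ∙ k)) (cong (g ⁻¹ ∙_) (\\-leftDividesˡ h k))) (∙-clos sM _ _ e e′))
    P? (λ {g} {h} p e → subst P (\\-leftDividesˡ g h) (closed p e))
    λ g _ → ∣-reflexive (#-bijection (_∈? M) (E? g) (g ∙_) (g ⁻¹ ∙_)
      (λ h m → subst (_∈ M) (sym (\\-leftDividesʳ g h)) m) (λ h e → e)
      (λ h _ → \\-leftDividesʳ g h) (λ h _ → \\-leftDividesˡ g h))
    where
    E : Fin order → Fin order → Set
    E g h = (g ⁻¹ ∙ h) ∈ M
    E? : ∀ g h → Dec (E g h)
    E? g h = (g ⁻¹ ∙ h) ∈? M

  lagrange : ∀ {M K} → IsSubgroup M → IsSubgroup K → M ⊆ K → # (_∈? M) ∣ # (_∈? K)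
  lagrange {M} {K} sM sK sub = closed-∣ sM (_∈? K) λ a b → ∙-clos sK _ _ a (sub _ b)

  module Orbits {m} (act : Fin order → Fin m → Fin m) (act-ε : ∀ y → act ε y ≡ y)
                (act-∙ : ∀ g h y → act (g ∙ h) y ≡ act g (act h y)) where

    act-inv : ∀ g {y y′} → act g y ≡ y′ → act (g ⁻¹) y′ ≡ y
    act-inv g {y} refl = trans (sym (act-∙ (g ⁻¹) g y)) (trans (cong (λ h → act h y) (inverseˡ g)) (act-ε y))

    act-injective : ∀ g {y y′} → act g y ≡ act g y′ → y ≡ y′
    act-injective g e = trans (sym (act-inv g e)) (act-inv g refl)

    module _ {K : SubsetG} (sK : IsSubgroup K) where

      Orb : Fin m → Fin m → Set
      Orb y y′ = ∃[ k ] k ∈ K × act k y ≡ y′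

      Orb? : ∀ y y′ → Dec (Orb y y′)
      Orb? y y′ = any? λ k → (k ∈? K) ×-dec (act k y ≟ᶠ y′)

      Orb-refl : ∀ y → Orb y y
      Orb-refl y = ε , has-ε sK , act-ε y

      Orb-sym : ∀ {y y′} → Orb y y′ → Orb y′ y
      Orb-sym (k , k∈ , e) = k ⁻¹ , ⁻¹-clos sK k k∈ , act-inv k e

      Orb-trans : ∀ {y y′ y″} → Orb y y′ → Orb y′ y″ → Orb y y″
      Orb-trans (k , k∈ , refl) (l , l∈ , e) = l ∙ k , ∙-clos sK l k l∈ k∈ , trans (act-∙ l k _) e

      Stab′ : Fin m → Fin order → Set
      Stab′ y k = k ∈ K × act k y ≡ y

      Stab? : ∀ y → Decidable (Stab′ y)
      Stab? y k = (k ∈? K) ×-dec (act k y ≟ᶠ y)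

      Stab-subgroup : ∀ y → IsSubgroup ⌜ Stab? y ⌝
      Stab-subgroup y = ⌜⌝-subgroup (Stab? y) (has-ε sK , act-ε y)
        (λ {g} {h} (g∈ , eg) (h∈ , eh) → ∙-clos sK g h g∈ h∈ , trans (act-∙ g h y) (trans (cong (act g) eh) eg))
        (λ {g} (g∈ , eg) → ⁻¹-clos sK g g∈ , act-inv g eg)

      -- The elements of K carrying y to a given point of its orbit form a left coset of the
      -- stabiliser.
      orbit-stabiliser : ∀ y → # (Orb? y) * # (Stab? y) ≡ # (_∈? K)
      orbit-stabiliser y = trans (sym (double-≡ (_∈? K) (Orb? y) R? {1} (λ {k} (k∈ , e) → k∈ , k , k∈ , e) row col)) (*-identityʳ _)
        where
        R? : ∀ k y′ → Dec (k ∈ K × act k y ≡ y′)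
        R? k y′ = (k ∈? K) ×-dec (act k y ≟ᶠ y′)
        row : ∀ k → k ∈ K → # (R? k) ≡ 1
        row k k∈ = #-unique (R? k) (act k y) (k∈ , refl) λ _ (_ , e) → sym e
        col : ∀ y′ → Orb y y′ → # (λ k → R? k y′) ≡ # (Stab? y)
        col y′ (k₀ , k₀∈ , e₀) = #-bijection (λ k → R? k y′) (Stab? y) (k₀ ⁻¹ ∙_) (k₀ ∙_)
          (λ k (k∈ , e) → ∙-clos sK _ _ (⁻¹-clos sK k₀ k₀∈) k∈ ,
            trans (act-∙ (k₀ ⁻¹) k y) (trans (cong (act (k₀ ⁻¹)) e) (act-inv k₀ e₀)))
          (λ k (k∈ , e) → ∙-clos sK _ _ k₀∈ k∈ , trans (act-∙ k₀ k y) (trans (cong (act k₀) e) e₀))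
          (λ k _ → \\-leftDividesˡ k₀ k) (λ k _ → \\-leftDividesʳ k₀ k)

      orbits-∤ : ∀ {d} {P : Fin m → Set} (P? : Decidable P) → (∀ k {y} → k ∈ K → P y → P (act k y)) →
        ¬ d ∣ # P? → ∃[ y ] P y × ¬ d ∣ # (Orb? y)
      orbits-∤ P? closed = class-∤ {E = Orb} Orb? Orb-refl Orb-sym Orb-trans P? λ { p (k , k∈ , refl) → closed k k∈ p }

  -- The left translate g c: an element h lies in it exactly when `g ⁻¹ ∙ h` lies in c. On subsets
  -- of size p ^ k this is Wielandt's action, and on the code of a subgroup it is the action on left
  -- cosets.
  translate : Fin order → Fin (bits order) → Fin (bits order)
  translate g c = encode λ h → decode c (g ⁻¹ ∙ h)

  translate-ε : ∀ c → translate ε c ≡ c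
  translate-ε c = trans (encode-cong λ h → cong (decode c) (trans (cong (_∙ h) ε⁻¹≈ε) (identityˡ h))) (encode-decode {order} c)

  translate-∙ : ∀ g h c → translate (g ∙ h) c ≡ translate g (translate h c)
  translate-∙ g h c = encode-cong λ k → trans
    (cong (decode c) (trans (cong (_∙ k) (⁻¹-anti-homo-∙ g h)) (assoc (h ⁻¹) (g ⁻¹) k)))
    (sym (decode-encode (λ k → decode c (h ⁻¹ ∙ k)) (g ⁻¹ ∙ k)))

  open Orbits translate translate-ε translate-∙ hiding (act-inv; act-injective)

  -- Wielandt: some orbit of subsets of size p^k has length prime to p, and its stabilisers are Sylow subgroups.
  opaque
    sylow : ∀ {p} → Prime p → ∀ k m → order ≡ p ^ k * m → ¬ p ∣ m → ∃[ P ] IsSubgroup P × # (_∈? P) ≡ p ^ k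
    sylow {p} pp k m eq ¬pm = from-orbit (orbits-∤ full-subgroup {p} size? closed (subst (λ x → ¬ p ∣ x) (sym (#-of-size order (p ^ k)))
        (subst (λ n → ¬ p ∣ (n C p ^ k)) (sym eq) (∤C pp k m ¬pm))))
      where
      size? : Decidable (λ c → count (decode {order} c) ≡ p ^ k)
      size? c = count (decode {order} c) ≟ p ^ k
      count-# : ∀ c → count (decode {order} c) ≡ # (_∈? decode c)
      count-# c = count≡# (decode c) (_∈? decode c) (λ _ → id) (λ _ → id)
      closed : ∀ g {c} → g ∈ full → count (decode {order} c) ≡ p ^ k → count (decode {order} (translate g c)) ≡ p ^ k
      closed g {c} _ e = trans (trans (count-# (translate g c)) (trans
        (#-bijection (_∈? decode (translate g c)) (_∈? decode c) (g ⁻¹ ∙_) (g ∙_)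
          (λ h h∈ → trans (sym (decode-encode (λ h → decode c (g ⁻¹ ∙ h)) h)) h∈)
          (λ h h∈ → trans (decode-encode (λ h → decode c (g ⁻¹ ∙ h)) (g ∙ h)) (trans (cong (decode c) (\\-leftDividesʳ g h)) h∈))
          (λ h _ → \\-leftDividesˡ g h) (λ h _ → \\-leftDividesʳ g h))
        (sym (count-# c)))) e
      from-orbit : ∃[ c ] count (decode {order} c) ≡ p ^ k × ¬ p ∣ # (Orb? full-subgroup c) → ∃[ P ] IsSubgroup P × # (_∈? P) ≡ p ^ k
      from-orbit (c , size , ¬p) = ⌜ St? ⌝ , Stab-subgroup full-subgroup c , trans (#⌜⌝ St?) (≤-antisym upper lower)
        where
        St? : Decidable (Stab′ full-subgroup c)
        St? = Stab? full-subgroup c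
        inhabited : ∃[ e ] e ∈ decode {order} c
        inhabited = #-inhabited (_∈? decode c) (subst (1 ≤_) (trans (sym size) (count-# c)) (>-nonZero⁻¹ (p ^ k) {{p^≢0 pp k}}))
        e : Fin order
        e = proj₁ inhabited
        -- Right multiplication by an element e of c maps the stabiliser of c injectively into c.
        -- Conversely p ^ k divides the order of the stabiliser, because p does not divide the
        -- length of the orbit.
        upper : # St? ≤ p ^ k
        upper = ≤-trans (#-injection St? (_∈? decode c) (_∙ e)
          (λ g (_ , fix) → trans (cong (λ c → decode {order} c (g ∙ e)) (sym fix)) (trans (decode-encode (λ h → decode c (g ⁻¹ ∙ h)) (g ∙ e))
             (trans (cong (decode c) (\\-leftDividesʳ g e)) (proj₂ inhabited))))
          (λ g h _ _ → ∙-cancelʳ e g h))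
          (≤-reflexive (trans (sym (count-# c)) size))
        lower : p ^ k ≤ # St?
        lower = ∣⇒≤ {{>-nonZero (#-positive St? ε (refl , translate-ε c))}} (p^∣*⇒p^∣ pp k {# St?} {# (Orb? full-subgroup c)}
          (divides m (trans (*-comm (# St?) _) (trans (orbit-stabiliser full-subgroup c) (trans #-full (trans eq (*-comm _ m)))))) ¬p)

  -- Maximal subgroups

  decode-subgroup : ∀ {K} → IsSubgroup K → IsSubgroup (decode (encode K))
  decode-subgroup {K} sK = record
    { has-ε = trans (decode-encode K ε) (has-ε sK)
    ; ∙-clos = λ g h a b → trans (decode-encode K _) (∙-clos sK g h (trans (sym (decode-encode K g)) a) (trans (sym (decode-encode K h)) b))
    ; ⁻¹-clos = λ g a → trans (decode-encode K _) (⁻¹-clos sK g (trans (sym (decode-encode K g)) a)) }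

  _⊆?_ : ∀ K M → Dec (K ⊆ M)
  K ⊆? M = all? λ g → (g ∈? K) →-dec (g ∈? M)

  all∈? : ∀ M → Dec (∀ g → g ∈ M)
  all∈? M = all? (_∈? M)

  opaque
    -- Maximality quantifies over all overgroups; passing to their codes leaves a finite search.
    maximal? : Decidable IsMaximal
    maximal? K = subgroup? K ×-dec any? (λ g → K g Bool.≟ false) ×-dec map′
      (λ f M sM sub → [ (λ a → inj₁ λ g → trans (sym (decode-encode M g)) (a g)) , (λ b → inj₂ λ g g∈ → b g (trans (decode-encode M g) g∈)) ]′
         (f (encode M) (decode-subgroup sM) λ g g∈ → trans (decode-encode M g) (sub g g∈)))
      (λ f c → f (decode c))
      (all? λ c → subgroup? (decode c) →-dec ((K ⊆? decode c) →-dec (all∈? (decode c) ⊎-dec (decode c ⊆? K))))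

  opaque
    extends-to-maximal : ∀ {M} → IsSubgroup M → ∀ {g} → ¬ g ∈ M → ∃[ K ] IsMaximal K × M ⊆ K
    extends-to-maximal {M} sM ∉M = go order sM (_ , ∉M) (m≤n⇒m≤n+o (# (_∈? M)) ≤-refl)
      where
      -- Here b bounds the order of H minus that of M, and it drops when M is replaced by a larger
      -- proper subgroup.
      go : ∀ b {M} → IsSubgroup M → (∃[ g ] ¬ g ∈ M) → order ≤ b + # (_∈? M) → ∃[ K ] IsMaximal K × M ⊆ K
      go b {M} sM (g , g∉) le with any? (λ c → subgroup? (decode c) ×-dec (M ⊆? decode c) ×-dec ¬? (all∈? (decode c)) ×-dec ¬? (decode c ⊆? M))
      go zero {M} sM (g , g∉) le | _ = contradiction
        (#-strict (_∈? M) (_∈? full) (λ _ _ → refl) g refl g∉) (≤⇒≯ (≤-trans (≤-reflexive #-full) le))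
      go (suc b) {M} sM (g , g∉) le | yes (c , sN , sub , ¬all , ¬sub)
        with ¬∀⟶∃¬ order _ (_∈? decode c) ¬all | ¬∀⟶∃¬ order _ (λ g → (g ∈? decode c) →-dec (g ∈? M)) ¬sub
      ... | h , h∉ | k , ¬k =
        let K , mK , N⊆K = go b sN (h , h∉) (≤-trans le (≤-trans (≤-reflexive (sym (+-suc b _)))
              (+-monoʳ-≤ b (#-strict (_∈? M) (_∈? decode c) sub k (decidable-stable (k ∈? decode c) λ k∉ → ¬k λ k∈ → contradiction k∈ k∉) λ k∈ → ¬k λ _ → k∈))))
        in K , mK , λ g g∈ → N⊆K g (sub g g∈)
      go (suc b) {M} sM (g , g∉) le | no ¬bigger = M , (sM , (g , Bool.¬-not g∉) , top) , λ _ → id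
        where
        top : ∀ N → IsSubgroup N → M ⊆ N → (∀ g → N g ≡ true) ⊎ (N ⊆ M)
        top N sN sub with all∈? N | N ⊆? M
        ... | yes a | _ = inj₁ a
        ... | no _ | yes s = inj₂ s
        ... | no ¬a | no ¬s = contradiction (encode N , decode-subgroup sN , (λ g g∈ → trans (decode-encode N g) (sub g g∈)) ,
              (λ a → ¬a λ g → trans (sym (decode-encode N g)) (a g)) , λ s → ¬s λ g g∈ → s g (trans (decode-encode N g) g∈)) ¬bigger

  decode-maximal : ∀ {K} → IsMaximal K → IsMaximal (decode (encode K))
  decode-maximal {K} (sK , (g , e) , top) = decode-subgroup sK , (g , trans (decode-encode K g) e) ,
    λ M sM sub → [ inj₁ , (λ s → inj₂ λ g g∈ → trans (decode-encode K g) (s g g∈)) ]′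
      (top M sM λ g g∈ → sub g (trans (decode-encode K g) g∈))

  opaque
    -- Makes Φ a Boolean subset, so that orbits and stabilisers of Φ can be counted.
    frattini? : Decidable Frattini
    frattini? g = map′ (λ f K mK → trans (sym (decode-encode K g)) (f (encode K) (decode-maximal mK)))
      (λ f c → f (decode c)) (all? λ c → maximal? (decode c) →-dec (g ∈? decode c))

  opaque
    -- Condition (b) only denies that two subgroups generate H; a search over codes extracts from
    -- this an actual proper subgroup.
    proper-if-not-generating : {X : Fin order → Set} → ¬ (∀ g → Generated X g) →
      Decidable X → ∃[ M ] IsSubgroup M × (∀ h → X h → h ∈ M) × (∃[ g ] ¬ g ∈ M)
    proper-if-not-generating ¬gen X?
      with any? (λ c → subgroup? (decode c) ×-dec all? (λ h → X? h →-dec (h ∈? decode c)) ×-dec any? (λ g → ¬? (g ∈? decode c)))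
    ... | yes (c , sM , sup , g) = decode c , sM , sup , g
    ... | no ¬e = contradiction (λ g M sM sup → decidable-stable (g ∈? M) λ g∉ → ¬e (encode M , decode-subgroup sM ,
            (λ h x → trans (decode-encode M h) (sup h x)) , g , λ g∈ → g∉ (trans (sym (decode-encode M g)) g∈))) ¬gen

  -- Normal subgroups

  Normal : SubsetG → Set
  Normal K = ∀ g k → k ∈ K → (g ⁻¹ ∙ k ∙ g) ∈ K

  Product : SubsetG → SubsetG → Fin order → Set
  Product K N g = ∃[ k ] ∃[ n ] k ∈ K × n ∈ N × g ≡ k ∙ n

  Product? : ∀ K N → Decidable (Product K N)
  Product? K N g = any? λ k → any? λ n → (k ∈? K) ×-dec (n ∈? N) ×-dec (g ≟ᶠ k ∙ n)

  product-subgroup : ∀ {K N} → IsSubgroup K → IsSubgroup N → Normal N → IsSubgroup ⌜ Product? K N ⌝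
  product-subgroup {K} {N} sK sN nN = ⌜⌝-subgroup (Product? K N)
    (ε , ε , has-ε sK , has-ε sN , sym (identityˡ ε))
    (λ { (k , n , k∈ , n∈ , refl) (l , m , l∈ , m∈ , refl) →
      k ∙ l , l ⁻¹ ∙ n ∙ l ∙ m , ∙-clos sK k l k∈ l∈ , ∙-clos sN _ m (nN l n n∈) m∈ , (begin
        k ∙ n ∙ (l ∙ m)                    ≡⟨ assoc k n (l ∙ m) ⟩
        k ∙ (n ∙ (l ∙ m))                  ≡⟨ cong (k ∙_) (sym (\\-leftDividesˡ l (n ∙ (l ∙ m)))) ⟩
        k ∙ (l ∙ (l ⁻¹ ∙ (n ∙ (l ∙ m))))   ≡⟨ cong (λ y → k ∙ (l ∙ y)) (sym (trans (assoc (l ⁻¹ ∙ n) l m) (assoc (l ⁻¹) n (l ∙ m)))) ⟩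
        k ∙ (l ∙ (l ⁻¹ ∙ n ∙ l ∙ m))       ≡⟨ sym (assoc k l _) ⟩
        k ∙ l ∙ (l ⁻¹ ∙ n ∙ l ∙ m)         ∎) })
    (λ { (k , n , k∈ , n∈ , refl) →
      k ⁻¹ , (k ⁻¹) ⁻¹ ∙ n ⁻¹ ∙ k ⁻¹ , ⁻¹-clos sK k k∈ , nN (k ⁻¹) (n ⁻¹) (⁻¹-clos sN n n∈) , (begin
        (k ∙ n) ⁻¹                         ≡⟨ ⁻¹-anti-homo-∙ k n ⟩
        n ⁻¹ ∙ k ⁻¹                        ≡⟨ sym (\\-leftDividesˡ (k ⁻¹) (n ⁻¹ ∙ k ⁻¹)) ⟩
        k ⁻¹ ∙ ((k ⁻¹) ⁻¹ ∙ (n ⁻¹ ∙ k ⁻¹)) ≡⟨ cong (k ⁻¹ ∙_) (sym (assoc ((k ⁻¹) ⁻¹) (n ⁻¹) (k ⁻¹))) ⟩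
        k ⁻¹ ∙ ((k ⁻¹) ⁻¹ ∙ n ⁻¹ ∙ k ⁻¹)   ∎) })
    where open ≡-Reasoning

  ⊆-productˡ : ∀ {K N} → IsSubgroup N → K ⊆ ⌜ Product? K N ⌝
  ⊆-productˡ sN g g∈ = ∈⌜⌝⁺ (Product? _ _) (g , ε , g∈ , has-ε sN , sym (identityʳ g))

  ⊆-productʳ : ∀ {K N} → IsSubgroup K → N ⊆ ⌜ Product? K N ⌝
  ⊆-productʳ sK g g∈ = ∈⌜⌝⁺ (Product? _ _) (ε , g , has-ε sK , g∈ , sym (identityˡ g))

  frattini-subgroup : IsSubgroup ⌜ frattini? ⌝
  frattini-subgroup = ⌜⌝-subgroup frattini? (λ K mK → has-ε (proj₁ mK))
    (λ a b K mK → ∙-clos (proj₁ mK) _ _ (a K mK) (b K mK)) (λ a K mK → ⁻¹-clos (proj₁ mK) _ (a K mK))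

  maximal-∌⇒⊇ : ∀ {K M} → IsMaximal K → IsSubgroup M → K ⊆ M → ∀ {g} → g ∈ M → ¬ g ∈ K → ∀ h → h ∈ M
  maximal-∌⇒⊇ (_ , _ , top) sM sub {g} g∈ g∉ with top _ sM sub
  ... | inj₁ a = a
  ... | inj₂ s = contradiction (s g g∈) g∉

  maximal-proper : ∀ {K} → IsMaximal K → ¬ (∀ g → g ∈ K)
  maximal-proper (_ , (g , e) , _) a = contradiction (trans (sym e) (a g)) λ ()

  -- K acts on its cosets with orbits of p-power length; the fixed cosets other than K itself lie in the normaliser.
  module _ {p} (pp : Prime p) {S K : SubsetG} (sS : IsSubgroup S) (nS : Normal S)
           (e : ℕ) (order≡ : order ≡ # (_∈? S) * p ^ e) (mK : IsMaximal K) (S⊆K : S ⊆ K) where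

    private
      sK = proj₁ mK
      s = # (_∈? S)
      -- The orbit of this code under `translate` is the set of left cosets of K.
      c : Fin (bits order)
      c = encode K

      instance
        s≢0 : NonZero s
        s≢0 = >-nonZero (#-positive (_∈? S) ε (has-ε sS))
        p≢0 : NonZero p
        p≢0 = prime⇒nonZero pp

      fixes⇒∈ : ∀ {g} → translate g c ≡ c → g ∈ K
      fixes⇒∈ {g} fix = trans (sym (decode-encode K g)) (trans (cong (λ c → decode {order} c g) (sym fix))
        (trans (decode-encode (λ h → decode c (g ⁻¹ ∙ h)) g) (trans (decode-encode K (g ⁻¹ ∙ g)) (trans (cong K (inverseˡ g)) (has-ε sK)))))

      ∈⇒fixes : ∀ {g} → g ∈ K → translate g c ≡ c
      ∈⇒fixes {g} g∈ = encode-cong λ h → trans (decode-encode K (g ⁻¹ ∙ h)) (same h)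
        where
        same : ∀ h → K (g ⁻¹ ∙ h) ≡ K h
        same h with K (g ⁻¹ ∙ h) in eq | K h in eq′
        ... | true | true = refl
        ... | false | false = refl
        ... | true | false = contradiction (trans (sym eq′) (trans (cong K (sym (\\-leftDividesˡ g h))) (∙-clos sK g _ g∈ eq))) λ ()
        ... | false | true = contradiction (trans (sym eq) (∙-clos sK _ h (⁻¹-clos sK g g∈) eq′)) λ ()

      -- Cancelling the common factor |S| in orbit-stabiliser.
      orbit-power : ∀ {L} (sL : IsSubgroup L) y → (∀ g → g ∈ S → Stab′ sL y g) → ∃[ j ] # (Orb? sL y) ≡ p ^ j
      orbit-power {L} sL y S⊆St with lagrange sL full-subgroup (λ _ _ → refl)
           | lagrange sS (Stab-subgroup sL y) (λ g g∈ → ∈⌜⌝⁺ (Stab? sL y) (S⊆St g g∈))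
      ... | divides a eqa | divides b eqb = ∣p^⇒≡p^ pp e (divides (a * b) (*-cancelˡ-≡ _ _ s (begin
        s * p ^ e                 ≡⟨ trans (sym order≡) (sym #-full) ⟩
        # (_∈? full)              ≡⟨ eqa ⟩
        a * # (_∈? L)             ≡⟨ cong (a *_) (sym (orbit-stabiliser sL y)) ⟩
        a * (o * # (Stab? sL y))  ≡⟨ cong (λ x → a * (o * x)) (trans (sym (#⌜⌝ (Stab? sL y))) eqb) ⟩
        a * (o * (b * s))         ≡⟨ lem a o b s ⟩
        s * (a * b * o)           ∎)))
        where
        open ≡-Reasoning
        o = # (Orb? sL y)
        lem : ∀ a o b s → a * (o * (b * s)) ≡ s * (a * b * o)
        lem = solve-∀

      coset? : Decidable (λ y → Orb full-subgroup c y × ¬ y ≡ c)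
      coset? y = Orb? full-subgroup c y ×-dec ¬? (y ≟ᶠ c)

      -- The index of K is a power of p, and not 1 because K is proper; leaving out K itself gives
      -- -1 modulo p.
      cosets : ¬ p ∣ # coset?
      cosets = from-power (orbit-power full-subgroup c λ g g∈ → refl , ∈⇒fixes (S⊆K g g∈))
        where
        from-power : ∃[ j ] # (Orb? full-subgroup c) ≡ p ^ j → ¬ p ∣ # coset?
        from-power (zero , eq) d = maximal-proper mK λ g → fixes⇒∈ {g}
          (#≡1⇒unique (Orb? full-subgroup c) eq {translate g c} {c} (g , refl , refl) (Orb-refl full-subgroup c))
        from-power (suc j , eq) d = ∤1 pp (∣m+n∣m⇒∣n (subst (p ∣_)
          (trans (sym eq) (trans (#-remove (Orb? full-subgroup c) c (Orb-refl full-subgroup c)) (+-comm 1 (# coset?)))) (m∣m*n (p ^ j))) d)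

      moves-by-conjugate : ∀ g h → translate g (translate h c) ≡ translate h (translate (h ⁻¹ ∙ g ∙ h) c)
      moves-by-conjugate g h = begin
        translate g (translate h c)               ≡⟨ sym (translate-∙ g h c) ⟩
        translate (g ∙ h) c                       ≡⟨ cong (λ x → translate x c) (trans (sym (\\-leftDividesˡ h (g ∙ h))) (cong (h ∙_) (sym (assoc (h ⁻¹) g h)))) ⟩
        translate (h ∙ (h ⁻¹ ∙ g ∙ h)) c          ≡⟨ translate-∙ h _ c ⟩
        translate h (translate (h ⁻¹ ∙ g ∙ h) c)  ∎
        where open ≡-Reasoning

      fixed-coset : ∃[ h ] ¬ h ∈ K × (∀ k → k ∈ K → (h ⁻¹ ∙ k ∙ h) ∈ K)
      fixed-coset = from-orbit ((orbits-∤ sK coset?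
        (λ { k k∈ ((h , _ , refl) , ≢c) → (k ∙ h , refl , translate-∙ k h c) ,
             λ e → ≢c (T.act-injective k (trans e (sym (∈⇒fixes k∈)))) }) cosets))
        where
        module T = Orbits translate translate-ε translate-∙
        fixed : ∀ h → ¬ translate h c ≡ c → ¬ p ∣ # (Orb? sK (translate h c)) → ∃[ j ] # (Orb? sK (translate h c)) ≡ p ^ j →
          ∃[ h ] ¬ h ∈ K × (∀ k → k ∈ K → (h ⁻¹ ∙ k ∙ h) ∈ K)
        fixed h ≢c ¬p (suc j , eq) = contradiction (subst (p ∣_) (sym eq) (m∣m*n (p ^ j))) ¬p
        fixed h ≢c _ (zero , eq) = h , (λ h∈ → ≢c (∈⇒fixes h∈)) , λ k k∈ → fixes⇒∈ (T.act-injective h (trans (sym (moves-by-conjugate k h))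
          (#≡1⇒unique (Orb? sK (translate h c)) eq {translate k (translate h c)} {translate h c} (k , k∈ , refl) (Orb-refl sK (translate h c)))))
        from-orbit : ∃[ y ] (Orb full-subgroup c y × ¬ y ≡ c) × ¬ p ∣ # (Orb? sK y) → ∃[ h ] ¬ h ∈ K × (∀ k → k ∈ K → (h ⁻¹ ∙ k ∙ h) ∈ K)
        -- S is normal and contained in K, so it fixes the coset h K; hence the length of the
        -- K-orbit of h K is a power of p, and being prime to p it is 1.
        from-orbit (_ , ((h , _ , refl) , ≢c) , ¬p) = fixed h ≢c ¬p (orbit-power sK (translate h c)
          λ g g∈ → S⊆K g g∈ , trans (moves-by-conjugate g h) (cong (translate h) (∈⇒fixes (S⊆K _ (nS h g g∈)))))

      conj-∙ : ∀ g h k → (g ∙ h) ⁻¹ ∙ k ∙ (g ∙ h) ≡ h ⁻¹ ∙ (g ⁻¹ ∙ k ∙ g) ∙ h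
      conj-∙ g h k = begin
        (g ∙ h) ⁻¹ ∙ k ∙ (g ∙ h)      ≡⟨ cong (λ x → x ∙ k ∙ (g ∙ h)) (⁻¹-anti-homo-∙ g h) ⟩
        h ⁻¹ ∙ g ⁻¹ ∙ k ∙ (g ∙ h)     ≡⟨ sym (assoc _ g h) ⟩
        h ⁻¹ ∙ g ⁻¹ ∙ k ∙ g ∙ h       ≡⟨ cong (λ x → x ∙ g ∙ h) (assoc (h ⁻¹) (g ⁻¹) k) ⟩
        h ⁻¹ ∙ (g ⁻¹ ∙ k) ∙ g ∙ h     ≡⟨ cong (_∙ h) (assoc (h ⁻¹) (g ⁻¹ ∙ k) g) ⟩
        h ⁻¹ ∙ (g ⁻¹ ∙ k ∙ g) ∙ h     ∎
        where open ≡-Reasoning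

      conj-inv : ∀ g k → (g ⁻¹) ⁻¹ ∙ (g ⁻¹ ∙ k ∙ g) ∙ g ⁻¹ ≡ k
      conj-inv g k = begin
        (g ⁻¹) ⁻¹ ∙ (g ⁻¹ ∙ k ∙ g) ∙ g ⁻¹  ≡⟨ sym (conj-∙ g (g ⁻¹) k) ⟩
        (g ∙ g ⁻¹) ⁻¹ ∙ k ∙ (g ∙ g ⁻¹)     ≡⟨ cong (λ x → x ⁻¹ ∙ k ∙ x) (inverseʳ g) ⟩
        ε ⁻¹ ∙ k ∙ ε                       ≡⟨ identityʳ _ ⟩
        ε ⁻¹ ∙ k                           ≡⟨ cong (_∙ k) ε⁻¹≈ε ⟩
        ε ∙ k                              ≡⟨ identityˡ k ⟩
        k                                  ∎
        where open ≡-Reasoning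

      conj-injective : ∀ g {k l} → g ⁻¹ ∙ k ∙ g ≡ g ⁻¹ ∙ l ∙ g → k ≡ l
      conj-injective g {k} {l} e = trans (sym (conj-inv g k)) (trans (cong (λ x → (g ⁻¹) ⁻¹ ∙ x ∙ g ⁻¹) e) (conj-inv g l))

      -- Both inclusions are recorded so that closure under inverses is formal; for the fixed coset
      -- the second follows from the first by finiteness.
      Normalises : Fin order → Set
      Normalises g = (∀ k → k ∈ K → (g ⁻¹ ∙ k ∙ g) ∈ K) × (∀ k → (g ⁻¹ ∙ k ∙ g) ∈ K → k ∈ K)

      normalises? : Decidable Normalises
      normalises? g = all? (λ k → (k ∈? K) →-dec ((g ⁻¹ ∙ k ∙ g) ∈? K)) ×-dec all? (λ k → ((g ⁻¹ ∙ k ∙ g) ∈? K) →-dec (k ∈? K))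

      ∈-normalises : ∀ {g} → g ∈ K → Normalises g
      ∈-normalises {g} g∈ = (λ k k∈ → ∙-clos sK _ g (∙-clos sK _ k (⁻¹-clos sK g g∈) k∈) g∈) ,
        λ k e → subst (_∈ K) (conj-inv g k) (∙-clos sK _ _ (∙-clos sK _ _ (⁻¹-clos sK _ (⁻¹-clos sK g g∈)) e) (⁻¹-clos sK g g∈))

      normaliser : IsSubgroup ⌜ normalises? ⌝
      normaliser = ⌜⌝-subgroup normalises? (∈-normalises (has-ε sK))
        (λ {g} {h} (a , b) (a′ , b′) → (λ k k∈ → subst (_∈ K) (sym (conj-∙ g h k)) (a′ _ (a k k∈))) ,
           λ k e → b k (b′ _ (subst (_∈ K) (conj-∙ g h k) e)))
        (λ {g} (a , b) → (λ k k∈ → b _ (subst (_∈ K) (sym (back g k)) k∈)) , λ k e → subst (_∈ K) (back g k) (a _ e))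
        where
        back : ∀ g k → g ⁻¹ ∙ ((g ⁻¹) ⁻¹ ∙ k ∙ g ⁻¹) ∙ g ≡ k
        back g k = trans (cong (λ x → g ⁻¹ ∙ ((g ⁻¹) ⁻¹ ∙ k ∙ g ⁻¹) ∙ x) (sym (⁻¹-involutive g)))
          (trans (cong (λ x → x ∙ ((g ⁻¹) ⁻¹ ∙ k ∙ g ⁻¹) ∙ (g ⁻¹) ⁻¹) (sym (⁻¹-involutive (g ⁻¹)))) (conj-inv (g ⁻¹) k))

    opaque
      maximal-normal : Normal K
      maximal-normal = from-fixed fixed-coset
        where
        from-fixed : ∃[ h ] ¬ h ∈ K × (∀ k → k ∈ K → (h ⁻¹ ∙ k ∙ h) ∈ K) → Normal K
        from-fixed (h , h∉ , into) g = proj₁ (∈⌜⌝⁻ normalises? {g} (maximal-∌⇒⊇ mK normaliser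
            (λ g g∈ → ∈⌜⌝⁺ normalises? (∈-normalises g∈)) {h} (∈⌜⌝⁺ normalises? {h} (into , onto)) h∉ g))
          where
          onto : ∀ k → (h ⁻¹ ∙ k ∙ h) ∈ K → k ∈ K
          onto k e =
            let k′ , k′∈ , eq = #-injection-onto (_∈? K) (_∈? K) (λ k → h ⁻¹ ∙ k ∙ h) into (λ _ _ _ _ → conj-injective h) ≤-refl _ e
            in subst (_∈ K) (conj-injective h eq) k′∈

  -- For K maximal and normal, the elements commuting with g modulo K form a subgroup containing K and g.
  module _ {K : SubsetG} (mK : IsMaximal K) (nK : Normal K) where

    private
      sK = proj₁ mK

      infix 4 _≈_ _≈?_
      _≈_ : Fin order → Fin order → Set
      a ≈ b = (a ⁻¹ ∙ b) ∈ K

      _≈?_ : ∀ a b → Dec (a ≈ b)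
      a ≈? b = (a ⁻¹ ∙ b) ∈? K

      ≈-refl : ∀ {a} → a ≈ a
      ≈-refl {a} = subst (_∈ K) (sym (inverseˡ a)) (has-ε sK)

      ≈-trans : ∀ {a b c} → a ≈ b → b ≈ c → a ≈ c
      ≈-trans {a} {b} {c} e f = subst (_∈ K) (trans (assoc (a ⁻¹) b (b ⁻¹ ∙ c)) (cong (a ⁻¹ ∙_) (\\-leftDividesˡ b c))) (∙-clos sK _ _ e f)

      ≈-sym : ∀ {a b} → a ≈ b → b ≈ a
      ≈-sym {a} {b} e = subst (_∈ K) (trans (⁻¹-anti-homo-∙ (a ⁻¹) b) (cong (b ⁻¹ ∙_) (⁻¹-involutive a))) (⁻¹-clos sK _ e)

      ≈-congˡ : ∀ c {a b} → a ≈ b → c ∙ a ≈ c ∙ b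
      ≈-congˡ c {a} {b} = subst (_∈ K) (sym (begin
        (c ∙ a) ⁻¹ ∙ (c ∙ b)      ≡⟨ cong (_∙ (c ∙ b)) (⁻¹-anti-homo-∙ c a) ⟩
        a ⁻¹ ∙ c ⁻¹ ∙ (c ∙ b)     ≡⟨ assoc _ _ _ ⟩
        a ⁻¹ ∙ (c ⁻¹ ∙ (c ∙ b))   ≡⟨ cong (a ⁻¹ ∙_) (\\-leftDividesʳ c b) ⟩
        a ⁻¹ ∙ b                  ∎))
        where open ≡-Reasoning

      ≈-congʳ : ∀ c {a b} → a ≈ b → a ∙ c ≈ b ∙ c
      ≈-congʳ c {a} {b} e = subst (_∈ K) (sym (begin
        (a ∙ c) ⁻¹ ∙ (b ∙ c)      ≡⟨ cong (_∙ (b ∙ c)) (⁻¹-anti-homo-∙ a c) ⟩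
        c ⁻¹ ∙ a ⁻¹ ∙ (b ∙ c)     ≡⟨ sym (assoc _ b c) ⟩
        c ⁻¹ ∙ a ⁻¹ ∙ b ∙ c       ≡⟨ cong (_∙ c) (assoc (c ⁻¹) (a ⁻¹) b) ⟩
        c ⁻¹ ∙ (a ⁻¹ ∙ b) ∙ c     ∎)) (nK c _ e)
        where open ≡-Reasoning

      commutes? : ∀ g → Decidable (λ h → h ∙ g ≈ g ∙ h)
      commutes? g h = (h ∙ g) ≈? (g ∙ h)

      centraliser : ∀ g → IsSubgroup ⌜ commutes? g ⌝
      centraliser g = ⌜⌝-subgroup (commutes? g)
        (subst₂ _≈_ (sym (identityˡ g)) (sym (identityʳ g)) ≈-refl)
        (λ {h} {k} e f → ≈-trans (subst₂ _≈_ (sym (assoc h k g)) (sym (assoc h g k)) (≈-congˡ h f))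
           (subst₂ _≈_ refl (assoc g h k) (≈-congʳ k e)))
        (λ {h} e → ≈-sym (subst₂ _≈_ (cong (_∙ h ⁻¹) (\\-leftDividesʳ h g)) refl
           (subst₂ _≈_ refl (trans (assoc (h ⁻¹) _ (h ⁻¹)) (cong (h ⁻¹ ∙_) (//-rightDividesʳ h g))) (≈-congʳ (h ⁻¹) (≈-congˡ (h ⁻¹) e)))))

    commutator-∈ : ∀ g h → commutator g h ∈ K
    commutator-∈ g h with g ∈? K
    ... | no g∉ = subst (_∈ K) (cong (_∙ (g ∙ h)) (⁻¹-anti-homo-∙ h g)) (∈⌜⌝⁻ (commutes? g) {h}
           (maximal-∌⇒⊇ mK (centraliser g) (λ k k∈ → ∈⌜⌝⁺ (commutes? g) (central k k∈)) (∈⌜⌝⁺ (commutes? g) {g} ≈-refl) g∉ h))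
      where
      central : ∀ k → k ∈ K → k ∙ g ≈ g ∙ k
      central k k∈ = subst (_∈ K) (trans (assoc _ g k) (cong (_∙ (g ∙ k)) (sym (⁻¹-anti-homo-∙ k g))))
        (∙-clos sK _ k (nK g _ (⁻¹-clos sK k k∈)) k∈)
    ... | yes g∈ = subst (_∈ K) (trans (cong (g ⁻¹ ∙_) (assoc (h ⁻¹) g h)) (sym (assoc (g ⁻¹) (h ⁻¹) (g ∙ h))))
           (∙-clos sK _ _ (⁻¹-clos sK g g∈) (nK h g g∈))

-- Reflection of Boolean conjunction and search

∧-true⁻ : ∀ {a b} → a ∧ b ≡ true → a ≡ true × b ≡ true
∧-true⁻ {true} {true} _ = refl , refl

∧-true⁺ : ∀ {a b} → a ≡ true → b ≡ true → a ∧ b ≡ true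
∧-true⁺ refl refl = refl

anyFin⁺ : ∀ {n} (f : Fin n → Bool) i → f i ≡ true → anyFin f ≡ true
anyFin⁺ f zero e rewrite e = refl
anyFin⁺ f (suc i) e with f zero
... | true = refl
... | false = anyFin⁺ (f ∘ suc) i e

anyFin⁻ : ∀ {n} (f : Fin n → Bool) → anyFin f ≡ true → ∃[ i ] f i ≡ true
anyFin⁻ {suc n} f e with f zero in eq
... | true = zero , eq
... | false = let i , e′ = anyFin⁻ (f ∘ suc) e in suc i , e′

-- Generalized quadrangles

module Incidence {np nl : ℕ} (I : Fin np → Fin nl → Bool) where
  open Geometry I public

  On : Fin np → Fin nl → Set
  On p L = I p L ≡ true

  On? : ∀ p L → Dec (On p L)
  On? p L = I p L Bool.≟ true

  Col : Fin np → Fin np → Set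
  Col p q = ∃[ L ] On p L × On q L

  Col? : ∀ p q → Dec (Col p q)
  Col? p q = any? λ L → On? p L ×-dec On? q L

  Col-sym : ∀ {p q} → Col p q → Col q p
  Col-sym (L , a , b) = L , b , a

  col⁺ : ∀ Ln {p q L} → Ln L ≡ true → On p L → On q L → col Ln p q ≡ true
  col⁺ Ln {p} {q} {L} l a b = anyFin⁺ (λ L → Ln L ∧ (I p L ∧ I q L)) L (∧-true⁺ l (∧-true⁺ a b))

  col⁻ : ∀ Ln {p q} → col Ln p q ≡ true → ∃[ L ] Ln L ≡ true × On p L × On q L
  col⁻ Ln {p} {q} e = let L , f = anyFin⁻ (λ L → Ln L ∧ (I p L ∧ I q L)) e
                          l , g = ∧-true⁻ f in L , l , ∧-true⁻ g

  Col⇒col : ∀ {p q} → Col p q → col allL p q ≡ true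
  Col⇒col (L , a , b) = col⁺ allL refl a b

  col⇒Col : ∀ {p q} → col allL p q ≡ true → Col p q
  col⇒Col e = let L , _ , a , b = col⁻ allL e in L , a , b

  ¬Col⇒col≡false : ∀ {p q} → ¬ Col p q → col allL p q ≡ false
  ¬Col⇒col≡false ¬c = Bool.¬-not (¬c ∘ col⇒Col)

  col≡false⇒¬Col : ∀ {p q} → col allL p q ≡ false → ¬ Col p q
  col≡false⇒¬Col e c = contradiction (trans (sym e) (Col⇒col c)) λ ()

  Meet : Fin nl → Fin nl → Set
  Meet L M = ∃[ p ] On p L × On p M

  Meet? : ∀ L M → Dec (Meet L M)
  Meet? L M = any? λ p → On? p L ×-dec On? p M

  module Quadrangle {s t : ℕ} (gq : IsGQ allP allL s t) where

    line-size : ∀ L → # (λ p → On? p L) ≡ suc s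
    line-size L = trans (sym (count≡# (λ p → allP p ∧ I p L) (λ p → On? p L) (λ _ → id) (λ _ → id))) (IsGQ.lineSize gq L refl)

    point-degree : ∀ p → # (On? p) ≡ suc t
    point-degree p = trans (sym (count≡# (λ L → allL L ∧ I p L) (On? p) (λ _ → id) (λ _ → id))) (IsGQ.pointDeg gq p refl)

    private
      projections : ∀ {p L} → ¬ On p L → # (λ q → On? q L ×-dec Col? p q) ≡ 1
      projections {p} {L} p∉L = trans (sym (count≡# (λ q → allP q ∧ (I q L ∧ col allL p q)) (λ q → On? q L ×-dec Col? p q)
        (λ q e → let a , b = ∧-true⁻ e in a , col⇒Col b) (λ q (a , b) → ∧-true⁺ a (Col⇒col b))))
        (IsGQ.gqAxiom gq p L refl refl (Bool.¬-not p∉L))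

    opaque
      project : ∀ {p L} → ¬ On p L → ∃[ q ] On q L × Col p q
      project {p} {L} p∉L = #-inhabited (λ q → On? q L ×-dec Col? p q) (≤-reflexive (sym (projections p∉L)))

      project-unique : ∀ {p L q r} → ¬ On p L → On q L → Col p q → On r L → Col p r → q ≡ r
      project-unique {p} {L} p∉L a b c d = #≡1⇒unique (λ q → On? q L ×-dec Col? p q) (projections p∉L) (a , b) (c , d)

    opaque
      line-through : ∀ p → ∃[ L ] On p L
      line-through p = #-inhabited (On? p) (subst (1 ≤_) (sym (point-degree p)) (s≤s z≤n))

    Col-refl : ∀ p → Col p p
    Col-refl p = let L , a = line-through p in L , a , a

    opaque
      point-on : ∀ L → ∃[ p ] On p L
      point-on L = #-inhabited (λ p → On? p L) (subst (1 ≤_) (sym (line-size L)) (s≤s z≤n))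

    other-points : ∀ {p L} → On p L → # (λ q → On? q L ×-dec ¬? (q ≟ᶠ p)) ≡ s
    other-points {p} {L} a = suc-injective (trans (sym (#-remove (λ q → On? q L) p a)) (line-size L))

    other-lines : ∀ {p L} → On p L → # (λ M → On? p M ×-dec ¬? (M ≟ᶠ L)) ≡ t
    other-lines {p} {L} a = suc-injective (trans (sym (#-remove (On? p) L a)) (point-degree p))

    module Linear (linear : ∀ {L M p q} → On p L → On q L → On p M → On q M → ¬ p ≡ q → L ≡ M) where

      meet-unique : ∀ {L M p q} → ¬ L ≡ M → On p L → On p M → On q L → On q M → p ≡ q
      meet-unique {p = p} {q} L≢M a b c d with p ≟ᶠ q
      ... | yes e = e
      ... | no ne = contradiction (linear a c b d ne) L≢M

      Transversal? : ∀ L M → Decidable (λ N → Meet L N × Meet M N)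
      Transversal? L M N = Meet? L N ×-dec Meet? M N

      opaque
        transversal-through : ∀ {L M p} → On p L → ¬ On p M →
          ∃[ N ] On p N × Meet M N × (∀ {K} → On p K → Meet M K → K ≡ N)
        transversal-through {M = M} p∈L p∉M =
          let q , q∈M , N , p∈N , q∈N = project p∉M in
          N , p∈N , (q , q∈M , q∈N) , λ { {K} p∈K (q′ , q′∈M , q′∈K) → linear p∈K
            (subst (λ r → On r K) (project-unique p∉M q′∈M (K , p∈K , q′∈K) q∈M (N , p∈N , q∈N)) q′∈K) p∈N q∈N
            λ e → p∉M (subst (λ r → On r M) (sym e) q∈M) }

      -- Each of the s + 1 points of L lies on exactly one of them.
      transversals : ∀ {L M} → ¬ Meet L M → # (Transversal? L M) ≡ suc s
      transversals {L} {M} L∥M = trans (sym (double-1 (λ p → On? p L) (Transversal? L M) R?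
          (λ {p} (a , b , m) → a , (p , a , b) , m)
          (λ p a → let N , p∈N , m , u = transversal-through a (λ b → L∥M (p , a , b)) in
             #-unique (R? p) N (a , p∈N , m) λ _ (_ , p∈K , m′) → u p∈K m′)
          (λ { N ((p , a , b) , m@(q , q∈M , q∈N)) → #-unique (λ p → R? p N) p (a , b , m) λ r (c , d , _) →
             meet-unique (λ { refl → L∥M (q , q∈N , q∈M) }) c d a b })))
        (line-size L)
        where
        R? : ∀ p N → Dec (On p L × On p N × Meet M N)
        R? p N = On? p L ×-dec On? p N ×-dec Meet? M N

      -- Fix p₀ on L. A line missing L contains exactly one point r collinear with p₀, and r is one
      -- of the t s points on the other lines through p₀. Conversely, the t lines through such an r
      -- that avoid p₀ all miss L, since there are no triangles.
      lines-missing : ∀ L → # (λ K → ¬? (Meet? L K)) ≡ t * s * t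
      lines-missing L = trans (sym (*-identityʳ _)) (trans
          (sym (double-≡ W? (λ K → ¬? (Meet? L K)) S? {t} {1} S⇒ lines-at unique-at)) (cong (_* t) #W))
        where
        p₀ = proj₁ (point-on L)
        p₀∈L = proj₂ (point-on L)
        R? : ∀ N r → Dec ((On p₀ N × ¬ N ≡ L) × On r N × ¬ r ≡ p₀)
        R? N r = (On? p₀ N ×-dec ¬? (N ≟ᶠ L)) ×-dec On? r N ×-dec ¬? (r ≟ᶠ p₀)
        W : Fin np → Set
        W r = ∃[ N ] (On p₀ N × ¬ N ≡ L) × On r N × ¬ r ≡ p₀
        W? : Decidable W
        W? r = any? λ N → R? N r
        #W : # W? ≡ t * s
        #W = trans (sym (trans
          (double-≡ (λ N → On? p₀ N ×-dec ¬? (N ≟ᶠ L)) W? R? {s} {1}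
            (λ {N} (a , b) → a , N , a , b)
            (λ N a → trans (#-cong (R? N) (λ r → On? r N ×-dec ¬? (r ≟ᶠ p₀)) (λ _ → proj₂) (λ _ b → a , b)) (other-points (proj₁ a)))
            (λ { r (N , a@(p∈N , _) , b@(r∈N , r≢p)) → #-unique (λ N → R? N r) N (a , b)
               λ M ((p∈M , _) , r∈M , _) → linear r∈M p∈M r∈N p∈N r≢p }))
          (*-identityʳ _))) (cong (_* s) (other-lines p₀∈L))
        S? : ∀ r K → Dec (W r × On r K × ¬ On p₀ K)
        S? r K = W? r ×-dec On? r K ×-dec ¬? (On? p₀ K)
        off-L : ∀ {r} → W r → ¬ On r L
        off-L (N , (a , N≢L) , b , r≢p) c = N≢L (linear b a c p₀∈L r≢p)
        S⇒ : ∀ {r K} → W r × On r K × ¬ On p₀ K → W r × ¬ Meet L K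
        S⇒ {r} {K} (w@(N , (a , _) , b , _) , r∈K , p∉K) = w , λ (q , q∈L , q∈K) →
          p∉K (subst (λ x → On x K) (project-unique (off-L w) q∈L (K , r∈K , q∈K) p₀∈L (N , b , a)) q∈K)
        lines-at : ∀ r → W r → # (S? r) ≡ t
        lines-at r w@(N , (p∈N , _) , r∈N , r≢p) = trans
          (#-cong (S? r) (λ K → On? r K ×-dec ¬? (K ≟ᶠ N))
            (λ { K (_ , r∈K , p∉K) → r∈K , λ { refl → p∉K p∈N } })
            (λ K (r∈K , K≢N) → w , r∈K , λ p∈K → K≢N (linear r∈K p∈K r∈N p∈N r≢p)))
          (other-lines r∈N)
        unique-at : ∀ K → ¬ Meet L K → # (λ r → S? r K) ≡ 1
        unique-at K L∥K =
          let p∉K = λ b → L∥K (p₀ , p₀∈L , b)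
              r , r∈K , N , p∈N , r∈N = project p∉K
              w : W r
              w = N , (p∈N , (λ N≡L → L∥K (r , subst (On r) N≡L r∈N , r∈K))) , r∈N , λ r≡p → p∉K (subst (λ x → On x K) r≡p r∈K)
          in #-unique (λ r → S? r K) r (w , r∈K , p∉K)
               λ { q ((M , (p∈M , _) , q∈M , _) , q∈K , _) → project-unique p∉K q∈K (M , p∈M , q∈M) r∈K (N , p∈N , r∈N) }

      -- Higman's inequality in its dual form: the numbers τ K of common transversals of L and M that meet
      -- the lines K missing both L and M satisfy Σ (t τ K - (s + t))² ≥ 0.
      module Higman {s′ t′ : ℕ} (s≡ : s ≡ suc s′) (t≡ : t ≡ suc t′) {L M : Fin nl} (L∥M : ¬ Meet L M) where

        V? : Decidable (λ K → ¬ Meet L K × ¬ Meet M K)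
        V? K = ¬? (Meet? L K) ×-dec ¬? (Meet? M K)

        Tr? : Decidable (λ N → Meet L N × Meet M N)
        Tr? = Transversal? L M

        -- Among the lines missing L, those that meet M are M itself and, at each of the s + 1
        -- points of M, the t - 1 lines other than M and the transversal to L.
        #V : # V? + suc (suc s * t′) ≡ t * s * t
        #V = trans (trans (+-comm (# V?) _) (cong (_+ # V?) (sym (trans (#-remove B? M M∈B) (cong suc #B))))) (trans (sym (#-split (λ K → ¬? (Meet? L K)) (Meet? M))) (lines-missing L))
          where
          B? : Decidable (λ K → ¬ Meet L K × Meet M K)
          B? K = ¬? (Meet? L K) ×-dec Meet? M K
          M∈B : ¬ Meet L M × Meet M M
          M∈B = L∥M , let p , a = point-on M in p , a , a
          B′? : Decidable (λ K → (¬ Meet L K × Meet M K) × ¬ K ≡ M)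
          B′? K = B? K ×-dec ¬? (K ≟ᶠ M)
          R? : ∀ r K → Dec (On r M × On r K × ¬ Meet L K × ¬ K ≡ M)
          R? r K = On? r M ×-dec On? r K ×-dec ¬? (Meet? L K) ×-dec ¬? (K ≟ᶠ M)
          #B : # B′? ≡ suc s * t′
          #B = trans (sym (*-identityʳ _)) (trans (sym (double-≡ (λ r → On? r M) B′? R? {t′} {1}
              (λ {r} (a , b , c , d) → a , (c , r , a , b) , d)
              (λ r r∈M → let N , r∈N , m , u = transversal-through {M = L} r∈M (λ r∈L → L∥M (r , r∈L , r∈M)) in
                suc-injective (trans (trans (cong suc (#-cong (R? r) (λ K → (On? r K ×-dec ¬? (K ≟ᶠ M)) ×-dec ¬? (K ≟ᶠ N))
                  (λ K (_ , r∈K , L∥K , K≢M) → (r∈K , K≢M) , λ e → L∥K (subst (Meet L) (sym e) m))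
                  (λ K ((r∈K , K≢M) , K≢N) → r∈M , r∈K , (λ m′ → K≢N (u r∈K m′)) , K≢M)))
                  (trans (sym (#-remove (λ K → On? r K ×-dec ¬? (K ≟ᶠ M)) N (r∈N , λ e → L∥M (subst (Meet L) e m)))) (other-lines r∈M))) t≡))
              (λ { K ((L∥K , r , r∈M , r∈K) , K≢M) → #-unique (λ r → R? r K) r (r∈M , r∈K , L∥K , K≢M)
                λ q (q∈M , q∈K , _) → meet-unique (λ e → K≢M (sym e)) q∈M q∈K r∈M r∈K })))
            (cong (_* t′) (line-size M)))

        module _ {N : Fin nl} (trN : Meet L N × Meet M N) where
          private
            p = proj₁ (proj₁ trN)
            p∈L = proj₁ (proj₂ (proj₁ trN))
            p∈N = proj₂ (proj₂ (proj₁ trN))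
            q = proj₁ (proj₂ trN)
            q∈M = proj₁ (proj₂ (proj₂ trN))
            q∈N = proj₂ (proj₂ (proj₂ trN))
            N≢L : ¬ N ≡ L
            N≢L e = L∥M (q , subst (On q) e q∈N , q∈M)
            N≢M : ¬ N ≡ M
            N≢M e = L∥M (p , p∈L , subst (On p) e p∈N)
            p≢q : ¬ q ≡ p
            p≢q e = L∥M (p , p∈L , subst (λ x → On x M) e q∈M)

          middle-points : # (λ r → On? r N ×-dec ¬? (On? r L) ×-dec ¬? (On? r M)) ≡ s′
          middle-points = suc-injective (trans (trans (cong suc (#-cong (λ r → On? r N ×-dec ¬? (On? r L) ×-dec ¬? (On? r M))
              (λ r → (On? r N ×-dec ¬? (r ≟ᶠ p)) ×-dec ¬? (r ≟ᶠ q))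
              (λ { r (a , b , c) → (a , λ { refl → b p∈L }) , λ { refl → c q∈M } })
              (λ r ((a , b) , c) → a , (λ d → b (meet-unique N≢L a d p∈N p∈L)) , λ d → c (meet-unique N≢M a d q∈N q∈M))))
              (trans (sym (#-remove (λ r → On? r N ×-dec ¬? (r ≟ᶠ p)) q (q∈N , p≢q))) (other-points p∈N))) s≡)

          -- N has s - 1 points off L and M. The t further lines through such a point miss both L
          -- and M, as otherwise a triangle would arise.
          τ-row : # (λ K → V? K ×-dec Meet? N K) ≡ s′ * t
          τ-row = trans (sym (*-identityʳ _)) (trans (sym (double-≡ (λ r → On? r N ×-dec ¬? (On? r L) ×-dec ¬? (On? r M))
              (λ K → V? K ×-dec Meet? N K) R? {t} {1}
              (λ {r} {K} (m@(r∈N , r∉L , r∉M) , r∈K , K≢N) → m , (missing r∈N p∈N p∈L r∉L r∈K K≢N , missing r∈N q∈N q∈M r∉M r∈K K≢N) , r , r∈N , r∈K)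
              (λ r m → trans (#-cong (R? r) (λ K → On? r K ×-dec ¬? (K ≟ᶠ N)) (λ _ → proj₂) (λ _ a → m , a)) (other-lines (proj₁ m)))
              (λ { K ((L∥K , M∥K) , r , r∈N , r∈K) →
                 let K≢N = λ K≡N → L∥K (subst (Meet L) (sym K≡N) (proj₁ trN)) in
                 #-unique (λ r → R? r K) r ((r∈N , (λ r∈L → L∥K (r , r∈L , r∈K)) , (λ r∈M → M∥K (r , r∈M , r∈K))) , r∈K , K≢N)
                 λ { x ((x∈N , _) , x∈K , _) → meet-unique K≢N x∈K x∈N r∈K r∈N } })))
              (cong (_* t) middle-points))
            where
            R? : ∀ r K → Dec ((On r N × ¬ On r L × ¬ On r M) × On r K × ¬ K ≡ N)
            R? r K = (On? r N ×-dec ¬? (On? r L) ×-dec ¬? (On? r M)) ×-dec On? r K ×-dec ¬? (K ≟ᶠ N)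
            missing : ∀ {r a K A} → On r N → On a N → On a A → ¬ On r A → On r K → ¬ K ≡ N → ¬ Meet A K
            missing {r} {a} {K} {A} r∈N a∈N a∈A r∉A r∈K K≢N (x , x∈A , x∈K) =
              K≢N (linear r∈K (subst (λ y → On y K) (project-unique r∉A x∈A (K , r∈K , x∈K) a∈A (N , r∈N , a∈N)) x∈K) r∈N a∈N
                λ { refl → r∉A a∈A })

          -- N and N′ are disjoint, since a common point would give a triangle with L or M. So they
          -- have s + 1 common transversals, among them L and M; the remaining s - 1 miss both L and
          -- M.
          pair : ∀ {N′} → Meet L N′ × Meet M N′ → ¬ N′ ≡ N → # (λ K → V? K ×-dec Meet? N K ×-dec Meet? N′ K) ≡ s′
          pair {N′} ((p′ , p′∈L , p′∈N′) , (q′ , q′∈M , q′∈N′)) N′≢N = suc-injective (suc-injective (trans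
              (cong (2 +_) (#-cong (λ K → V? K ×-dec Meet? N K ×-dec Meet? N′ K)
                (λ K → (Transversal? N N′ K ×-dec ¬? (K ≟ᶠ L)) ×-dec ¬? (K ≟ᶠ M))
                (λ { K ((L∥K , M∥K) , m) → (m , λ { refl → L∥K (p , p∈L , p∈L) }) , λ { refl → M∥K (q , q∈M , q∈M) } })
                (λ K ((m , K≢L) , K≢M) → (missing K≢L p∈L p∈N p′∈L p′∈N′ m , missing K≢M q∈M q∈N q′∈M q′∈N′ m) , m)))
              (trans (cong suc (sym (#-remove (λ K → Transversal? N N′ K ×-dec ¬? (K ≟ᶠ L)) M
                  (((q , q∈N , q∈M) , q′ , q′∈N′ , q′∈M) , λ M≡L → L∥M (p , p∈L , subst (On p) (sym M≡L) p∈L)))))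
                (trans (sym (#-remove (Transversal? N N′) L ((p , p∈N , p∈L) , p′ , p′∈N′ , p′∈L))) (trans (transversals N∥N′) (cong suc s≡))))))
            where
            N∥N′ : ¬ Meet N N′
            N∥N′ (r , r∈N , r∈N′) with On? r L
            ... | no r∉L = N′≢N (linear r∈N′ (subst (λ x → On x N′) (project-unique r∉L p′∈L (N′ , r∈N′ , p′∈N′) p∈L (N , r∈N , p∈N)) p′∈N′)
                             r∈N p∈N λ { refl → r∉L p∈L })
            ... | yes r∈L = N′≢N (linear r∈N′ (subst (λ x → On x N′) (project-unique r∉M q′∈M (N′ , r∈N′ , q′∈N′) q∈M (N , r∈N , q∈N)) q′∈N′)
                             r∈N q∈N λ { refl → r∉M q∈M })
              where
              r∉M : ¬ On r M
              r∉M r∈M = L∥M (r , r∈L , r∈M)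
            missing : ∀ {A a a′ K} → ¬ K ≡ A → On a A → On a N → On a′ A → On a′ N′ → Meet N K × Meet N′ K → ¬ Meet A K
            missing {A} {a} {a′} {K} K≢A a∈A a∈N a′∈A a′∈N′ ((k , k∈N , k∈K) , (k′ , k′∈N′ , k′∈K)) (r , r∈A , r∈K) =
              K≢A (linear k∈K k′∈K (subst (λ x → On x A) (sym k≡a) a∈A) (subst (λ x → On x A) (sym k′≡a′) a′∈A)
                λ { refl → N∥N′ (k , k∈N , k′∈N′) })
              where
              on-corner : ∀ {X x y} → On x X → On x A → On y X → On y K → ¬ On r X → y ≡ x
              on-corner {X} x∈X x∈A y∈X y∈K r∉X = project-unique r∉X y∈X (K , r∈K , y∈K) x∈X (A , r∈A , x∈A)
              k≡a : k ≡ a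
              k≡a with On? r N
              ... | no r∉N = on-corner a∈N a∈A k∈N k∈K r∉N
              ... | yes r∈N with k ≟ᶠ r
              ...   | yes refl = meet-unique (λ { refl → N∥N′ (a′ , a′∈A , a′∈N′) }) r∈N r∈A a∈N a∈A
              ...   | no k≢r = contradiction (subst (Meet N′) (linear k∈K r∈K k∈N r∈N k≢r) (k′ , k′∈N′ , k′∈K)) λ (x , x∈N′ , x∈N) → N∥N′ (x , x∈N , x∈N′)
              k′≡a′ : k′ ≡ a′
              k′≡a′ with On? r N′
              ... | no r∉N′ = on-corner a′∈N′ a′∈A k′∈N′ k′∈K r∉N′
              ... | yes r∈N′ with k′ ≟ᶠ r
              ...   | yes refl = meet-unique (λ { refl → N∥N′ (a , a∈N , a∈A) }) r∈N′ r∈A a′∈N′ a′∈A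
              ...   | no k′≢r = contradiction (subst (Meet N) (linear k′∈K r∈K k′∈N′ r∈N′ k′≢r) (k , k∈N , k∈K)) N∥N′

        R? : ∀ N K → Dec ((Meet L N × Meet M N) × (¬ Meet L K × ¬ Meet M K) × Meet N K)
        R? N K = Tr? N ×-dec V? K ×-dec Meet? N K

        τ : Fin nl → ℕ
        τ K = # (λ N → R? N K)

        #Tr : # Tr? ≡ suc s
        #Tr = transversals L∥M

        Στ : sum τ ≡ suc s * (s′ * t)
        Στ = begin
          sum τ                      ≡⟨ sym (sum-swap Tr? V? R?) ⟩
          sum (λ N → # (R? N))       ≡⟨ sum≡#* Tr? (λ N tr → trans (#-cong (R? N) (λ K → V? K ×-dec Meet? N K) (λ _ → proj₂) (λ _ a → tr , a)) (τ-row tr))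
                                          (λ N ¬tr → #-none (R? N) λ K r → ¬tr (proj₁ r)) ⟩
          # Tr? * (s′ * t)           ≡⟨ cong (_* (s′ * t)) #Tr ⟩
          suc s * (s′ * t)           ∎
          where open ≡-Reasoning

        1*# : ∀ {A : Set} (a? : Dec A) {m} {P : Fin m → Set} (P? : Decidable P) → # P? * 1[ a? ] ≡ # (λ i → a? ×-dec P? i)
        1*# (yes a) P? = trans (*-identityʳ _) (#-cong P? (λ i → yes a ×-dec P? i) (λ _ p → a , p) (λ _ → proj₂))
        1*# (no ¬a) P? = trans (*-zeroʳ (# P?)) (sym (#-none (λ i → no ¬a ×-dec P? i) λ _ r → ¬a (proj₁ r)))

        -- Ordered pairs of transversals are counted: for each N, the pair (N, N) contributes
        -- `s′ * t` and each of the s pairs with N′ different from N contributes `s′`.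
        Στ² : sum (λ K → τ K * τ K) ≡ suc s * (s′ * t + s * s′)
        Στ² = begin
          sum (λ K → τ K * τ K)                           ≡⟨ sum-cong-≗ (λ K → trans (cong (τ K *_) (#-def (λ N → R? N K))) (*-distribˡ-sum (τ K) (λ N → 1[ R? N K ]))) ⟩
          sum (λ K → sum (λ N → τ K * 1[ R? N K ]))       ≡⟨ ∑-comm (λ K N → τ K * 1[ R? N K ]) ⟩
          sum (λ N → sum (λ K → τ K * 1[ R? N K ]))       ≡⟨ sum≡#* Tr? row off ⟩
          # Tr? * (s′ * t + s * s′)                       ≡⟨ cong (_* (s′ * t + s * s′)) #Tr ⟩
          suc s * (s′ * t + s * s′)                       ∎
          where
          open ≡-Reasoning
          off : ∀ N → ¬ (Meet L N × Meet M N) → sum (λ K → τ K * 1[ R? N K ]) ≡ 0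
          off N ¬tr = trans (sum≡#* V? {a = 0} (λ K _ → zero-at K) (λ K _ → zero-at K)) (*-zeroʳ (# V?))
            where
            zero-at : ∀ K → τ K * 1[ R? N K ] ≡ 0
            zero-at K = trans (1*# (R? N K) (λ N′ → R? N′ K)) (#-none (λ N′ → R? N K ×-dec R? N′ K) λ _ r → ¬tr (proj₁ (proj₁ r)))
          row : ∀ N → Meet L N × Meet M N → sum (λ K → τ K * 1[ R? N K ]) ≡ s′ * t + s * s′
          row N tr = begin
            sum (λ K → τ K * 1[ R? N K ])
              ≡⟨ sum-cong-≗ (λ K → trans (1*# (R? N K) (λ N′ → R? N′ K)) (#-split (λ N′ → R? N K ×-dec R? N′ K) (λ N′ → N′ ≟ᶠ N))) ⟩
            sum (λ K → # (λ N′ → (R? N K ×-dec R? N′ K) ×-dec (N′ ≟ᶠ N)) + # (λ N′ → (R? N K ×-dec R? N′ K) ×-dec ¬? (N′ ≟ᶠ N)))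
              ≡⟨ ∑-distrib-+ (λ K → # (λ N′ → (R? N K ×-dec R? N′ K) ×-dec (N′ ≟ᶠ N))) (λ K → # (λ N′ → (R? N K ×-dec R? N′ K) ×-dec ¬? (N′ ≟ᶠ N))) ⟩
            sum (λ K → # (λ N′ → (R? N K ×-dec R? N′ K) ×-dec (N′ ≟ᶠ N))) + sum (λ K → # (λ N′ → (R? N K ×-dec R? N′ K) ×-dec ¬? (N′ ≟ᶠ N)))
              ≡⟨ cong₂ _+_ diagonal off-diagonal ⟩
            s′ * t + s * s′ ∎
            where
            VN? : Decidable (λ K → (¬ Meet L K × ¬ Meet M K) × Meet N K)
            VN? K = V? K ×-dec Meet? N K
            diagonal : sum (λ K → # (λ N′ → (R? N K ×-dec R? N′ K) ×-dec (N′ ≟ᶠ N))) ≡ s′ * t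
            diagonal = trans (sum≡#* VN? (λ K v → #-unique (λ N′ → (R? N K ×-dec R? N′ K) ×-dec (N′ ≟ᶠ N)) N (((tr , v) , tr , v) , refl) λ _ → proj₂)
                (λ K ¬v → #-none (λ N′ → (R? N K ×-dec R? N′ K) ×-dec (N′ ≟ᶠ N)) λ _ r → ¬v (proj₂ (proj₁ (proj₁ r)))))
              (trans (*-identityʳ _) (τ-row tr))
            Tr′? : Decidable (λ N′ → (Meet L N′ × Meet M N′) × ¬ N′ ≡ N)
            Tr′? N′ = Tr? N′ ×-dec ¬? (N′ ≟ᶠ N)
            off-diagonal : sum (λ K → # (λ N′ → (R? N K ×-dec R? N′ K) ×-dec ¬? (N′ ≟ᶠ N))) ≡ s * s′
            off-diagonal = trans (sum-swap V? Tr′? (λ K N′ → (R? N K ×-dec R? N′ K) ×-dec ¬? (N′ ≟ᶠ N)))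
              (trans (sum≡#* Tr′? (λ N′ (tr′ , ne) → trans (#-cong (λ K → (R? N K ×-dec R? N′ K) ×-dec ¬? (N′ ≟ᶠ N)) (λ K → V? K ×-dec Meet? N K ×-dec Meet? N′ K)
                    (λ K (((_ , v , a) , (_ , _ , b)) , _) → v , a , b) (λ K (v , a , b) → ((tr , v , a) , tr′ , v , b) , ne)) (pair tr tr′ ne))
                  (λ N′ ¬tr → #-none (λ K → (R? N K ×-dec R? N′ K) ×-dec ¬? (N′ ≟ᶠ N)) λ K ((_ , r) , ne) → ¬tr (proj₁ r , ne)))
                (cong (_* s′) (suc-injective (trans (sym (#-remove Tr? N tr)) #Tr))))

        2ab≤a²+b² : ∀ a b → 2 * (a * b) ≤ a * a + b * b
        2ab≤a²+b² a b = [ go , (λ b≤a → subst₂ _≤_ (cong (2 *_) (*-comm b a)) (+-comm (b * b) (a * a)) (go b≤a)) ]′ (≤-total a b)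
          where
          go : ∀ {a b} → a ≤ b → 2 * (a * b) ≤ a * a + b * b
          go {a} {b} a≤b with m≤n⇒∃[o]m+o≡n a≤b
          ... | c , refl = subst (2 * (a * (a + c)) ≤_) (lem a c) (m≤m+n (2 * (a * (a + c))) (c * c))
            where
            lem : ∀ a c → 2 * (a * (a + c)) + c * c ≡ a * a + (a + c) * (a + c)
            lem = solve-∀

        -- The sum of squares with its negative term moved to the other side. The constant (s + t) /
        -- t is the quotient of the sum of the τ² by the sum of the τ; with this choice the
        -- inequality collapses to t Σ τ ≤ (s + t) |V|.
        variance : 2 * (t * (s + t)) * sum τ ≤ t * t * sum (λ K → τ K * τ K) + # V? * ((s + t) * (s + t))
        variance = begin
          2 * (t * (s + t)) * sum τ                                         ≡⟨ *-distribˡ-sum (2 * (t * (s + t))) τ ⟩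
          sum (λ K → 2 * (t * (s + t)) * τ K)                               ≤⟨ sum-mono pointwise ⟩
          sum (λ K → t * t * (τ K * τ K) + 1[ V? K ] * ((s + t) * (s + t)))
            ≡⟨ ∑-distrib-+ (λ K → t * t * (τ K * τ K)) (λ K → 1[ V? K ] * ((s + t) * (s + t))) ⟩
          sum (λ K → t * t * (τ K * τ K)) + sum (λ K → 1[ V? K ] * ((s + t) * (s + t)))
            ≡⟨ cong₂ _+_ (sym (*-distribˡ-sum (t * t) (λ K → τ K * τ K))) (sum≡#* V? on off) ⟩
          t * t * sum (λ K → τ K * τ K) + # V? * ((s + t) * (s + t)) ∎
          where
          open ≤-Reasoning
          on : ∀ K → ¬ Meet L K × ¬ Meet M K → 1[ V? K ] * ((s + t) * (s + t)) ≡ (s + t) * (s + t)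
          on K v = trans (cong (_* ((s + t) * (s + t))) (1-yes (V? K) v)) (+-identityʳ _)
          off : ∀ K → ¬ (¬ Meet L K × ¬ Meet M K) → 1[ V? K ] * ((s + t) * (s + t)) ≡ 0
          off K ¬v = cong (_* ((s + t) * (s + t))) (1-no (V? K) ¬v)
          lem : ∀ s t x → 2 * (t * (s + t)) * x ≡ 2 * (t * x * (s + t))
          lem = solve-∀
          lem′ : ∀ t x y → t * x * (t * x) + y ≡ t * t * (x * x) + y
          lem′ = solve-∀
          pointwise : ∀ K → 2 * (t * (s + t)) * τ K ≤ t * t * (τ K * τ K) + 1[ V? K ] * ((s + t) * (s + t))
          pointwise K with toSum (V? K)
          ... | inj₁ v = subst₂ _≤_ (sym (lem s t (τ K))) (trans (lem′ t (τ K) _) (cong (t * t * (τ K * τ K) +_) (sym (on K v))))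
              (2ab≤a²+b² (t * τ K) (s + t))
          ... | inj₂ ¬v = ≤-trans (≤-reflexive (trans (cong (2 * (t * (s + t)) *_) (#-none (λ N → R? N K) λ N r → ¬v (proj₁ (proj₂ r))))
              (*-zeroʳ (2 * (t * (s + t)))))) z≤n

        s≤t² : 1 ≤ t′ → s ≤ t * t
        s≤t² 1≤t′ = *-cancelˡ-≤ (s * t′) {{m*n≢0 s t′ {{s≢0}} {{>-nonZero 1≤t′}}}} (+-cancelˡ-≤ X _ _ (begin
          X + s * t′ * s                    ≤⟨ +-monoˡ-≤ (s * t′ * s) core ⟩
          (s + t) * (t * s * t) + s * t′ * s  ≡⟨ identity ⟩
          X + s * t′ * (t * t)              ∎))
          where
          open ≤-Reasoning
          s≢0 : NonZero s
          s≢0 = subst NonZero (sym s≡) _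
          -- The first summand is t Σ τ; the second is what `#V` adds to (s + t) |V| to reach (s +
          -- t) t s t. The latter exceeds X by s (t - 1) (t² - s), so X cannot be larger exactly
          -- when s ≤ t².
          X = t * t * (s′ * suc s) + (s + t) * suc (suc s * t′)
          identity : (s + t) * (t * s * t) + s * t′ * s ≡ X + s * t′ * (t * t)
          identity rewrite s≡ | t≡ = lem s′ t′
            where
            lem : ∀ s′ t′ → (suc s′ + suc t′) * (suc t′ * suc s′ * suc t′) + suc s′ * t′ * suc s′ ≡
              (suc t′ * suc t′ * (s′ * suc (suc s′)) + (suc s′ + suc t′) * suc (suc (suc s′) * t′)) + suc s′ * t′ * (suc t′ * suc t′)
            lem = solve-∀
          core′ : t * t * (s′ * suc s) ≤ (s + t) * # V?
          core′ = *-cancelˡ-≤ (s + t) {{>-nonZero (≤-trans (>-nonZero⁻¹ s {{s≢0}}) (m≤m+n s t))}} (+-cancelˡ-≤ ((s + t) * (t * t * (s′ * suc s))) _ _ (begin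
            (s + t) * (t * t * (s′ * suc s)) + (s + t) * (t * t * (s′ * suc s))  ≡⟨ lem₁ s t s′ ⟩
            2 * (t * (s + t)) * (suc s * (s′ * t))                              ≡⟨ cong (2 * (t * (s + t)) *_) (sym Στ) ⟩
            2 * (t * (s + t)) * sum τ                                           ≤⟨ variance ⟩
            t * t * sum (λ K → τ K * τ K) + # V? * ((s + t) * (s + t))          ≡⟨ cong (λ x → t * t * x + # V? * ((s + t) * (s + t))) Στ² ⟩
            t * t * (suc s * (s′ * t + s * s′)) + # V? * ((s + t) * (s + t))    ≡⟨ lem₂ s t s′ (# V?) ⟩
            (s + t) * (t * t * (s′ * suc s)) + (s + t) * ((s + t) * # V?)       ∎))
            where
            lem₁ : ∀ s t s′ → (s + t) * (t * t * (s′ * suc s)) + (s + t) * (t * t * (s′ * suc s)) ≡ 2 * (t * (s + t)) * (suc s * (s′ * t))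
            lem₁ = solve-∀
            lem₂ : ∀ s t s′ v → t * t * (suc s * (s′ * t + s * s′)) + v * ((s + t) * (s + t)) ≡ (s + t) * (t * t * (s′ * suc s)) + (s + t) * ((s + t) * v)
            lem₂ = solve-∀
          core : X ≤ (s + t) * (t * s * t)
          core = begin
            X                                                          ≤⟨ +-monoˡ-≤ _ core′ ⟩
            (s + t) * # V? + (s + t) * suc (suc s * t′)                ≡⟨ sym (*-distribˡ-+ (s + t) (# V?) _) ⟩
            (s + t) * (# V? + suc (suc s * t′))                        ≡⟨ cong ((s + t) *_) #V ⟩
            (s + t) * (t * s * t)                                      ∎

-- Elation quadrangles with t symmetries

module Setting {np nl : ℕ} (I : Fin np → Fin nl → Bool) (s t : ℕ) (G : FinGroup) (A : Action G I)
  (x z : Fin np) (S : Fin (FinGroup.order G) → Bool)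
  (gq : Geometry.IsGQ I (Geometry.allP I) (Geometry.allL I) s t) (2≤s : 2 ≤ s) (2≤t : 2 ≤ t)
  (egq : STGQ.IsEGQ I G A x) (symmetries : STGQ.IsSymmetryGroup I G A x S t)
  (z-affine : Geometry.Affine I (Geometry.allP I) (Geometry.allL I) x z) where

  open Incidence I public
  open Quadrangle gq public
  open Groups G public
  open Action A public
  open STGQ.IsEGQ egq public
  open STGQ.IsSymmetryGroup symmetries using () renaming (subgroup to S-subgroup; size to S-size; symmetry to S-symmetry) public

  1≤s : 1 ≤ s
  1≤s = ≤-trans (s≤s z≤n) 2≤s

  1≤t : 1 ≤ t
  1≤t = ≤-trans (s≤s z≤n) 2≤t

  Aff : Fin np → Set
  Aff p = ¬ Col x p

  Aff? : Decidable Aff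
  Aff? p = ¬? (Col? x p)

  Aff⇒Affine : ∀ {p} → Aff p → Affine allP allL x p
  Aff⇒Affine a = refl , ¬Col⇒col≡false a

  z-Aff : Aff z
  z-Aff = col≡false⇒¬Col (proj₂ z-affine)

  On-act : ∀ g {p L} → On p L → On (actP g p) (actL g L)
  On-act g {p} {L} a = trans (preservesI g p L) a

  On-act⁻ : ∀ g {p L} → On (actP g p) (actL g L) → On p L
  On-act⁻ g {p} {L} a = trans (sym (preservesI g p L)) a

  Col-act : ∀ g {p q} → Col p q → Col (actP g p) (actP g q)
  Col-act g (L , a , b) = actL g L , On-act g a , On-act g b

  actP-inv : ∀ g p → actP (g ⁻¹) (actP g p) ≡ p
  actP-inv g p = trans (sym (actP-∙ (g ⁻¹) g p)) (trans (cong (λ h → actP h p) (inverseˡ g)) (actP-ε p))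

  actL-inv : ∀ g L → actL (g ⁻¹) (actL g L) ≡ L
  actL-inv g L = trans (sym (actL-∙ (g ⁻¹) g L)) (trans (cong (λ h → actL h L) (inverseˡ g)) (actL-ε L))

  Col-act⁻ : ∀ g {p q} → Col (actP g p) (actP g q) → Col p q
  Col-act⁻ g c = subst₂ Col (actP-inv g _) (actP-inv g _) (Col-act (g ⁻¹) c)

  S-fixes : ∀ {σ} → σ ∈ S → ∀ {p} → Col x p → actP σ p ≡ p
  S-fixes σ∈ c = S-symmetry _ σ∈ _ (Col⇒col c)

  #S : # (_∈? S) ≡ t
  #S = trans (sym (count≡# S (_∈? S) (λ _ → id) (λ _ → id))) S-size

  -- The image must be assumed affine at this stage: that elations fix x is derived from linearity,
  -- whose proof uses this lemma.
  free′ : ∀ {y g h} → Aff y → Aff (actP g y) → actP g y ≡ actP h y → g ≡ h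
  free′ {y} {g} {h} a b e = let _ , _ , u = sharplyTransitive y (actP g y) (Aff⇒Affine a) (Aff⇒Affine b) in
    trans (u g refl) (sym (u h (sym e)))

  S-Aff : ∀ {σ y} → σ ∈ S → Aff y → Aff (actP σ y)
  S-Aff {σ} {y} σ∈ a c = a (Col-act⁻ σ (subst (λ p → Col p (actP σ y)) (sym (S-fixes σ∈ (Col-refl x))) c))

  opaque
    -- σ ↦ σM is injective from S into the lines through v other than N, and both sets have t elements.
    S-lines : ∀ {v w y M N} → Col x v → Col x w → ¬ Col v w → Aff y → On v M → On y M → Col y w → On v N → On x N →
      ∀ K → On v K → ¬ K ≡ N → ∃[ σ ] σ ∈ S × actL σ M ≡ K
    S-lines {v} {w} {y} {M} {N} xv xw v≁w y-aff v∈M y∈M yw v∈N x∈N K v∈K K≢N =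
      #-injection-onto (_∈? S) (λ K → On? v K ×-dec ¬? (K ≟ᶠ N)) (λ σ → actL σ M)
        (λ σ σ∈ → v∈σM σ∈ , λ e → x∉M (On-act⁻ σ (subst₂ On (sym (S-fixes σ∈ (Col-refl x))) (sym e) x∈N)))
        (λ σ σ′ σ∈ σ′∈ e → free′ y-aff (S-Aff σ∈ y-aff) (project-unique (λ w∈σM → v≁w (actL σ M , v∈σM σ∈ , w∈σM))
           (On-act σ y∈M) (w~σy σ∈) (subst (On (actP σ′ y)) (sym e) (On-act σ′ y∈M)) (w~σy σ′∈)))
        (≤-reflexive (trans (other-lines v∈N) (sym #S))) K (v∈K , K≢N)
      where
      x∉M : ¬ On x M
      x∉M x∈M = y-aff (M , x∈M , y∈M)
      v∈σM : ∀ {σ} → σ ∈ S → On v (actL σ M)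
      v∈σM {σ} σ∈ = subst (λ p → On p (actL σ M)) (S-fixes σ∈ xv) (On-act σ v∈M)
      w~σy : ∀ {σ} → σ ∈ S → Col w (actP σ y)
      w~σy {σ} σ∈ = subst (λ p → Col p (actP σ y)) (S-fixes σ∈ xw) (Col-act σ (Col-sym yw))

  opaque
    -- Project y onto a line through x that misses v. Before linearity is known such a line comes
    -- from comparing degrees: U passes through v but not through x, so not every line through x
    -- passes through v.
    witness : ∀ {v y U} → ¬ On x U → On v U → Col x v → Aff y → ∃[ w ] Col x w × ¬ Col v w × Col y w
    witness {v} {y} {U} x∉U v∈U xv y-aff =
      let w , w∈L , yw = project {y} {L₁} y∉L₁ in
      w , (L₁ , x∈L₁ , w∈L) , (λ vw → y-aff (subst (λ p → Col p y) (project-unique v∉L₁ w∈L vw x∈L₁ (Col-sym xv)) (Col-sym yw))) , yw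
      where
      skew : ∃[ L ] On x L × ¬ On v L
      skew with any? (λ L → On? x L ×-dec ¬? (On? v L))
      ... | yes e = e
      ... | no ¬e = contradiction (#-tight (On? x) (On? v) (λ L x∈L → decidable-stable (On? v L) λ v∉L → ¬e (L , x∈L , v∉L))
            (≤-reflexive (trans (point-degree v) (sym (point-degree x)))) U v∈U) x∉U
      L₁ : Fin nl
      L₁ = proj₁ skew
      x∈L₁ : On x L₁
      x∈L₁ = proj₁ (proj₂ skew)
      v∉L₁ : ¬ On v L₁
      v∉L₁ = proj₂ (proj₂ skew)
      y∉L₁ : ¬ On y L₁
      y∉L₁ y∈L₁ = y-aff (L₁ , x∈L₁ , y∈L₁)

  opaque
    affine-point : ∀ {U v} → ¬ On x U → On v U → Col x v → ∃[ y ] On y U × Aff y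
    affine-point {U} {v} x∉U v∈U xv =
      let y , y∈U , y≢v = #-inhabited (λ q → On? q U ×-dec ¬? (q ≟ᶠ v)) (subst (1 ≤_) (sym (other-points v∈U)) 1≤s) in
      y , y∈U , λ xy → y≢v (project-unique x∉U y∈U xy v∈U xv)

  opaque
    S-transitive : ∀ {v M N K} → Col x v → On v M → ¬ On x M → On v N → On x N → On v K → ¬ K ≡ N → ∃[ σ ] σ ∈ S × actL σ M ≡ K
    S-transitive xv v∈M x∉M v∈N x∈N v∈K K≢N =
      let y , y∈M , y-aff = affine-point x∉M v∈M xv
          w , xw , v≁w , yw = witness x∉M v∈M xv y-aff
      in S-lines xv xw v≁w y-aff v∈M y∈M yw v∈N x∈N _ v∈K K≢N

  opaque
    -- The axioms in IsGQ allow repeated lines; |S| = t excludes them.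
    linear : ∀ {L M p q} → On p L → On q L → On p M → On q M → ¬ p ≡ q → L ≡ M
    linear {L} {M} {p} {q} p∈L q∈L p∈M q∈M p≢q with L ≟ᶠ M
    ... | yes e = e
    ... | no L≢M = ⊥-elim (absurd (toSum (On? x L)))
      where
      same-points : ∀ {r} → On r L → On r M
      same-points {r} r∈L = decidable-stable (On? r M) λ r∉M → p≢q (project-unique r∉M p∈M (L , r∈L , p∈L) q∈M (L , r∈L , q∈L))
      absurd : On x L ⊎ ¬ On x L → ⊥
      -- A symmetry moves a line U through v and z onto M. But M contains x, as L does, while U does
      -- not, and symmetries fix x.
      absurd (inj₁ x∈L) =
        let v , v∈L , U , z∈U , v∈U = project {z} {L} λ z∈L → z-Aff (L , x∈L , z∈L)
            x∉U = λ x∈U → z-Aff (U , x∈U , z∈U)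
            σ , σ∈ , e = S-transitive (L , x∈L , v∈L) v∈U x∉U v∈L x∈L (same-points v∈L) (λ M≡L → L≢M (sym M≡L))
        in x∉U (On-act⁻ σ (subst₂ On (sym (S-fixes σ∈ (Col-refl x))) (sym e) (same-points x∈L)))
      -- A symmetry σ carries L to M. Both y and σ y are the projection of w onto M, so σ fixes the
      -- affine point y; hence σ is the identity and L = M.
      absurd (inj₂ x∉L) =
        let v , v∈L , N , x∈N , v∈N = project x∉L
            xv = (N , x∈N , v∈N)
            y , y∈L , y-aff = affine-point x∉L v∈L xv
            w , xw , v≁w , yw = witness x∉L v∈L xv y-aff
            σ , σ∈ , e = S-lines xv xw v≁w y-aff v∈L y∈L yw v∈N x∈N M (same-points v∈L)
                           λ M≡N → y-aff (N , x∈N , subst (On y) M≡N (same-points y∈L))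
            wσy = subst (λ p → Col p (actP σ y)) (S-fixes σ∈ xw) (Col-act σ (Col-sym yw))
            y≡σy = project-unique (λ w∈M → v≁w (M , same-points v∈L , w∈M)) (same-points y∈L) (Col-sym yw)
                     (subst (On (actP σ y)) e (On-act σ y∈L)) wσy
            ε≡σ = free′ {y} {ε} {σ} y-aff (subst Aff (sym (actP-ε y)) y-aff) (trans (actP-ε y) y≡σy)
        in L≢M (trans (sym (actL-ε L)) (trans (cong (λ g → actL g L) ε≡σ) e))

  -- Elations, symmetries and the order of the group

  open Linear linear public

  opaque
    another-line : ∀ {p L} → On p L → ∃[ M ] On p M × ¬ M ≡ L
    another-line {p} {L} p∈L = #-inhabited (λ M → On? p M ×-dec ¬? (M ≟ᶠ L)) (subst (1 ≤_) (sym (other-lines p∈L)) 1≤t)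

  fixes-x : ∀ g → actP g x ≡ x
  fixes-x g =
    let L , x∈L = line-through x
        M , x∈M , M≢L = another-line x∈L
    in meet-unique (λ e → M≢L (sym e)) (fixed x∈L) (fixed x∈M) x∈L x∈M
    where
    fixed : ∀ {L} → On x L → On (actP g x) L
    fixed {L} x∈L = subst (On (actP g x)) (fixesLinesThroughX g L x∈L) (On-act g x∈L)

  Col-x-act : ∀ g {p} → Col x p → Col x (actP g p)
  Col-x-act g c = subst (λ q → Col q (actP g _)) (fixes-x g) (Col-act g c)

  Aff-act : ∀ g {p} → Aff p → Aff (actP g p)
  Aff-act g a c = a (Col-act⁻ g (subst (λ q → Col q (actP g _)) (sym (fixes-x g)) c))

  ≢x-act : ∀ g {p} → ¬ p ≡ x → ¬ actP g p ≡ x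
  ≢x-act g {p} ne e = ne (trans (sym (actP-inv g p)) (trans (cong (actP (g ⁻¹)) e) (fixes-x (g ⁻¹))))

  On-pencil-act : ∀ g {p L} → On x L → On p L → On (actP g p) L
  On-pencil-act g {p} {L} x∈L p∈L = subst (On (actP g p)) (fixesLinesThroughX g L x∈L) (On-act g p∈L)

  free : ∀ {y g h} → Aff y → actP g y ≡ actP h y → g ≡ h
  free {g = g} a = free′ a (Aff-act g a)

  opaque
    transitive : ∀ {p q} → Aff p → Aff q → ∃[ g ] actP g p ≡ q
    transitive a b = let g , e , _ = sharplyTransitive _ _ (Aff⇒Affine a) (Aff⇒Affine b) in g , e

  off-pencil : ∀ {y L} → Aff y → On x L → ¬ On y L
  off-pencil a x∈L y∈L = a (_ , x∈L , y∈L)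

  cross : ∀ {L M v w} → On x L → On x M → ¬ L ≡ M → On v L → On w M → ¬ v ≡ x → ¬ w ≡ x → ¬ Col v w
  cross x∈L x∈M L≢M v∈L w∈M v≢x w≢x vw = w≢x (project-unique (λ v∈M → v≢x (meet-unique L≢M v∈L v∈M x∈L x∈M)) w∈M vw x∈M (_ , v∈L , x∈L))

  opaque
    affine-line : ∀ {v N} → ¬ v ≡ x → On v N → On x N → ∃[ M ] On v M × ¬ On x M
    affine-line v≢x v∈N x∈N = let M , v∈M , M≢N = another-line v∈N in
      M , v∈M , λ x∈M → M≢N (linear v∈M x∈M v∈N x∈N v≢x)

  -- Take a line M through v not through x, and on it the point y collinear with w. Some symmetry σ
  -- agrees with h on M as a line; then h y and σ y are both the projection of w onto that image,
  -- and freeness gives h = σ.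
  ∈S : ∀ {L M v w h} → On x L → On x M → ¬ L ≡ M → On v L → On w M → ¬ v ≡ x → ¬ w ≡ x → actP h v ≡ v → actP h w ≡ w → h ∈ S
  ∈S {N} {N′} {v} {w} {h} x∈N x∈N′ N≢N′ v∈N w∈N′ v≢x w≢x hv hw =
    let M , v∈M , x∉M = affine-line v≢x v∈N x∈N
        v≁w = cross x∈N x∈N′ N≢N′ v∈N w∈N′ v≢x w≢x
        xv = (N , x∈N , v∈N)
        xw = (N′ , x∈N′ , w∈N′)
        y , y∈M , wy = project {w} {M} λ w∈M → v≁w (M , v∈M , w∈M)
        y-aff = λ xy → v≁w (subst (λ p → Col p w) (project-unique x∉M y∈M xy v∈M xv) (Col-sym wy))
        x∉hM = λ x∈hM → x∉M (On-act⁻ h (subst (λ p → On p (actL h M)) (sym (fixes-x h)) x∈hM))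
        v∈hM = subst (λ p → On p (actL h M)) hv (On-act h v∈M)
        σ , σ∈ , e = S-lines xv xw v≁w y-aff v∈M y∈M (Col-sym wy) v∈N x∈N (actL h M) v∈hM
                      (λ e → x∉hM (subst (On x) (sym e) x∈N))
        hy≡σy = project-unique (λ w∈hM → v≁w (actL h M , v∈hM , w∈hM)) (On-act h y∈M) (subst (λ p → Col p (actP h y)) hw (Col-act h wy))
                  (subst (On (actP σ y)) e (On-act σ y∈M)) (subst (λ p → Col p (actP σ y)) (S-fixes σ∈ xw) (Col-act σ wy))
    in subst (_∈ S) (sym (free y-aff hy≡σy)) σ∈

  opaque
    foot : ∀ {y L} → Aff y → On x L → ∃[ v ] On v L × ¬ v ≡ x × Col y v
    foot a x∈L = let v , v∈L , yv = project (off-pencil a x∈L) in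
      v , v∈L , (λ e → a (Col-sym (subst (Col _) e yv))) , yv

  foot-unique : ∀ {y L v w} → Aff y → On x L → On v L → Col y v → On w L → Col y w → v ≡ w
  foot-unique a x∈L = project-unique (off-pencil a x∈L)

  opaque
    two-lines : ∃[ L ] ∃[ M ] On x L × On x M × ¬ L ≡ M
    two-lines = let L , x∈L = line-through x
                    M , x∈M , ne = another-line x∈L
                in L , M , x∈L , x∈M , λ e → ne (sym e)

  S-normal : Normal S
  S-normal g σ σ∈ =
    let L , M , x∈L , x∈M , L≢M = two-lines
        v , v∈L , v≢x , _ = foot z-Aff x∈L
        w , w∈M , w≢x , _ = foot z-Aff x∈M
    in ∈S x∈L x∈M L≢M v∈L w∈M v≢x w≢x (fixed (L , x∈L , v∈L)) (fixed (M , x∈M , w∈M))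
    where
    fixed : ∀ {v} → Col x v → actP (g ⁻¹ ∙ σ ∙ g) v ≡ v
    fixed {v} xv = begin
      actP (g ⁻¹ ∙ σ ∙ g) v                ≡⟨ actP-∙ (g ⁻¹ ∙ σ) g v ⟩
      actP (g ⁻¹ ∙ σ) (actP g v)           ≡⟨ actP-∙ (g ⁻¹) σ (actP g v) ⟩
      actP (g ⁻¹) (actP σ (actP g v))      ≡⟨ cong (actP (g ⁻¹)) (S-fixes σ∈ (Col-x-act g xv)) ⟩
      actP (g ⁻¹) (actP g v)               ≡⟨ actP-inv g v ⟩
      v                                    ∎
      where open ≡-Reasoning

  #affine-neighbours : ∀ {v L} → On x L → On v L → ¬ v ≡ x → # (λ y → Aff? y ×-dec Col? v y) ≡ t * s
  #affine-neighbours {v} {L} x∈L v∈L v≢x = trans (sym (*-identityʳ _)) (trans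
      (sym (double-≡ (λ M → On? v M ×-dec ¬? (M ≟ᶠ L)) (λ y → Aff? y ×-dec Col? v y) R? {s} {1}
        (λ {M} {y} (m , y∈M , y≢v) → m , aff m y∈M y≢v , M , proj₁ m , y∈M)
        (λ M m → trans (#-cong (R? M) (λ y → On? y M ×-dec ¬? (y ≟ᶠ v)) (λ _ → proj₂) (λ _ a → m , a)) (other-points (proj₁ m)))
        (λ { y (a , M , v∈M , y∈M) →
           let y≢v = λ e → a (L , x∈L , subst (λ p → On p L) (sym e) v∈L) in
           #-unique (λ M → R? M y) M ((v∈M , λ e → a (L , x∈L , subst (On y) e y∈M)) , y∈M , y≢v)
             λ { K ((v∈K , _) , y∈K , _) → linear y∈K v∈K y∈M v∈M y≢v } })))
      (cong (_* s) (other-lines v∈L)))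
    where
    R? : ∀ M y → Dec ((On v M × ¬ M ≡ L) × On y M × ¬ y ≡ v)
    R? M y = (On? v M ×-dec ¬? (M ≟ᶠ L)) ×-dec On? y M ×-dec ¬? (y ≟ᶠ v)
    aff : ∀ {M y} → On v M × ¬ M ≡ L → On y M → ¬ y ≡ v → Aff y
    aff (v∈M , M≢L) y∈M y≢v xy = y≢v (project-unique (λ x∈M → M≢L (linear v∈M x∈M v∈L x∈L v≢x)) y∈M xy v∈M (L , x∈L , v∈L))

  #Aff : # Aff? ≡ s * (t * s)
  #Aff = trans (sym (*-identityʳ _)) (trans (sym (double-≡ (λ v → On? v L ×-dec ¬? (v ≟ᶠ x)) Aff? R? {t * s} {1}
      (λ (m , a , _) → m , a)
      (λ v m → trans (#-cong (R? v) (λ y → Aff? y ×-dec Col? v y) (λ _ → proj₂) (λ _ a → m , a)) (#affine-neighbours x∈L (proj₁ m) (proj₂ m)))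
      (λ y a → let v , v∈L , v≢x , yv = foot a x∈L in #-unique (λ v → R? v y) v ((v∈L , v≢x) , a , Col-sym yv)
         λ { w ((w∈L , _) , _ , wy) → foot-unique a x∈L w∈L (Col-sym wy) v∈L yv })))
    (cong (_* (t * s)) (other-points x∈L)))
    where
    L = proj₁ (line-through x)
    x∈L = proj₂ (line-through x)
    R? : ∀ v y → Dec ((On v L × ¬ v ≡ x) × Aff y × Col v y)
    R? v y = (On? v L ×-dec ¬? (v ≟ᶠ x)) ×-dec Aff? y ×-dec Col? v y

  order≡ : order ≡ s * (t * s)
  order≡ = trans (sym #-full) (trans (double-1 (_∈? full) Aff? (λ g y → Aff? y ×-dec (actP g z ≟ᶠ y))
      (λ (a , _) → refl , a)
      (λ g _ → #-unique (λ y → Aff? y ×-dec (actP g z ≟ᶠ y)) (actP g z) (Aff-act g z-Aff , refl) λ _ (_ , e) → sym e)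
      (λ y a → let g , e = transitive z-Aff a in #-unique (λ g → Aff? y ×-dec (actP g z ≟ᶠ y)) g (a , e) λ h (_ , e′) → free z-Aff (trans e′ (sym e))))
    #Aff)

  -- Partial congruence partitions and the prime dividing s

  choose : {P : Fin nl → Set} (P? : Decidable P) {Q : Fin nl → Fin np → Set} →
    (∀ L → P L → ∃[ v ] Q L v) → Σ (Fin nl → Fin np) λ f → ∀ L → P L → Q L (f L)
  choose {P} P? {Q} c = (λ L → pick L (P? L)) , λ L p → picked L (P? L) p
    where
    pick : ∀ L → Dec (P L) → Fin np
    pick L (yes p) = proj₁ (c L p)
    -- A default value: only lines satisfying P are ever asked about.
    pick L (no _) = x
    picked : ∀ L (d : Dec (P L)) → P L → Q L (pick L d)
    picked L (yes p) _ = proj₂ (c L p)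
    picked L (no ¬p) p = contradiction p ¬p

  Fix? : ∀ (K : SubsetG) v → Decidable (λ g → g ∈ K × actP g v ≡ v)
  Fix? K v g = (g ∈? K) ×-dec (actP g v ≟ᶠ v)

  K∩S? : ∀ (K : SubsetG) → Decidable (λ g → g ∈ K × g ∈ S)
  K∩S? K g = (g ∈? K) ×-dec (g ∈? S)

  -- Stabilisers of points on different lines through x meet inside S: modulo S they form a partial congruence partition.
  partition-bound : ∀ (K : SubsetG) {k} →
    (∀ L → On x L → ∃[ v ] (On v L × ¬ v ≡ x) × k ≤ # (Fix? K v)) → suc t * (k ∸ # (K∩S? K)) + # (K∩S? K) ≤ # (_∈? K)
  partition-bound K {k} c = begin
    suc t * (k ∸ # (K∩S? K)) + # (K∩S? K)       ≤⟨ +-monoˡ-≤ _ (subst₂ _≤_ (cong (_* (k ∸ # (K∩S? K))) (point-degree x)) (*-identityʳ _)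
        (double-≤ (On? x) K∖S? R? {k ∸ # (K∩S? K)} {1} (λ ((_ , g∈ , _) , g∉) → g∈ , g∉) row column)) ⟩
    # K∖S? + # (K∩S? K)                         ≡⟨ +-comm (# K∖S?) _ ⟩
    # (K∩S? K) + # K∖S?                         ≡⟨ sym (#-split (_∈? K) (_∈? S)) ⟩
    # (_∈? K)                                   ∎
    where
    open ≤-Reasoning
    ch = choose (On? x) c
    v = proj₁ ch
    K∖S? : Decidable (λ g → g ∈ K × ¬ g ∈ S)
    K∖S? g = (g ∈? K) ×-dec ¬? (g ∈? S)
    R? : ∀ L g → Dec ((On x L × g ∈ K × actP g (v L) ≡ v L) × ¬ g ∈ S)
    R? L g = (On? x L ×-dec Fix? K (v L) g) ×-dec ¬? (g ∈? S)
    row : ∀ L → On x L → k ∸ # (K∩S? K) ≤ # (R? L)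
    row L x∈L = m≤n+o⇒m∸n≤o k (# (K∩S? K)) (begin
      k                                          ≤⟨ proj₂ (proj₂ ch L x∈L) ⟩
      # (Fix? K (v L))                           ≡⟨ #-split (Fix? K (v L)) (_∈? S) ⟩
      # (λ g → Fix? K (v L) g ×-dec (g ∈? S)) + # (λ g → Fix? K (v L) g ×-dec ¬? (g ∈? S))
        ≤⟨ +-mono-≤ (#-mono (λ g → Fix? K (v L) g ×-dec (g ∈? S)) (K∩S? K) λ g ((a , _) , b) → a , b)
                    (#-mono (λ g → Fix? K (v L) g ×-dec ¬? (g ∈? S)) (R? L) λ g (a , b) → (x∈L , a) , b) ⟩
      # (K∩S? K) + # (R? L)                      ∎)
    column : ∀ g → g ∈ K × ¬ g ∈ S → # (λ L → R? L g) ≤ 1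
    column g (_ , g∉) = #≤1 (λ L → R? L g) λ L M ((x∈L , _ , fL) , _) ((x∈M , _ , fM) , _) → decidable-stable (L ≟ᶠ M) λ L≢M →
      let (v∈L , v≢x) , _ = proj₂ ch L x∈L
          (w∈M , w≢x) , _ = proj₂ ch M x∈M
      in g∉ (∈S x∈L x∈M L≢M v∈L w∈M v≢x w≢x fL fM)

  s≤t² : s ≤ t * t
  s≤t² =
    let L , x∈L = line-through x
        v , v∈L , v≢x , U , z∈U , v∈U = foot z-Aff x∈L
        M , z∈M , M≢U = another-line z∈U
    in Higman.s≤t² (sym (suc-pred s {{>-nonZero 1≤s}})) (sym (suc-pred t {{>-nonZero 1≤t}}))
         {L} {M} (λ (r , r∈L , r∈M) → M≢U (linear z∈M (subst (λ p → On p M) (foot-unique z-Aff x∈L r∈L (M , z∈M , r∈M) v∈L (U , z∈U , v∈U)) r∈M) z∈U v∈U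
           λ e → z-Aff (L , x∈L , subst (λ p → On p L) (sym e) v∈L)))
         (s≤s⁻¹ (subst (2 ≤_) (sym (suc-pred t {{>-nonZero 1≤t}})) 2≤t))

  open Orbits actP actP-ε actP-∙ public

  -- The left side of the bound is least for c = b, where it becomes (t + 1)(a - 1) ≤ a² - 1 after
  -- cancelling b; dividing by a - 1 leaves t ≤ a. The term `t * d` below is the slack between c and
  -- b.
  partition-arithmetic : ∀ {a b c} → 2 ≤ a → 1 ≤ b → c ≤ b → suc t * (a * b ∸ c) + c ≤ a * a * b → t ≤ a
  partition-arithmetic {suc a} {b} {c} (s≤s 1≤a) 1≤b c≤b bound with m≤n⇒∃[o]m+o≡n c≤b
  ... | d , refl = s≤s⁻¹ (*-cancelʳ-≤ (suc t) (suc (suc a)) (a * (c + d)) {{m*n≢0 a (c + d) {{>-nonZero 1≤a}} {{>-nonZero 1≤b}}}}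
        (+-cancelʳ-≤ (c + d) _ _ (begin
          suc t * (a * (c + d)) + (c + d)            ≤⟨ m≤m+n _ (t * d) ⟩
          suc t * (a * (c + d)) + (c + d) + t * d    ≡⟨ lem t a c d ⟩
          suc t * (d + a * (c + d)) + c              ≡⟨ cong (λ y → suc t * y + c) (sym (trans (cong (_∸ c) (+-assoc c d (a * (c + d)))) (m+n∸m≡n c _))) ⟩
          suc t * (suc a * (c + d) ∸ c) + c          ≤⟨ bound ⟩
          suc a * suc a * (c + d)                    ≡⟨ lem′ a (c + d) ⟩
          suc (suc a) * (a * (c + d)) + (c + d)      ∎)))
    where
    open ≤-Reasoning
    lem : ∀ t a c d → suc t * (a * (c + d)) + (c + d) + t * d ≡ suc t * (d + a * (c + d)) + c
    lem = solve-∀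
    lem′ : ∀ a b → suc a * suc a * b ≡ suc (suc a) * (a * b) + b
    lem′ = solve-∀

  ^-mono-∣ : ∀ p {i j} → i ≤ j → p ^ i ∣ p ^ j
  ^-mono-∣ p {i} i≤j with m≤n⇒∃[o]m+o≡n i≤j
  ... | o , refl = divides (p ^ o) (trans (^-distribˡ-+-* p i o) (*-comm (p ^ i) (p ^ o)))

  -- On every line through x a Sylow p-subgroup of H has an orbit whose length has p-part at most that of s.
  t≤p-part : ∀ {p} → Prime p → ∀ {a m} → s ≡ p ^ suc a * m → ¬ p ∣ m → t ≤ p ^ suc a
  t≤p-part {p} pp {a₀} {m} s≡ ¬pm = from-t (p-part pp t {{>-nonZero 1≤t}})
    where
    a = suc a₀
    instance
      p≢0 : NonZero p
      p≢0 = prime⇒nonZero pp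
    from-t : ∃[ b ] ∃[ m′ ] t ≡ p ^ b * m′ × ¬ p ∣ m′ → t ≤ p ^ a
    from-t (b , m′ , t≡ , ¬pm′) = from-sylow (sylow pp (a + b + a) (m * (m′ * m)) order-split coprime)
      where
      order-split : order ≡ p ^ (a + b + a) * (m * (m′ * m))
      order-split = begin
        order                                      ≡⟨ order≡ ⟩
        s * (t * s)                                ≡⟨ cong₂ (λ s t → s * (t * s)) s≡ t≡ ⟩
        p ^ a * m * (p ^ b * m′ * (p ^ a * m))     ≡⟨ lem (p ^ a) (p ^ b) m m′ ⟩
        p ^ a * p ^ b * p ^ a * (m * (m′ * m))     ≡⟨ cong (_* (m * (m′ * m))) (sym (trans (^-distribˡ-+-* p (a + b) a) (cong (_* p ^ a) (^-distribˡ-+-* p a b)))) ⟩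
        p ^ (a + b + a) * (m * (m′ * m))           ∎
        where
        open ≡-Reasoning
        lem : ∀ A B m m′ → A * m * (B * m′ * (A * m)) ≡ A * B * A * (m * (m′ * m))
        lem = solve-∀
      coprime : ¬ p ∣ m * (m′ * m)
      coprime d = [ ¬pm , (λ d → [ ¬pm′ , ¬pm ]′ (euclidsLemma m′ m pp d)) ]′ (euclidsLemma m (m′ * m) pp d)
      from-sylow : ∃[ P ] IsSubgroup P × # (_∈? P) ≡ p ^ (a + b + a) → t ≤ p ^ a
      from-sylow (P , sP , #P) = partition-arithmetic 2≤p^a (>-nonZero⁻¹ (p ^ b) {{p^≢0 pp b}}) c≤p^b
          (subst₂ (λ k n → suc t * (k ∸ # (K∩S? P)) + # (K∩S? P) ≤ n) (^-distribˡ-+-* p a b) (trans #P #P≡) (partition-bound P large-stabiliser))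
        where
        #P≡ : p ^ (a + b + a) ≡ p ^ a * p ^ a * p ^ b
        #P≡ = trans (^-distribˡ-+-* p (a + b) a) (trans (cong (_* p ^ a) (^-distribˡ-+-* p a b)) (lem (p ^ a) (p ^ b)))
          where
          lem : ∀ A B → A * B * A ≡ A * A * B
          lem = solve-∀
        2≤p^a : 2 ≤ p ^ a
        2≤p^a = ≤-trans (1<p pp) (m≤m*n p (p ^ a₀) {{p^≢0 pp a₀}})
        P∩S-subgroup : IsSubgroup ⌜ K∩S? P ⌝
        P∩S-subgroup = ⌜⌝-subgroup (K∩S? P) (IsSubgroup.has-ε sP , IsSubgroup.has-ε S-subgroup)
          (λ (a , b) (c , d) → IsSubgroup.∙-clos sP _ _ a c , IsSubgroup.∙-clos S-subgroup _ _ b d)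
          (λ (a , b) → IsSubgroup.⁻¹-clos sP _ a , IsSubgroup.⁻¹-clos S-subgroup _ b)
        c≤p^b : # (K∩S? P) ≤ p ^ b
        c≤p^b =
          let i , eq = ∣p^⇒≡p^ pp (a + b + a) (subst₂ _∣_ (#⌜⌝ (K∩S? P)) #P (lagrange P∩S-subgroup sP λ g g∈ → proj₁ (∈⌜⌝⁻ (K∩S? P) g∈)))
              d = subst₂ _∣_ (trans (#⌜⌝ (K∩S? P)) eq) (trans #S t≡) (lagrange P∩S-subgroup S-subgroup λ g g∈ → proj₂ (∈⌜⌝⁻ (K∩S? P) g∈))
          in subst (_≤ p ^ b) (sym eq) (∣⇒≤ {{p^≢0 pp b}} (p^∣*⇒p^∣ pp i d ¬pm′))
        large-stabiliser : ∀ L → On x L → ∃[ v ] (On v L × ¬ v ≡ x) × p ^ (a + b) ≤ # (Fix? P v)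
        large-stabiliser L x∈L =
          let v , m , ¬d = orbits-∤ sP {p ^ suc a} (λ v → On? v L ×-dec ¬? (v ≟ᶠ x))
                (λ g _ (v∈L , v≢x) → On-pencil-act g x∈L v∈L , ≢x-act g v≢x)
                (λ d → ¬pm (*-cancelˡ-∣ (p ^ a) {{p^≢0 pp a}} (subst₂ _∣_ (*-comm p (p ^ a)) (trans (other-points x∈L) s≡) d)))
              j , eq = ∣p^⇒≡p^ pp (a + b + a) (divides (# (Fix? P v)) (trans (sym #P) (trans (sym (orbit-stabiliser sP v)) (*-comm (# (Orb? sP v)) _))))
              j≤a = ≮⇒≥ {a} {j} λ a<j → ¬d (subst (p ^ suc a ∣_) (sym eq) (^-mono-∣ p {suc a} {j} a<j))
          in v , m , *-cancelʳ-≤ _ _ (p ^ a) {{p^≢0 pp a}} (begin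
               p ^ (a + b) * p ^ a         ≡⟨ sym (^-distribˡ-+-* p (a + b) a) ⟩
               p ^ (a + b + a)             ≡⟨ sym #P ⟩
               # (_∈? P)                   ≡⟨ sym (orbit-stabiliser sP v) ⟩
               # (Orb? sP v) * # (Fix? P v)  ≡⟨ cong (_* # (Fix? P v)) eq ⟩
               p ^ j * # (Fix? P v)        ≤⟨ *-monoˡ-≤ (# (Fix? P v)) (∣⇒≤ {{p^≢0 pp a}} (^-mono-∣ p {j} {a} j≤a)) ⟩
               p ^ a * # (Fix? P v)        ≡⟨ *-comm (p ^ a) _ ⟩
               # (Fix? P v) * p ^ a        ∎)
          where open ≤-Reasoning

  opaque
    prime-divisor : ∀ n → 2 ≤ n → ∃[ p ] Prime p × p ∣ n
    prime-divisor n 2≤n = from-factors (factors f) (factorsPrime f) (isFactorisation f)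
      where
      open PrimeFactorisation
      instance
        n≢0 : NonZero n
        n≢0 = >-nonZero (≤-trans (s≤s z≤n) 2≤n)
      f : PrimeFactorisation n
      f = factorise n
      from-factors : ∀ ps → All Prime ps → n ≡ product ps → ∃[ p ] Prime p × p ∣ n
      from-factors [] _ eq = contradiction (subst (2 ≤_) eq 2≤n) λ { (s≤s ()) }
      from-factors (p ∷ ps) (pp ∷ _) eq = p , pp , divides (product ps) (trans eq (*-comm p _))

  positive-exponent : ∀ {p k m} → p ∣ p ^ k * m → ¬ p ∣ m → ∃[ k′ ] k ≡ suc k′
  positive-exponent {k = zero} d ¬d = contradiction (subst (_ ∣_) (+-identityʳ _) d) ¬d
  positive-exponent {k = suc k} _ _ = k , refl

  opaque
    -- Let p^a and q^b be the full powers of two primes in s. Then t ≤ p^a and t ≤ q^b, while p^a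
    -- q^b ≤ s ≤ t²; so both powers equal t, and p would divide q^b and with it the cofactor of p^a.
    s-prime-power : ∃[ p ] Prime p × ∃[ a ] s ≡ p ^ a
    s-prime-power = from-prime (prime-divisor s 2≤s)
      where
      from-prime : ∃[ p ] Prime p × p ∣ s → ∃[ p ] Prime p × ∃[ a ] s ≡ p ^ a
      from-prime (p , pp , p∣s) with p-part pp s {{>-nonZero 1≤s}}
      ... | k , zero , _ , ¬pm = contradiction (p ∣0) ¬pm
      ... | k , suc zero , s≡ , _ = p , pp , k , trans s≡ (*-identityʳ _)
      ... | k , m@(suc (suc _)) , s≡ , ¬pm with positive-exponent {k = k} (subst (p ∣_) s≡ p∣s) ¬pm
      ...   | a , refl with prime-divisor m (s≤s (s≤s z≤n))
      ...     | q , qq , q∣m with p-part qq s {{>-nonZero 1≤s}}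
      ...       | l , m₂ , s≡₂ , ¬qm₂ with positive-exponent {k = l} (subst (q ∣_) s≡₂ (∣-trans q∣m (divides (p ^ suc a) s≡))) ¬qm₂
      ...         | b , refl = contradiction (∣-trans (subst (p ∣_) p^a≡q^b (m∣m*n (p ^ a))) q^b∣m) ¬pm
        where
        instance
          p^≢0′ : NonZero (p ^ suc a)
          p^≢0′ = p^≢0 pp (suc a)
          q^≢0′ : NonZero (q ^ suc b)
          q^≢0′ = p^≢0 qq (suc b)
        q∤p^ : ∀ k → ¬ q ∣ p ^ k
        q∤p^ zero d = ∤1 qq d
        q∤p^ (suc k) d with euclidsLemma p (p ^ k) qq d
        ... | inj₂ d′ = q∤p^ k d′
        ... | inj₁ d′ with prime⇒irreducible pp d′
        ...   | inj₁ refl = ∤1 qq ∣-refl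
        ...   | inj₂ refl = ¬pm q∣m
        q^b∣m : q ^ suc b ∣ m
        q^b∣m = p^∣*⇒p^∣ qq (suc b) (divides m₂ (trans (*-comm m (p ^ suc a)) (trans (sym s≡) (trans s≡₂ (*-comm (q ^ suc b) m₂))))) (q∤p^ (suc a))
        t≤p^ : t ≤ p ^ suc a
        t≤p^ = t≤p-part pp {a} s≡ ¬pm
        t≤q^ : t ≤ q ^ suc b
        t≤q^ = t≤p-part qq {b} s≡₂ ¬qm₂
        product≤ : p ^ suc a * q ^ suc b ≤ t * t
        product≤ = ≤-trans (*-monoʳ-≤ (p ^ suc a) (∣⇒≤ q^b∣m)) (≤-trans (≤-reflexive (sym s≡)) s≤t²)
        p^a≡q^b : p ^ suc a ≡ q ^ suc b
        p^a≡q^b = trans (≤-antisym (*-cancelʳ-≤ _ _ (q ^ suc b) (≤-trans product≤ (*-monoʳ-≤ t t≤q^))) t≤p^)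
          (≤-antisym t≤q^ (*-cancelˡ-≤ (p ^ suc a) (≤-trans product≤ (*-monoˡ-≤ t t≤p^))))

  -- Line stabilisers and the Kantor family

  open STGQ I G A using (Stab; ConditionB; GammaDualPLS; ProjectionLemma; Generic; ΓIncident; PhiSubSTGQ) public
  open IsSubgroup

  Stab⁺ : ∀ U {g} → actL g U ≡ U → g ∈ Stab U
  Stab⁺ U {g} e with actL g U ≟ᶠ U
  ... | yes _ = refl
  ... | no ne = contradiction e ne

  Stab⁻ : ∀ U {g} → g ∈ Stab U → actL g U ≡ U
  Stab⁻ U {g} e with actL g U ≟ᶠ U
  ... | yes e′ = e′
  ... | no _ = contradiction e λ ()

  Stab-line-subgroup : ∀ U → IsSubgroup (Stab U)
  Stab-line-subgroup U = record
    { has-ε = Stab⁺ U (actL-ε U)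
    ; ∙-clos = λ g h a b → Stab⁺ U (trans (actL-∙ g h U) (trans (cong (actL g) (Stab⁻ U b)) (Stab⁻ U a)))
    ; ⁻¹-clos = λ g a → Stab⁺ U (trans (cong (actL (g ⁻¹)) (sym (Stab⁻ U a))) (actL-inv g U)) }

  -- Both lines meet N in the foot of the affine point y, so they share two points.
  line-determined : ∀ {y U V N u v} → Aff y → On y U → On y V → On x N → On u N → On v N → On u U → On v V → U ≡ V
  line-determined a y∈U y∈V x∈N u∈N v∈N u∈U v∈V = linear y∈U u∈U y∈V
    (subst (λ p → On p _) (foot-unique a x∈N v∈N (_ , y∈V , v∈V) u∈N (_ , y∈U , u∈U)) v∈V)
    λ e → a (_ , x∈N , subst (λ p → On p _) (sym e) u∈N)

  affine-line-∌x : ∀ {y U} → Aff y → On y U → ¬ On x U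
  affine-line-∌x a y∈U x∈U = a (_ , x∈U , y∈U)

  ≢x : ∀ {y U v} → Aff y → On y U → On v U → ¬ v ≡ x
  ≢x a y∈U v∈U e = affine-line-∌x a y∈U (subst (λ p → On p _) e v∈U)

  opaque
    -- H = A S B for distinct members A, B of the Kantor family, with the A-component read off from the point a z.
    factorise-at : ∀ {U V v N a} h → On z U → On z V → On v V → On x N → On v N → On (actP a z) U → Col (actP a z) (actP h v) →
      a ∈ Stab U × (∃[ σ ] ∃[ b ] σ ∈ S × b ∈ Stab V × h ≡ a ∙ (σ ∙ b))
    factorise-at {U} {V} {v} {N} {a} h z∈U z∈V v∈V x∈N v∈N az∈U az~hv =
      let u , u∈U , N′ , x∈N′ , u∈N′ = project (affine-line-∌x z-Aff z∈U)
          -- The points h v and a v are both the foot of a z on N, so `a ⁻¹ ∙ h` fixes v. It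
          -- therefore moves V to another line through v, and a symmetry σ does the same; what
          -- remains after removing a and σ stabilises V.
          σ , σ∈ , e = S-transitive {N = N} {K = actL (a ⁻¹ ∙ h) V} (N , x∈N , v∈N) v∈V (affine-line-∌x z-Aff z∈V) v∈N x∈N
            (subst (λ p → On p (actL (a ⁻¹ ∙ h) V)) gv≡v (On-act (a ⁻¹ ∙ h) v∈V))
            (λ e → affine-line-∌x (Aff-act (a ⁻¹ ∙ h) z-Aff) (On-act (a ⁻¹ ∙ h) z∈V) (subst (On x) (sym e) x∈N))
      in Stab⁺ U (line-determined az-Aff (On-act a z∈U) az∈U x∈N′ (On-pencil-act a x∈N′ u∈N′) u∈N′ (On-act a u∈U) u∈U) ,
         σ , σ ⁻¹ ∙ (a ⁻¹ ∙ h) , σ∈ ,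
         Stab⁺ V (trans (actL-∙ (σ ⁻¹) (a ⁻¹ ∙ h) V) (trans (cong (actL (σ ⁻¹)) (sym e)) (actL-inv σ V))) ,
         sym (trans (cong (a ∙_) (\\-leftDividesˡ σ (a ⁻¹ ∙ h))) (\\-leftDividesˡ a h))
      where
      az-Aff : Aff (actP a z)
      az-Aff = Aff-act a z-Aff
      gv≡v : actP (a ⁻¹ ∙ h) v ≡ v
      gv≡v = trans (actP-∙ (a ⁻¹) h v) (trans (cong (actP (a ⁻¹))
        (foot-unique az-Aff x∈N (On-pencil-act h x∈N v∈N) az~hv (On-pencil-act a x∈N v∈N) (Col-act a (V , z∈V , v∈V)))) (actP-inv a v))

  module _ {U V v N} (z∈U : On z U) (z∈V : On z V) (U≢V : ¬ U ≡ V) (v∈V : On v V) (x∈N : On x N) (v∈N : On v N) where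

    private
      v≢x : ¬ v ≡ x
      v≢x = ≢x z-Aff z∈V v∈V

      pencil-distinct : ∀ {u N′} → On u U → On x N′ → On u N′ → ¬ N′ ≡ N
      pencil-distinct u∈U x∈N′ u∈N′ e = U≢V (line-determined z-Aff z∈U z∈V x∈N (subst (On _) e u∈N′) v∈N u∈U v∈V)

    opaque
      -- The projection is affine because the point u of U in x^⊥ and h v lie on different lines
      -- through x, so they are not collinear.
      project-to : ∀ h → ∃[ q ] On q U × Aff q × Col q (actP h v)
      project-to h =
        let u , u∈U , N′ , x∈N′ , u∈N′ = project (affine-line-∌x z-Aff z∈U)
            u≁hv = cross x∈N′ x∈N (pencil-distinct u∈U x∈N′ u∈N′) u∈N′ (On-pencil-act h x∈N v∈N) (≢x z-Aff z∈U u∈U) (≢x-act h v≢x)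
            q , q∈U , hv~q = project {actP h v} {U} λ hv∈U → u≁hv (U , u∈U , hv∈U)
        in q , q∈U , (λ xq → u≁hv (subst (λ p → Col p (actP h v)) (project-unique (affine-line-∌x z-Aff z∈U) q∈U xq u∈U (N′ , x∈N′ , u∈N′)) (Col-sym hv~q))) ,
           Col-sym hv~q

    generated-by : ∀ {M} → IsSubgroup M → S ⊆ M → Stab U ⊆ M → Stab V ⊆ M → ∀ h → h ∈ M
    generated-by {M} sM S⊆M U⊆M V⊆M h =
      let q , q∈U , q-aff , q~hv = project-to h
          a , e = transitive z-Aff q-aff
          a∈ , σ , b , σ∈ , b∈ , h≡ = factorise-at h z∈U z∈V v∈V x∈N v∈N (subst (λ p → On p U) (sym e) q∈U) (subst (λ p → Col p _) (sym e) q~hv)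
      in subst (_∈ M) (sym h≡) (∙-clos sM _ _ (U⊆M a a∈) (∙-clos sM _ _ (S⊆M σ σ∈) (V⊆M b b∈)))

  -- The Frattini subgroup and the closure property

  module Projection (projection : ProjectionLemma S) (generic : Generic S) where

    -- K S is a subgroup between K and H. If it were H, the projection lemma would make K itself
    -- equal to H.
    S⊆maximal : ∀ {K} → IsMaximal K → S ⊆ K
    S⊆maximal {K} mK@(sK , _ , top) = [
        (λ all → contradiction (projection K sK λ h → ∈⌜⌝⁻ (Product? K S) (all h)) (maximal-proper mK)) ,
        (λ KS⊆K g g∈ → KS⊆K g (⊆-productʳ sK g g∈)) ]′
      (top ⌜ Product? K S ⌝ (product-subgroup sK S-subgroup S-normal) (⊆-productˡ S-subgroup))

    maximal⇒normal : ∀ {K} → IsMaximal K → Normal K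
    maximal⇒normal mK =
      let p , pp , a , s≡ = s-prime-power
      -- H has order t s² with s = p ^ a, so S has index p ^ (a + a).
      in maximal-normal pp S-subgroup S-normal (a + a) (trans order≡ (trans (cong (λ y → y * (t * y)) s≡)
           (trans (lem (p ^ a) t) (cong₂ _*_ (sym #S) (sym (^-distribˡ-+-* p a a)))))) mK (S⊆maximal mK)
      where
      lem : ∀ A t → A * (t * A) ≡ t * (A * A)
      lem = solve-∀

    Φ : SubsetG
    Φ = ⌜ frattini? ⌝

    Φ⁺ : ∀ {g} → Frattini g → g ∈ Φ
    Φ⁺ = ∈⌜⌝⁺ frattini?

    Φ⁻ : ∀ {g} → g ∈ Φ → Frattini g
    Φ⁻ = ∈⌜⌝⁻ frattini?

    S⊆Φ : S ⊆ Φ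
    S⊆Φ σ σ∈ = Φ⁺ λ K mK → S⊆maximal mK σ σ∈

    Φ-proper : ∃[ g ] ¬ g ∈ Φ
    Φ-proper =
      let g , h , e = generic
          K , mK , _ = extends-to-maximal S-subgroup λ c∈ → contradiction (trans (sym e) c∈) λ ()
          k , k∉ = proj₁ (proj₂ mK)
      in k , λ k∈ → contradiction (trans (sym k∉) (Φ⁻ k∈ K mK)) λ ()

    Φ⊈S : ∃[ g ] g ∈ Φ × ¬ g ∈ S
    Φ⊈S = let g , h , e = generic in commutator g h , Φ⁺ (λ K mK → commutator-∈ mK (maximal⇒normal mK) g h) ,
      λ c∈ → contradiction (trans (sym e) c∈) λ ()

    -- Read in the group: whenever an element of Φ factors as a σ b, with a in the stabiliser of U,
    -- σ in S and b in the stabiliser of V, the component a lies in Φ too, with q = a z. Conditions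
    -- (a) and (b) enter the proof only through this property.
    Star : Set
    Star = ∀ {U V v N q} φ → On z U → On z V → ¬ U ≡ V → On v V → On x N → On v N → φ ∈ Φ → On q U → Aff q → Col q (actP φ v) →
      ∃[ ψ ] ψ ∈ Φ × actP ψ z ≡ q

    -- In Γ(Φ) the orbits of z and q are both incident with the orbits of u and v, where u is the
    -- point of U in x^⊥. The latter two orbits differ because Φ fixes the distinct lines x u and x
    -- v, so those of z and q coincide.
    star-from-PLS : GammaDualPLS x → Star
    star-from-PLS pls {U} {V} {v} {N} {q} φ z∈U z∈V U≢V v∈V x∈N v∈N φ∈ q∈U q-aff q~φv =
      let u , u∈U , N′ , x∈N′ , u∈N′ = project (affine-line-∌x z-Aff z∈U)
          N′≢N = λ e → U≢V (line-determined z-Aff z∈U z∈V x∈N (subst (On _) e u∈N′) v∈N u∈U v∈V)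
          v≢x = ≢x z-Aff z∈V v∈V
          ψ , fψ , e = pls u v z q (Col⇒col (N′ , x∈N′ , u∈N′) , ≢x z-Aff z∈U u∈U) (Col⇒col (N , x∈N , v∈N) , v≢x)
            (λ (χ , _ , e) → v≢x (meet-unique N′≢N (subst (λ p → On p N′) e (On-pencil-act χ x∈N′ u∈N′)) v∈N x∈N′ x∈N))
            (Aff⇒Affine z-Aff) (Aff⇒Affine q-aff)
            (incident (U , z∈U , u∈U)) (incident (V , z∈V , v∈V)) (incident (U , q∈U , u∈U))
            (ε , φ , fε , Φ⁻ φ∈ , Col⇒col (subst (λ p → Col p _) (sym (actP-ε q)) q~φv))
      in ψ , Φ⁺ fψ , e
      where
      fε : Frattini ε
      fε = Φ⁻ (has-ε frattini-subgroup)
      incident : ∀ {a w} → Col a w → ΓIncident a w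
      incident c = ε , ε , fε , fε , Col⇒col (subst₂ Col (sym (actP-ε _)) (sym (actP-ε _)) c)

    -- Let A and B be the stabilisers of U and V, and let the maximal subgroup K miss the
    -- A-component a of φ. By (b) some maximal subgroup M contains A ∩ K and B. As M also contains φ
    -- and S, it contains a, and then all of A; but A, S and B generate H.
    star-from-B : ConditionB z → Star
    star-from-B condB {U} {V} {v} {N} {q} φ z∈U z∈V U≢V v∈V x∈N v∈N φ∈ q∈U q-aff q~φv =
      a , Φ⁺ (λ K mK → decidable-stable (a ∈? K) (in-every-maximal K mK)) , az≡q
      where
      a : Fin order
      a = proj₁ (transitive z-Aff q-aff)
      az≡q : actP a z ≡ q
      az≡q = proj₂ (transitive z-Aff q-aff)
      factored : a ∈ Stab U × (∃[ σ ] ∃[ b ] σ ∈ S × b ∈ Stab V × φ ≡ a ∙ (σ ∙ b))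
      factored = factorise-at φ z∈U z∈V v∈V x∈N v∈N (subst (λ p → On p U) (sym az≡q) q∈U) (subst (λ p → Col p _) (sym az≡q) q~φv)
      a∈U : a ∈ Stab U
      a∈U = proj₁ factored
      in-every-maximal : ∀ K → IsMaximal K → ¬ ¬ a ∈ K
      in-every-maximal K mK@(sK , _) a∉K = from-proper (proper-if-not-generating
          (condB U V z∈U z∈V U≢V K mK λ U⊆K → a∉K (U⊆K a a∈U))
          (λ h → ((Stab U h ∧ K h) Bool.≟ true) ⊎-dec (h ∈? Stab V)))
        where
        X : Fin order → Set
        X h = (Stab U h ∧ K h) ≡ true ⊎ Stab V h ≡ true
        from-maximal : ∀ M → IsMaximal M → (∀ h → X h → h ∈ M) → ⊥
        from-maximal M mM@(sM , _) X⊆M = maximal-proper mM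
          (generated-by z∈U z∈V U≢V v∈V x∈N v∈N sM (S⊆maximal mM) U⊆M V⊆M)
          where
          V⊆M : Stab V ⊆ M
          V⊆M h h∈ = X⊆M h (inj₂ h∈)
          a∈M : a ∈ M
          a∈M = let _ , σ , b , σ∈ , b∈ , φ≡ = factored in
            subst (_∈ M) (trans (cong (_∙ (σ ∙ b) ⁻¹) φ≡) (//-rightDividesʳ (σ ∙ b) a))
              (∙-clos sM _ _ (Φ⁻ φ∈ M mM) (⁻¹-clos sM _ (∙-clos sM _ _ (S⊆maximal mM σ σ∈) (V⊆M b b∈))))
          UM? : Decidable (λ h → h ∈ Stab U × h ∈ M)
          UM? h = (h ∈? Stab U) ×-dec (h ∈? M)
          UM : SubsetG
          UM = ⌜ UM? ⌝
          sUM : IsSubgroup UM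
          sUM = ⌜⌝-subgroup UM? (has-ε (Stab-line-subgroup U) , has-ε sM)
            (λ (a , b) (c , d) → ∙-clos (Stab-line-subgroup U) _ _ a c , ∙-clos sM _ _ b d)
            (λ (a , b) → ⁻¹-clos (Stab-line-subgroup U) _ a , ⁻¹-clos sM _ b)
          -- A ∩ K is maximal in A because K is normal, so a ∈ M \ K forces A ≤ M.
          U⊆M : Stab U ⊆ M
          U⊆M h h∈ = from-product (∈⌜⌝⁻ (Product? UM K) (maximal-∌⇒⊇ mK (product-subgroup sUM sK (maximal⇒normal mK)) (⊆-productʳ sUM)
              (⊆-productˡ sK a (∈⌜⌝⁺ UM? (a∈U , a∈M))) a∉K h))
            where
            from-product : Product UM K h → h ∈ M
            from-product (m , k , m∈ , k∈ , h≡) =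
              let m∈U , m∈M = ∈⌜⌝⁻ UM? m∈
                  k≡ = trans (sym (\\-leftDividesʳ m k)) (cong (m ⁻¹ ∙_) (sym h≡))
                  k∈U = subst (_∈ Stab U) (sym k≡) (∙-clos (Stab-line-subgroup U) _ _ (⁻¹-clos (Stab-line-subgroup U) _ m∈U) h∈)
              in subst (_∈ M) (sym h≡) (∙-clos sM _ _ m∈M (X⊆M k (inj₁ (∧-true⁺ k∈U k∈))))
        from-proper : ∃[ M ] IsSubgroup M × (∀ h → X h → h ∈ M) × (∃[ g ] ¬ g ∈ M) → ⊥
        from-proper (M , sM , X⊆M , g , g∉) =
          let M′ , mM′ , M⊆M′ = extends-to-maximal sM g∉
          in from-maximal M′ mM′ λ h e → M⊆M′ h (X⊆M h e)

    star : GammaDualPLS x ⊎ ConditionB z → Star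
    star = [ star-from-PLS , star-from-B ]′

  -- The substructure on the orbit of z under Φ

  module SubQuadrangle (projection : ProjectionLemma S) (generic : Generic S) (condition : GammaDualPLS x ⊎ ConditionB z) where
    open Projection projection generic public

    Base : Fin np → Set
    Base p = ∃[ φ ] φ ∈ Φ × actP φ z ≡ p

    Base? : Decidable Base
    Base? p = any? λ φ → (φ ∈? Φ) ×-dec (actP φ z ≟ᶠ p)

    Shadow : Fin np → Set
    Shadow p = (Col x p × ¬ p ≡ x) × ∃[ φ ] φ ∈ Φ × Col (actP φ z) p

    SubP : Fin np → Set
    SubP p = p ≡ x ⊎ Base p ⊎ Shadow p

    SubP? : Decidable SubP
    SubP? p = (p ≟ᶠ x) ⊎-dec Base? p ⊎-dec ((Col? x p ×-dec ¬? (p ≟ᶠ x)) ×-dec any? λ φ → (φ ∈? Φ) ×-dec Col? (actP φ z) p)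

    SubL : Fin nl → Set
    SubL L = On x L ⊎ ∃[ φ ] φ ∈ Φ × On (actP φ z) L

    SubL? : Decidable SubL
    SubL? L = On? x L ⊎-dec any? λ φ → (φ ∈? Φ) ×-dec On? (actP φ z) L

    Base-Aff : ∀ {p} → Base p → Aff p
    Base-Aff (φ , _ , refl) = Aff-act φ z-Aff

    SubP-Aff : ∀ {p} → SubP p → Aff p → Base p
    SubP-Aff (inj₁ refl) a = contradiction (Col-refl x) a
    SubP-Aff (inj₂ (inj₁ b)) _ = b
    SubP-Aff (inj₂ (inj₂ ((c , _) , _))) a = contradiction c a

    SubP-shadow : ∀ {p} → SubP p → Col x p → ¬ p ≡ x → Shadow p
    SubP-shadow (inj₁ e) _ ne = contradiction e ne
    SubP-shadow (inj₂ (inj₁ b)) c _ = contradiction c (Base-Aff b)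
    SubP-shadow (inj₂ (inj₂ s)) _ _ = s

    actP-inv′ : ∀ g p → actP g (actP (g ⁻¹) p) ≡ p
    actP-inv′ g p = trans (cong (λ h → actP h (actP (g ⁻¹) p)) (sym (⁻¹-involutive g))) (actP-inv (g ⁻¹) p)

    opaque
      -- U is moved back to z by `φ ⁻¹` and the line V, joining v to a base point, by `ψ ⁻¹`; the
      -- element of Φ between them is `φ ⁻¹ ∙ ψ`. The two lines through z differ, as otherwise v
      -- would lie on U.
      star-translate : ∀ {U v q} → (∃[ φ ] φ ∈ Φ × On (actP φ z) U) → Shadow v → ¬ On v U → On q U → Aff q → Col q v → Base q
      star-translate {U} {v} {q} (φ , φ∈ , φz∈U) (((N , x∈N , v∈N) , v≢x) , ψ , ψ∈ , V , ψz∈V , v∈V) v∉U q∈U q-aff q~v =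
        let ρ , ρ∈ , e = star condition (φ ⁻¹ ∙ ψ) z∈U₀ (back ψ ψz∈V) U₀≢V₀ (On-act (ψ ⁻¹) v∈V) x∈N (On-pencil-act (ψ ⁻¹) x∈N v∈N)
              (∙-clos frattini-subgroup _ ψ (⁻¹-clos frattini-subgroup φ φ∈) ψ∈) (On-act (φ ⁻¹) q∈U) (Aff-act (φ ⁻¹) q-aff)
              (subst (Col _) (sym (trans (actP-∙ (φ ⁻¹) ψ _) (cong (actP (φ ⁻¹)) (actP-inv′ ψ v)))) (Col-act (φ ⁻¹) q~v))
        in φ ∙ ρ , ∙-clos frattini-subgroup φ ρ φ∈ ρ∈ , trans (actP-∙ φ ρ z) (trans (cong (actP φ) e) (actP-inv′ φ q))
        where
        back : ∀ g {L} → On (actP g z) L → On z (actL (g ⁻¹) L)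
        back g {L} a = subst (λ p → On p (actL (g ⁻¹) L)) (actP-inv g z) (On-act (g ⁻¹) a)
        z∈U₀ : On z (actL (φ ⁻¹) U)
        z∈U₀ = back φ φz∈U
        U₀≢V₀ : ¬ actL (φ ⁻¹) U ≡ actL (ψ ⁻¹) V
        U₀≢V₀ e = v∉U (On-act⁻ (φ ⁻¹) (subst (λ p → On p (actL (φ ⁻¹) U))
          (foot-unique (Aff-act (φ ⁻¹) q-aff) x∈N (On-pencil-act (ψ ⁻¹) x∈N v∈N) (actL (φ ⁻¹) U , On-act (φ ⁻¹) q∈U , ψv∈U₀)
            (On-pencil-act (φ ⁻¹) x∈N v∈N) (Col-act (φ ⁻¹) q~v)) ψv∈U₀))
          where
          ψv∈U₀ : On (actP (ψ ⁻¹) v) (actL (φ ⁻¹) U)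
          ψv∈U₀ = subst (On _) (sym e) (On-act (ψ ⁻¹) v∈V)

      -- The substructure is full at each of its points. At a point of x^⊥ this holds because S lies
      -- in Φ and is transitive on the lines there other than the one to x.
      lines-in : ∀ {p L} → SubP p → On p L → SubL L
      lines-in (inj₁ refl) p∈L = inj₁ p∈L
      lines-in (inj₂ (inj₁ (φ , φ∈ , refl))) p∈L = inj₂ (φ , φ∈ , p∈L)
      lines-in {p} {L} (inj₂ (inj₂ ((xp@(N , x∈N , p∈N) , _) , φ , φ∈ , M , φz∈M , p∈M))) p∈L with L ≟ᶠ N
      ... | yes refl = inj₁ x∈N
      ... | no L≢N =
        let σ , σ∈ , e = S-transitive xp p∈M (affine-line-∌x (Aff-act φ z-Aff) φz∈M) p∈N x∈N p∈L L≢N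
        in inj₂ (σ ∙ φ , ∙-clos frattini-subgroup σ φ (S⊆Φ σ σ∈) φ∈ , subst₂ On (sym (actP-∙ σ φ z)) e (On-act σ φz∈M))

      -- Closure under projection is what gives the quadrangle axiom inside the substructure. The
      -- difficult case is that of an affine q; on a line through a base point, a q in x^⊥ is a
      -- shadow by definition.
      project-in : ∀ {p L q} → SubP p → SubL L → ¬ On p L → On q L → Col p q → SubP q
      project-in (inj₁ refl) (inj₁ x∈L) x∉L _ _ = contradiction x∈L x∉L
      project-in {q = q} (inj₂ (inj₁ (φ , φ∈ , refl))) (inj₁ x∈L) p∉L q∈L pq =
        inj₂ (inj₂ (((_ , x∈L , q∈L) , λ { refl → Aff-act φ z-Aff (Col-sym pq) }) , φ , φ∈ , pq))
      project-in (inj₂ (inj₂ ((xp , _) , _))) (inj₁ x∈L) p∉L q∈L pq = inj₁ (project-unique p∉L q∈L pq x∈L (Col-sym xp))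
      project-in {p} {L} {q} P (inj₂ l@(φ , φ∈ , φz∈L)) p∉L q∈L pq with Col? x q
      ... | yes xq = inj₂ (inj₂ ((xq , ≢x (Aff-act φ z-Aff) φz∈L q∈L) , φ , φ∈ , L , φz∈L , q∈L))
      ... | no q-aff = inj₂ (inj₁ (affine-case P))
        where
        affine-case : SubP p → Base q
        affine-case (inj₁ refl) = contradiction pq q-aff
        affine-case (inj₂ (inj₂ s)) = star-translate l s p∉L q∈L q-aff (Col-sym pq)
        -- The line joining p and q meets x^⊥ in a shadow v off L. As q is also the projection of v,
        -- this reduces to the case of a shadow.
        affine-case (inj₂ (inj₁ (ψ , ψ∈ , refl))) =
          let N , p∈N , q∈N = pq
              v , v∈N , M , x∈M , v∈M = project (affine-line-∌x q-aff q∈N)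
              v≢x = ≢x q-aff q∈N v∈N
          in star-translate l (((M , x∈M , v∈M) , v≢x) , ψ , ψ∈ , N , p∈N , v∈N)
               (λ v∈L → p∉L (subst (On _) (linear q∈N v∈N q∈L v∈L λ q≡v → q-aff (M , x∈M , subst (λ r → On r M) (sym q≡v) v∈M)) p∈N))
               q∈L q-aff (N , q∈N , v∈N)

    -- Line sizes and the parameters

    points-on? : ∀ L → Decidable (λ p → SubP p × On p L)
    points-on? L p = SubP? p ×-dec On? p L

    opaque
      -- Projection from one line to the other is a bijection and preserves the substructure.
      disjoint-equal : ∀ {L M} → SubL L → SubL M → ¬ Meet L M → # (points-on? L) ≡ # (points-on? M)
      disjoint-equal {L} {M} l m L∥M = double-1 (points-on? L) (points-on? M) R? (λ (a , b , _) → a , b)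
        (λ p (P , p∈L) → let p∉M = λ p∈M → L∥M (p , p∈L , p∈M)
                             q , q∈M , pq = project p∉M
                         in #-unique (R? p) q ((P , p∈L) , (project-in P m p∉M q∈M pq , q∈M) , pq) λ r (_ , (_ , r∈M) , pr) → project-unique p∉M r∈M pr q∈M pq)
        (λ q (Q , q∈M) → let q∉L = λ q∈L → L∥M (q , q∈L , q∈M)
                             p , p∈L , qp = project q∉L
                         in #-unique (λ p → R? p q) p ((project-in Q l q∉L p∈L qp , p∈L) , (Q , q∈M) , Col-sym qp) λ r ((_ , r∈L) , _ , rq) → project-unique q∉L r∈L (Col-sym rq) p∈L qp)
        where
        R? : ∀ p q → Dec ((SubP p × On p L) × (SubP q × On q M) × Col p q)
        R? p q = points-on? L p ×-dec points-on? M q ×-dec Col? p q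

      third-line : ∀ {p K} J → On p K → ∃[ M ] On p M × ¬ M ≡ K × ¬ M ≡ J
      third-line {p} {K} J p∈K with any? (λ M → On? p M ×-dec ¬? (M ≟ᶠ K) ×-dec ¬? (M ≟ᶠ J))
      ... | yes e = e
      ... | no ¬e = contradiction (≤-trans 2≤t (≤-reflexive (sym (other-lines p∈K))))
            (<⇒≱ (s≤s (#≤1 (λ M → On? p M ×-dec ¬? (M ≟ᶠ K)) λ M M′ m m′ → trans (is-J M m) (sym (is-J M′ m′)))))
        where
        is-J : ∀ M → On p M × ¬ M ≡ K → M ≡ J
        is-J M (a , b) = decidable-stable (M ≟ᶠ J) λ c → ¬e (M , a , b , c)

      missing-line : ∀ {y L} → Aff y → On x L → ∃[ U ] On y U × (∀ {M} → On y M → ¬ M ≡ U → ¬ Meet L M)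
      missing-line {y} {L} a x∈L =
        let v , v∈L , v≢x , U , y∈U , v∈U = foot a x∈L in
        U , y∈U , λ {M} y∈M M≢U (r , r∈L , r∈M) → M≢U (line-determined a y∈M y∈U x∈L r∈L v∈L r∈M v∈U)

      -- L and M meet in x, so both are compared with a line through z that meets neither. At most
      -- two of the t + 1 lines through z are excluded, and t ≥ 2 leaves a third.
      pencil-equal : ∀ {L M} → On x L → On x M → # (points-on? L) ≡ # (points-on? M)
      pencil-equal {L} {M} x∈L x∈M =
        let U , z∈U , missL = missing-line z-Aff x∈L
            V , z∈V , missM = missing-line z-Aff x∈M
            W , z∈W , W≢U , W≢V = third-line V z∈U
            w = inj₂ (ε , has-ε frattini-subgroup , subst (λ p → On p W) (sym (actP-ε z)) z∈W)
        in trans (disjoint-equal (inj₁ x∈L) w (missL z∈W W≢U)) (sym (disjoint-equal (inj₁ x∈M) w (missM z∈W W≢V)))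

      line-equal : ∀ {L M} → On x L → SubL M → # (points-on? M) ≡ # (points-on? L)
      line-equal x∈L (inj₁ x∈M) = pencil-equal x∈M x∈L
      line-equal {L} {M} x∈L m@(inj₂ (φ , φ∈ , y∈M)) =
        let v , v∈M , N , x∈N , v∈N = project (affine-line-∌x y-Aff y∈M)
            K , x∈K , K≢N = another-line x∈N
        in trans (disjoint-equal m (inj₁ x∈K) λ (r , r∈M , r∈K) →
             ≢x y-Aff y∈M r∈M (meet-unique K≢N r∈K (subst (λ p → On p N) (project-unique (affine-line-∌x y-Aff y∈M) v∈M (N , x∈N , v∈N) r∈M (K , x∈K , r∈K)) v∈N) x∈K x∈N))
           (pencil-equal x∈K x∈L)
        where
        y-Aff : Aff (actP φ z)
        y-Aff = Aff-act φ z-Aff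

    L₀ : Fin nl
    L₀ = proj₁ (line-through x)

    x∈L₀ : On x L₀
    x∈L₀ = proj₂ (line-through x)

    shadows? : ∀ L → Decidable (λ p → (SubP p × On p L) × ¬ p ≡ x)
    shadows? L p = points-on? L p ×-dec ¬? (p ≟ᶠ x)

    s₁ : ℕ
    s₁ = # (shadows? L₀)

    opaque
      line-size₁ : ∀ {L} → SubL L → # (points-on? L) ≡ suc s₁
      line-size₁ l = trans (line-equal x∈L₀ l) (#-remove (points-on? L₀) x (inj₁ refl , x∈L₀))

      #shadows : ∀ {L} → On x L → # (shadows? L) ≡ s₁
      #shadows {L} x∈L = suc-injective (trans (sym (#-remove (points-on? L) x (inj₁ refl , x∈L))) (line-size₁ (inj₁ x∈L)))

      shadow-of : ∀ {φ v L} → φ ∈ Φ → On x L → On v L → ¬ v ≡ x → Col z v → (SubP (actP φ v) × On (actP φ v) L) × ¬ actP φ v ≡ x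
      shadow-of {φ} φ∈ x∈L v∈L v≢x zv = (inj₂ (inj₂ ((Col-x-act φ (_ , x∈L , v∈L) , ≢x-act φ v≢x) , φ , φ∈ , Col-act φ zv)) , On-pencil-act φ x∈L v∈L) , ≢x-act φ v≢x

      shadow-orbit : ∀ {v L w} → On x L → On v L → Col z v → SubP w → On w L → ¬ w ≡ x → ∃[ φ ] φ ∈ Φ × actP φ v ≡ w
      shadow-orbit x∈L v∈L zv P w∈L w≢x =
        let _ , φ , φ∈ , c = SubP-shadow P (_ , x∈L , w∈L) w≢x
        in φ , φ∈ , foot-unique (Aff-act φ z-Aff) x∈L (On-pencil-act φ x∈L v∈L) (Col-act φ zv) w∈L c

      -- If s₁ were 1, Φ would fix the foot of z on each line through x. Two such feet already force
      -- Φ into S, but Φ contains a commutator outside S.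
      2≤s₁ : 2 ≤ s₁
      2≤s₁ = ≤∧≢⇒< (positive two-lines) λ e → absurd two-lines (sym e)
        where
        fixed : ∀ {L v} φ → s₁ ≡ 1 → φ ∈ Φ → On x L → On v L → ¬ v ≡ x → Col z v → actP φ v ≡ v
        fixed {L} {v} φ e φ∈ x∈L v∈L v≢x zv = #≡1⇒unique (shadows? L) (trans (#shadows x∈L) e) {actP φ v} {v} (shadow-of φ∈ x∈L v∈L v≢x zv)
          (subst (λ p → (SubP p × On p L) × ¬ p ≡ x) (actP-ε v) (shadow-of (has-ε frattini-subgroup) x∈L v∈L v≢x zv))
        positive : ∃[ L ] ∃[ M ] On x L × On x M × ¬ L ≡ M → 1 ≤ s₁
        positive (L , _ , x∈L , _) = let v , v∈L , v≢x , zv = foot z-Aff x∈L in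
          subst (1 ≤_) (#shadows x∈L) (#-positive (shadows? L) _ (shadow-of (has-ε frattini-subgroup) x∈L v∈L v≢x zv))
        absurd : ∃[ L ] ∃[ M ] On x L × On x M × ¬ L ≡ M → ¬ s₁ ≡ 1
        absurd (L , M , x∈L , x∈M , L≢M) e =
          let g , g∈ , g∉ = Φ⊈S
              v , v∈L , v≢x , zv = foot z-Aff x∈L
              w , w∈M , w≢x , zw = foot z-Aff x∈M
          in g∉ (∈S x∈L x∈M L≢M v∈L w∈M v≢x w≢x (fixed g e g∈ x∈L v∈L v≢x zv) (fixed g e g∈ x∈M w∈M w≢x zw))

      #Φ : ∀ {L v} → On x L → On v L → ¬ v ≡ x → Col z v → # (_∈? Φ) ≡ s₁ * # (Fix? Φ v)
      #Φ {L} {v} x∈L v∈L v≢x zv = trans (sym (orbit-stabiliser frattini-subgroup v)) (cong (_* # (Fix? Φ v)) (trans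
        (#-cong (Orb? frattini-subgroup v) (shadows? L) (λ { _ (φ , φ∈ , refl) → shadow-of φ∈ x∈L v∈L v≢x zv })
          (λ w ((P , w∈L) , w≢x) → shadow-orbit x∈L v∈L zv P w∈L w≢x))
        (#shadows x∈L)))

      -- By sharp transitivity the elements of Φ fixing v correspond to the base points collinear
      -- with v, of which there are s₁ on each of the t lines through v other than L.
      #Φ-fixing : ∀ {L v} → On x L → On v L → ¬ v ≡ x → Col z v → # (Fix? Φ v) ≡ t * s₁
      #Φ-fixing {L} {v} x∈L v∈L v≢x zv = trans
          (double-1 (Fix? Φ v) near? (λ φ q → Fix? Φ v φ ×-dec (actP φ z ≟ᶠ q))
            (λ { {φ} (f@(φ∈ , e) , refl) → f , (φ , φ∈ , refl) , subst (λ p → Col p (actP φ z)) e (Col-act φ (Col-sym zv)) })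
            (λ φ f → #-unique (λ q → Fix? Φ v φ ×-dec (actP φ z ≟ᶠ q)) (actP φ z) (f , refl) λ _ (_ , e) → sym e)
            (λ { q ((φ , φ∈ , refl) , vq) → #-unique (λ ψ → Fix? Φ v ψ ×-dec (actP ψ z ≟ᶠ q)) φ
                   ((φ∈ , foot-unique (Aff-act φ z-Aff) x∈L (On-pencil-act φ x∈L v∈L) (Col-act φ zv) v∈L (Col-sym vq)) , refl)
                   λ ψ (_ , e) → free z-Aff e }))
          (trans (sym (*-identityʳ _)) (trans (sym (double-≡ (λ M → On? v M ×-dec ¬? (M ≟ᶠ L)) near? R? {s₁} {1}
            (λ (a , b , q∈M) → a , b , _ , proj₁ a , q∈M)
            row
            (λ { q (b , M , v∈M , q∈M) → #-unique (λ M → R? M q) M ((v∈M , λ e → Base-Aff b (L , x∈L , subst (On q) e q∈M)) , b , q∈M)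
               λ { K ((v∈K , _) , _ , q∈K) → linear q∈K v∈K q∈M v∈M (q≢v b) } })))
            (cong (_* s₁) (other-lines v∈L))))
        where
        near? : Decidable (λ q → Base q × Col v q)
        near? q = Base? q ×-dec Col? v q
        R? : ∀ M q → Dec ((On v M × ¬ M ≡ L) × Base q × On q M)
        R? M q = (On? v M ×-dec ¬? (M ≟ᶠ L)) ×-dec Base? q ×-dec On? q M
        q≢v : ∀ {q} → Base q → ¬ q ≡ v
        q≢v b refl = Base-Aff b (L , x∈L , v∈L)
        V : SubP v
        V = subst SubP (actP-ε v) (proj₁ (proj₁ (shadow-of (has-ε frattini-subgroup) x∈L v∈L v≢x zv)))
        row : ∀ M → On v M × ¬ M ≡ L → # (R? M) ≡ s₁
        row M m@(v∈M , M≢L) = suc-injective (trans (cong suc (#-cong (R? M) (λ q → points-on? M q ×-dec ¬? (q ≟ᶠ v))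
            (λ q (_ , b , q∈M) → (inj₂ (inj₁ b) , q∈M) , q≢v b)
            (λ q ((Q , q∈M) , q≢v) → m , SubP-Aff Q (λ xq → q≢v (project-unique (λ x∈M → M≢L (linear v∈M x∈M v∈L x∈L v≢x)) q∈M xq v∈M (L , x∈L , v∈L))) , q∈M)))
          (trans (sym (#-remove (points-on? M) v (V , v∈M))) (line-size₁ (lines-in V v∈M))))

      t≤s₁ : t ≤ s₁
      -- Φ has order s₁² t, the relevant stabilisers have order s₁ t, and Φ ∩ S is S of order t; so
      -- a = s₁ and b = c = t.
      t≤s₁ = partition-arithmetic 2≤s₁ 1≤t ≤-refl
        (subst₂ (λ c n → suc t * (s₁ * t ∸ c) + c ≤ n) #Φ∩S total (partition-bound Φ {s₁ * t} λ L x∈L →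
          let v , v∈L , v≢x , zv = foot z-Aff x∈L
          in v , (v∈L , v≢x) , ≤-reflexive (trans (*-comm s₁ t) (sym (#Φ-fixing x∈L v∈L v≢x zv)))))
        where
        #Φ∩S : # (K∩S? Φ) ≡ t
        #Φ∩S = trans (#-cong (K∩S? Φ) (_∈? S) (λ _ → proj₂) (λ σ σ∈ → S⊆Φ σ σ∈ , σ∈)) #S
        total : # (_∈? Φ) ≡ s₁ * s₁ * t
        total = let v , v∈L , v≢x , zv = foot z-Aff x∈L₀ in
          trans (#Φ x∈L₀ v∈L v≢x zv) (trans (cong (s₁ *_) (trans (#Φ-fixing x∈L₀ v∈L v≢x zv) (*-comm t s₁))) (sym (*-assoc s₁ s₁ t)))

      -- An affine point outside the subquadrangle lies on at most one of its lines.
      outer-line : ∃[ L ] ¬ SubL L × ∃[ r ] On r L × Aff r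
      outer-line =
        let g , g∉ = Φ-proper
            r-aff = Aff-act g z-Aff
            N , r∈N = line-through (actP g z)
            N′ , r∈N′ , N′≢N = another-line r∈N
        in pick g∉ r-aff r∈N r∈N′ N′≢N
        where
        pick : ∀ {g N N′} → ¬ g ∈ Φ → Aff (actP g z) → On (actP g z) N → On (actP g z) N′ → ¬ N′ ≡ N → ∃[ L ] ¬ SubL L × ∃[ r ] On r L × Aff r
        pick {g} {N} {N′} g∉ r-aff r∈N r∈N′ N′≢N with SubL? N | SubL? N′
        ... | no ¬l | _ = N , ¬l , _ , r∈N , r-aff
        ... | yes _ | no ¬l = N′ , ¬l , _ , r∈N′ , r-aff
        ... | yes (inj₁ x∈N) | yes _ = contradiction x∈N (affine-line-∌x r-aff r∈N)
        ... | yes (inj₂ (φ , φ∈ , φz∈N)) | yes l′ = contradiction (SubP-Aff (project-in {actP φ z} {N′} {actP g z} (inj₂ (inj₁ (φ , φ∈ , refl))) l′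
                (λ φz∈N′ → N′≢N (linear r∈N′ φz∈N′ r∈N φz∈N r≢φz)) r∈N′ (N , φz∈N , r∈N)) r-aff)
                λ (ψ , ψ∈ , e) → g∉ (subst (_∈ Φ) (free z-Aff e) ψ∈)
          where
          r≢φz : ¬ actP g z ≡ actP φ z
          r≢φz e = g∉ (subst (_∈ Φ) (sym (free z-Aff e)) φ∈)

      -- Project the points of x^⊥ in the subquadrangle, off the line N through x meeting an outer line L, onto L.
      ts₁≤s : t * s₁ ≤ s
      ts₁≤s =
        let L , ¬l , r , r∈L , r-aff = outer-line
            y , y∈L , N , x∈N , y∈N = project (affine-line-∌x r-aff r∈L)
        in bound ¬l (affine-line-∌x r-aff r∈L) (≢x r-aff r∈L y∈L) y∈L x∈N y∈N
        where
        bound : ∀ {L y N} → ¬ SubL L → ¬ On x L → ¬ y ≡ x → On y L → On x N → On y N → t * s₁ ≤ s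
        bound {L} {y} {N} ¬l x∉L y≢x y∈L x∈N y∈N = begin
          t * s₁            ≡⟨ cong (_* s₁) (sym (other-lines x∈N)) ⟩
          # (λ K → On? x K ×-dec ¬? (K ≟ᶠ N)) * s₁   ≡⟨ double-≡ (λ K → On? x K ×-dec ¬? (K ≟ᶠ N)) outer? R? {s₁} {1}
              (λ (k , P , p∈K) → k , P , _ , k , p∈K)
              (λ K k → trans (#-cong (R? K) (shadows? K) (λ _ (_ , (P , ne) , p∈K) → (P , p∈K) , ne) (λ _ ((P , p∈K) , ne) → k , (P , ne) , p∈K)) (#shadows (proj₁ k)))
              (λ { p ((Q , ne) , K , k , p∈K) → #-unique (λ K → R? K p) K (k , (Q , ne) , p∈K) λ { J ((x∈J , _) , _ , p∈J) → linear p∈J x∈J p∈K (proj₁ k) ne } }) ⟩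
          # outer? * 1      ≤⟨ double-≤ outer? target? T? {1} {1} proj₂ row column ⟩
          # target? * 1     ≡⟨ *-identityʳ _ ⟩
          # target?         ≡⟨ other-points y∈L ⟩
          s                 ∎
          where
          open ≤-Reasoning
          Outer : Fin np → Set
          Outer p = (SubP p × ¬ p ≡ x) × ∃[ K ] (On x K × ¬ K ≡ N) × On p K
          outer? : Decidable Outer
          outer? p = (SubP? p ×-dec ¬? (p ≟ᶠ x)) ×-dec any? λ K → (On? x K ×-dec ¬? (K ≟ᶠ N)) ×-dec On? p K
          R? : ∀ K p → Dec ((On x K × ¬ K ≡ N) × (SubP p × ¬ p ≡ x) × On p K)
          R? K p = (On? x K ×-dec ¬? (K ≟ᶠ N)) ×-dec (SubP? p ×-dec ¬? (p ≟ᶠ x)) ×-dec On? p K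
          target? : Decidable (λ q → On q L × ¬ q ≡ y)
          target? q = On? q L ×-dec ¬? (q ≟ᶠ y)
          T? : ∀ p q → Dec ((Outer p × Col p q) × On q L × ¬ q ≡ y)
          T? p q = (outer? p ×-dec Col? p q) ×-dec target? q
          row : ∀ p → Outer p → 1 ≤ # (T? p)
          row p o@((P , ne) , K , (x∈K , K≢N) , p∈K) =
            let q , q∈L , pq = project {p} {L} λ p∈L → ¬l (lines-in P p∈L)
            in #-positive (T? p) q ((o , pq) , q∈L , λ q≡y → cross x∈K x∈N K≢N p∈K y∈N ne y≢x (subst (Col p) q≡y pq))
          column : ∀ q → On q L × ¬ q ≡ y → # (λ p → T? p q) ≤ 1
          column q (q∈L , q≢y) = #≤1 (λ p → T? p q)
            λ { p p′ ((((P , ne) , K , (x∈K , _) , p∈K) , J , p∈J , q∈J) , _) ((((P′ , ne′) , K′ , (x∈K′ , _) , p′∈K′) , J′ , p′∈J′ , q∈J′) , _) →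
                same P P′ (K , x∈K , p∈K) (K′ , x∈K′ , p′∈K′) p∈J q∈J p′∈J′ q∈J′ }
            where
            ¬Q : ¬ SubP q
            ¬Q Q = ¬l (lines-in Q q∈L)
            q-aff : Aff q
            q-aff xq = q≢y (project-unique x∉L q∈L xq y∈L (N , x∈N , y∈N))
            -- If p and p′ lie on one line with q, both are the projection of x onto it. Otherwise q
            -- is the projection of p onto a line of the substructure and would itself belong to it,
            -- and L with it.
            same : ∀ {p p′ J J′} → SubP p → SubP p′ → Col x p → Col x p′ → On p J → On q J → On p′ J′ → On q J′ → p ≡ p′
            same {p} {p′} {J} {J′} P P′ xp xp′ p∈J q∈J p′∈J′ q∈J′ with On? p J′
            ... | yes p∈J′ = project-unique (affine-line-∌x q-aff q∈J′) p∈J′ xp p′∈J′ xp′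
            ... | no p∉J′ = contradiction (project-in P (lines-in P′ p′∈J′) p∉J′ q∈J′ (J , p∈J , q∈J)) ¬Q

      s₁≡t : s₁ ≡ t
      s₁≡t = ≤-antisym (*-cancelˡ-≤ t {{>-nonZero 1≤t}} (≤-trans ts₁≤s s≤t²)) t≤s₁

      s≡t² : s ≡ t * t
      s≡t² = ≤-antisym s≤t² (subst (λ n → t * n ≤ s) s₁≡t ts₁≤s)

    -- The substructure as an elation quadrangle for Φ

    P′ : Fin np → Bool
    P′ p = does (SubP? p)

    L′ : Fin nl → Bool
    L′ L = does (SubL? L)

    SubP-act : ∀ {φ p} → φ ∈ Φ → SubP p → SubP (actP φ p)
    SubP-act {φ} φ∈ (inj₁ refl) = inj₁ (fixes-x φ)
    SubP-act {φ} φ∈ (inj₂ (inj₁ (ψ , ψ∈ , refl))) = inj₂ (inj₁ (φ ∙ ψ , ∙-clos frattini-subgroup φ ψ φ∈ ψ∈ , actP-∙ φ ψ z))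
    SubP-act {φ} {p} φ∈ (inj₂ (inj₂ ((xp , ne) , ψ , ψ∈ , c))) = inj₂ (inj₂ ((Col-x-act φ xp , ≢x-act φ ne) ,
      φ ∙ ψ , ∙-clos frattini-subgroup φ ψ φ∈ ψ∈ , subst (λ q → Col q (actP φ p)) (sym (actP-∙ φ ψ z)) (Col-act φ c)))

    SubL-act : ∀ {φ L} → φ ∈ Φ → SubL L → SubL (actL φ L)
    SubL-act {φ} {L} φ∈ (inj₁ x∈L) = inj₁ (subst (On x) (sym (fixesLinesThroughX φ L x∈L)) x∈L)
    SubL-act {φ} {L} φ∈ (inj₂ (ψ , ψ∈ , a)) = inj₂ (φ ∙ ψ , ∙-clos frattini-subgroup φ ψ φ∈ ψ∈ , subst (λ q → On q (actL φ L)) (sym (actP-∙ φ ψ z)) (On-act φ a))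

    sub-col : ∀ {p q} → SubP p → Col p q → col L′ p q ≡ true
    sub-col P (L , p∈L , q∈L) = col⁺ L′ (dec-true (SubL? L) (lines-in P p∈L)) p∈L q∈L

    sub-col⁻ : ∀ {p q} → col L′ p q ≡ true → Col p q
    sub-col⁻ e = let L , _ , a , b = col⁻ L′ e in L , a , b

    sub-affine : ∀ {p} → Affine P′ L′ x p → Base p
    sub-affine {p} (P , c) = SubP-Aff (does⁻ (SubP? p) P) λ xp → contradiction (trans (sym c) (sub-col (inj₁ refl) xp)) λ ()

    sub-quadrangle : IsGQ P′ L′ t t
    sub-quadrangle = record
      { lineSize = λ L l → trans (count≡# (λ p → P′ p ∧ I p L) (points-on? L)
          (λ p e → let a , b = ∧-true⁻ e in does⁻ (SubP? p) a , b) (λ p (a , b) → ∧-true⁺ (dec-true (SubP? p) a) b))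
          (trans (line-size₁ (does⁻ (SubL? L) l)) (cong suc s₁≡t))
      ; pointDeg = λ p P → trans (count≡# (λ L → L′ L ∧ I p L) (On? p)
          (λ L e → proj₂ (∧-true⁻ {L′ L} e)) (λ L a → ∧-true⁺ (dec-true (SubL? L) (lines-in (does⁻ (SubP? p) P) a)) a)) (point-degree p)
      ; gqAxiom = λ p L P l e → axiom (does⁻ (SubP? p) P) (does⁻ (SubL? L) l) λ a → contradiction (trans (sym e) a) λ () }
      where
      axiom : ∀ {p L} → SubP p → SubL L → ¬ On p L → count (λ q → P′ q ∧ (I q L ∧ col L′ p q)) ≡ 1
      axiom {p} {L} P l p∉L =
        let q , q∈L , pq = project p∉L
        in trans (count≡# (λ q → P′ q ∧ (I q L ∧ col L′ p q)) (λ q → On? q L ×-dec Col? p q)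
             (λ q e → let _ , f = ∧-true⁻ {P′ q} e
                          a , b = ∧-true⁻ f in a , sub-col⁻ b)
             (λ q (a , b) → ∧-true⁺ (dec-true (SubP? q) (project-in P l p∉L a b)) (∧-true⁺ a (sub-col P b))))
           (#-unique (λ q → On? q L ×-dec Col? p q) q (q∈L , pq) λ r (r∈L , pr) → project-unique p∉L r∈L pr q∈L pq)

    frattini-elation : PhiSubSTGQ x t P′ L′
    frattini-elation = record
      { subGQ = sub-quadrangle
      ; hasX = dec-true (SubP? x) (inj₁ refl)
      ; stabP = λ φ f p → does-⇔ (mk⇔ (λ P → subst SubP (actP-inv φ p) (SubP-act (⁻¹-clos frattini-subgroup φ (Φ⁺ f)) P)) (SubP-act (Φ⁺ f)))
          (SubP? (actP φ p)) (SubP? p)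
      ; stabL = λ φ f L → does-⇔ (mk⇔ (λ l → subst SubL (actL-inv φ L) (SubL-act (⁻¹-clos frattini-subgroup φ (Φ⁺ f)) l)) (SubL-act (Φ⁺ f)))
          (SubL? (actL φ L)) (SubL? L)
      ; fixesLinesThroughX = λ φ _ L _ x∈L → fixesLinesThroughX φ L x∈L
      ; sharplyTransitive = λ p q a b →
          let φ , φ∈ , e = sub-affine a
              ψ , ψ∈ , e′ = sub-affine b
              ψφ⁻¹p≡q = trans (actP-∙ ψ (φ ⁻¹) p) (trans (cong (actP ψ) (trans (cong (actP (φ ⁻¹)) (sym e)) (actP-inv φ z))) e′)
          in ψ ∙ φ ⁻¹ , Φ⁻ (∙-clos frattini-subgroup ψ _ ψ∈ (⁻¹-clos frattini-subgroup φ φ∈)) , ψφ⁻¹p≡q ,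
             λ χ _ e″ → free (Base-Aff (sub-affine a)) (trans e″ (sym ψφ⁻¹p≡q))
      ; symGroup = S , S-subgroup , (λ σ σ∈ → Φ⁻ (S⊆Φ σ σ∈)) , S-size , λ σ σ∈ p _ c → S-fixes σ∈ (sub-col⁻ c) }

mainTheorem4 : ∀ {np nl : ℕ} (I : Fin np → Fin nl → Bool) (s t : ℕ)
    (G : FinGroup) (A : Action G I) (x z : Fin np)
    (S : Fin (FinGroup.order G) → Bool) →
    Geometry.IsGQ I (Geometry.allP I) (Geometry.allL I) s t →
    2 ≤ s → 2 ≤ t →
    STGQ.IsEGQ I G A x →
    STGQ.IsSymmetryGroup I G A x S t →
    STGQ.Generic I G A S →
    STGQ.ProjectionLemma I G A S →
    Geometry.Affine I (Geometry.allP I) (Geometry.allL I) x z →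
    (STGQ.GammaDualPLS I G A x ⊎ STGQ.ConditionB I G A z) →
    Σ (Fin np → Bool) (λ P' → Σ (Fin nl → Bool) (λ L' →
    STGQ.PhiSubSTGQ I G A x t P' L'))
    × (s ≡ t * t)
mainTheorem4 I s t G A x z S gq 2≤s 2≤t egq symmetries generic projection z-affine condition =
  (P′ , L′ , frattini-elation) , s≡t²
  where
  open Setting I s t G A x z S gq 2≤s 2≤t egq symmetries z-affine
  open SubQuadrangle projection generic condition
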